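{- Let $d$ be odd, let $k\ge 1$ with $d-2k\ge 3$, and put $\delta=\frac{d-1}{2}$. Let $L=BW_d$, let $t\in G_d$ be an involution of defect $k$ with positive trace on $\mathbb Q\otimes L$, and let $f\in R_d$ be a fourvolution commuting with $t$. For $\varepsilon\in\{+,-\}$ set $M_\varepsilon=L^\varepsilon(t)+P^\varepsilon(L)(f-1)$. Then: (i) the minimum norm of $M_\varepsilon$ is $2^{\delta-1}$; (ii) a vector $v\in M_\varepsilon$ is a minimal vector of $M_\varepsilon$ if and only if $v(f-1)$ is a minimal vector of $L^\varepsilon(t)$ (equivalently, $v(f-1)$ is a minimal vector of $BW_d$ lying in $L^\varepsilon(t)$); (iii) the minimal vectors of $M_\varepsilon$ lie in $M_\varepsilon\setminus L^\varepsilon(t)$.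
   Context: Let $\Omega=\mathbb F_2^d$ (affine space); $RM(k,d)$ is the Reed–Muller code spanned (in the power set of $\Omega$ under symmetric difference) by affine subspaces of codimension at most $k$. $V=\mathbb R^\Omega$ has basis $v_i$ with $(v_i,v_j)=2^{\lfloor d/2\rfloor}\delta_{ij}$, $v_A=\sum_{i\in A}v_i$; $\varepsilon_S$ negates $v_i$ for $i\in S$ and fixes the others; $\tau_c:v_i\mapsto v_{i+c}$. $BW_d$ is the $\mathbb Z$-span of all $2^{ -m}v_A\varepsilon_S$, $m\ge 0$, $A$ affine of dimension $2m$, $S\in RM(2,d)$; its minimum norm is $2^{\lfloor d/2\rfloor}$. $R_d$ is the extraspecial group of order $2^{1+2d}$ generated by the $\varepsilon_S$ ($S\in RM(1,d)$) and the $\tau_c$. $G_d$ is the Bolt–Room–Wall group, a subgroup of $O(BW_d)$ of shape $2^{1+2d}_+.\Omega^+(2d,2)$ with largest normal 2-subgroup $R_d$. A fourvolution is an isometry $f$ with $f^2=-1$. The defect of an involution $t\in G_d$ is $d-e$ where $2e$ is the dimension of the fixed space of conjugation by $t$ on $R_d/Z(R_d)\cong\mathbb F_2^{2d}$. $L^\varepsilon(t)=\{x\in L:xt=\varepsilon x\}$ and $P^\varepsilon$ is the orthogonal projection of $\mathbb Q\otimes L$ onto $\mathbb Q\otimes L^\varepsilon(t)$. -}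

module Defs where

open import Data.Bool using (Bool; true; false; if_then_else_; _xor_; _∧_; _∨_; not)
open import Data.Nat as ℕ using (ℕ; zero; suc; _∸_; _^_; _%_)
open import Data.Integer using (+_)
open import Data.Rational using (ℚ; 0ℚ; 1ℚ; ½; _/_; -_)
import Data.Rational as Q
open import Data.List using (List; []; _∷_; _++_; map; foldr)
open import Data.Vec using (Vec; []; _∷_; zipWith; replicate; lookup)
open import Data.Vec.Relation.Unary.All using (All)
open import Data.Product using (Σ; _×_; _,_; ∃)
open import Data.Sum using (_⊎_)
open import Relation.Binary.PropositionalEquality using (_≡_)
open import Relation.Nullary using (¬_)

Ω : ℕ → Set
Ω d = Vec Bool d

allVecs : (d : ℕ) → List (Vec Bool d)
allVecs zero    = [] ∷ []
allVecs (suc d) = map (false ∷_) (allVecs d) ++ map (true ∷_) (allVecs d)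

_⊕_ : ∀ {d} → Vec Bool d → Vec Bool d → Vec Bool d
_⊕_ = zipWith _xor_

zeroV : ∀ {d} → Vec Bool d
zeroV = replicate _ false

_==v_ : ∀ {d} → Vec Bool d → Vec Bool d → Bool
[] ==v [] = true
(a ∷ u) ==v (b ∷ w) = not (a xor b) ∧ (u ==v w)

anyL : ∀ {A : Set} → (A → Bool) → List A → Bool
anyL p = foldr (λ a r → p a ∨ r) false

combo : ∀ {d r} → Vec Bool r → Vec (Vec Bool d) r → Vec Bool d
combo [] [] = zeroV
combo (c ∷ cs) (b ∷ bs) = (if c then b else zeroV) ⊕ combo cs bs

LinIndep : ∀ {d r} → Vec (Vec Bool d) r → Set
LinIndep {d} {r} bs = (c : Vec Bool r) → combo c bs ≡ zeroV → c ≡ replicate r false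

record Aff (d r : ℕ) : Set where
  constructor aff
  field
    base  : Vec Bool d
    dirs  : Vec (Vec Bool d) r
    indep : LinIndep dirs

inAff : ∀ {d r} → Aff d r → Ω d → Bool
inAff {d} {r} A p = anyL (λ c → p ==v (Aff.base A ⊕ combo c (Aff.dirs A))) (allVecs r)

Subset : ℕ → Set
Subset d = Ω d → Bool

_≈s_ : ∀ {d} → Subset d → Subset d → Set
S ≈s T = ∀ i → S i ≡ T i

AffCodim≤ : ℕ → ℕ → Set
AffCodim≤ k d = Σ ℕ λ r → Aff d r × (d ℕ.≤ r ℕ.+ k)

symDiffAll : ∀ {k d} → List (AffCodim≤ k d) → Subset d
symDiffAll [] i = false
symDiffAll ((r , A , _) ∷ As) i = inAff A i xor symDiffAll As i

InRM : (k d : ℕ) → Subset d → Set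
InRM k d S = Σ (List (AffCodim≤ k d)) λ As → S ≈s symDiffAll As

-- V = ℚ^Ω (rational suffices: all lattices involved are rational)

Vect : ℕ → Set
Vect d = Ω d → ℚ

sumΩ : (d : ℕ) → (Ω d → ℚ) → ℚ
sumΩ d f = foldr (λ i r → f i Q.+ r) 0ℚ (allVecs d)

_≈v_ : ∀ {d} → Vect d → Vect d → Set
x ≈v y = ∀ i → x i ≡ y i

0v : ∀ {d} → Vect d
0v _ = 0ℚ

_+v_ : ∀ {d} → Vect d → Vect d → Vect d
(x +v y) i = x i Q.+ y i

-v_ : ∀ {d} → Vect d → Vect d
(-v x) i = - x i

_*v_ : ∀ {d} → ℚ → Vect d → Vect d
(q *v x) i = q Q.* x i

pow2 : ℕ → ℚ
pow2 n = (+ (2 ^ n)) / 1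

halfPow : ℕ → ℚ
halfPow zero = 1ℚ
halfPow (suc m) = ½ Q.* halfPow m

ip : (d : ℕ) → Vect d → Vect d → ℚ
ip d x y = pow2 (d ℕ./ 2) Q.* sumΩ d (λ i → x i Q.* y i)

norm : (d : ℕ) → Vect d → ℚ
norm d x = ip d x x

-- Linear maps (matrices, acting on row vectors from the right: x ↦ x g)

Mat : ℕ → Set
Mat d = Ω d → Ω d → ℚ

_≈m_ : ∀ {d} → Mat d → Mat d → Set
M ≈m N = ∀ i j → M i j ≡ N i j

_·_ : ∀ {d} → Vect d → Mat d → Vect d
_·_ {d} x M j = sumΩ d (λ i → x i Q.* M i j)

_∘m_ : ∀ {d} → Mat d → Mat d → Mat d
_∘m_ {d} M N i j = sumΩ d (λ k → M i k Q.* N k j)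

idM : ∀ {d} → Mat d
idM i j = if i ==v j then 1ℚ else 0ℚ

negM : ∀ {d} → Mat d → Mat d
negM M i j = - M i j

transpose : ∀ {d} → Mat d → Mat d
transpose M i j = M j i

trace : (d : ℕ) → Mat d → ℚ
trace d M = sumΩ d (λ i → M i i)

epsM : ∀ {d} → Subset d → Mat d
epsM S i j = if i ==v j then (if S i then - 1ℚ else 1ℚ) else 0ℚ

tauM : ∀ {d} → Ω d → Mat d
tauM c i j = if j ==v (i ⊕ c) then 1ℚ else 0ℚ

bwGen : ∀ {d} (m : ℕ) → Aff d (2 ℕ.* m) → Subset d → Vect d
bwGen m A S i = if inAff A i then halfPow m Q.* (if S i then - 1ℚ else 1ℚ) else 0ℚ

data InBW (d : ℕ) : Vect d → Set where
  bw-gen  : (m : ℕ) (A : Aff d (2 ℕ.* m)) (S : Subset d) → InRM 2 d S → InBW d (bwGen m A S)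
  bw-zero : InBW d 0v
  bw-add  : ∀ {x y} → InBW d x → InBW d y → InBW d (x +v y)
  bw-neg  : ∀ {x} → InBW d x → InBW d (-v x)
  bw-resp : ∀ {x y} → x ≈v y → InBW d x → InBW d y

data InR (d : ℕ) : Mat d → Set where
  r-eps  : (S : Subset d) → InRM 1 d S → InR d (epsM S)
  r-tau  : (c : Ω d) → InR d (tauM c)
  r-id   : InR d idM
  r-comp : ∀ {M N} → InR d M → InR d N → InR d (M ∘m N)
  r-resp : ∀ {M N} → M ≈m N → InR d M → InR d N

IsIsometry : (d : ℕ) → Mat d → Set
IsIsometry d g = ∀ x y → ip d (x · g) (y · g) ≡ ip d x y

-- Bolt–Room–Wall group G_d: isometries of V preserving BW_d and normalising R_d
-- (for an isometry the inverse is the transpose)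
InG : (d : ℕ) → Mat d → Set
InG d g = IsIsometry d g
        × (∀ x → InBW d x → InBW d (x · g))
        × (∀ x → InBW d x → InBW d (x · transpose g))
        × (∀ r → InR d r → InR d ((transpose g ∘m r) ∘m g))
        × (∀ r → InR d r → InR d ((g ∘m r) ∘m transpose g))

IsInvolution : ∀ {d} → Mat d → Set
IsInvolution t = (t ∘m t) ≈m idM × ¬ (t ≈m idM)

IsFourvolution : ∀ {d} → Mat d → Set
IsFourvolution f = (f ∘m f) ≈m negM idM

-- Defect: fixed space of conjugation by t on R_d / Z(R_d), Z(R_d) = {±1}

-- r ∈ R_d whose class in R_d/Z is fixed by conjugation by t (t⁻¹ = t)
FixedMod : (d : ℕ) → Mat d → Mat d → Set
FixedMod d t r = InR d r × (((t ∘m r) ∘m t) ≈m r ⊎ ((t ∘m r) ∘m t) ≈m negM r)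

-- product of the selected elements ∏_{cᵢ = 1} rᵢ (this is addition in R_d/Z)
prodSel : ∀ {d n} → Vec Bool n → Vec (Mat d) n → Mat d
prodSel [] [] = idM
prodSel (c ∷ cs) (r ∷ rs) = (if c then r else idM) ∘m prodSel cs rs

InZ : ∀ {d} → Mat d → Set
InZ M = M ≈m idM ⊎ M ≈m negM idM

-- the fixed space has F₂-dimension n: it has a basis of n elements
FixedDim : (d : ℕ) → Mat d → ℕ → Set
FixedDim d t n =
  Σ (Vec (Mat d) n) λ rs →
      All (FixedMod d t) rs
    × (∀ (c : Vec Bool n) → InZ (prodSel c rs) → c ≡ replicate n false)
    × (∀ r → FixedMod d t r → Σ (Vec Bool n) λ c → (r ≈m prodSel c rs ⊎ r ≈m negM (prodSel c rs)))

HasDefect : (d : ℕ) → Mat d → ℕ → Set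
HasDefect d t k = k ℕ.≤ d × FixedDim d t (2 ℕ.* (d ∸ k))

data Sgn : Set where
  plus minus : Sgn

sgn : ∀ {d} → Sgn → Vect d → Vect d
sgn plus  x = x
sgn minus x = -v x

Leps : (d : ℕ) → Mat d → Sgn → Vect d → Set
Leps d t ε x = InBW d x × (x · t) ≈v sgn ε x

data QSpan {d : ℕ} (P : Vect d → Set) : Vect d → Set where
  qs-zero : QSpan P 0v
  qs-gen  : ∀ q {x} → P x → QSpan P (q *v x)
  qs-add  : ∀ {x y} → QSpan P x → QSpan P y → QSpan P (x +v y)
  qs-resp : ∀ {x y} → x ≈v y → QSpan P x → QSpan P y

IsOrthProj : (d : ℕ) → (Vect d → Set) → Vect d → Vect d → Set
IsOrthProj d P x z = QSpan P z × (∀ y → QSpan P y → ip d (x +v (-v z)) y ≡ 0ℚ)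

InPL : (d : ℕ) → Mat d → Sgn → Vect d → Set
InPL d t ε z = Σ (Vect d) λ x → InBW d x × IsOrthProj d (Leps d t ε) x z

timesFm1 : ∀ {d} → Vect d → Mat d → Vect d
timesFm1 v f = (v · f) +v (-v v)

InM : (d : ℕ) → Mat d → Mat d → Sgn → Vect d → Set
InM d t f ε v = Σ (Vect d) λ a → Σ (Vect d) λ z →
  Leps d t ε a × InPL d t ε z × v ≈v (a +v (timesFm1 z f))

_≤q_ : ℚ → ℚ → Set
_≤q_ = Q._≤_

HasMinNorm : (d : ℕ) → (Vect d → Set) → ℚ → Set
HasMinNorm d P μ =
    (Σ (Vect d) λ v → P v × ¬ (v ≈v 0v) × norm d v ≡ μ)
  × (∀ v → P v → ¬ (v ≈v 0v) → μ ≤q norm d v)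

IsMinimalVec : (d : ℕ) → (Vect d → Set) → Vect d → Set
IsMinimalVec d P v = P v × ¬ (v ≈v 0v) × (∀ w → P w → ¬ (w ≈v 0v) → norm d v ≤q norm d w)

{-# OPTIONS --safe #-}
-- For v = a + z(f − 1) in M_ε one has v(f − 1) = a(f − 1) − 2zf ∈ L^ε(t), because f² = −1 and
-- 2z = x + εxt for the x ∈ L that projects to z.  As f − 1 doubles norms and BW_d has minimum
-- norm 2^⌊d/2⌋, all three claims follow once one vector of norm 2^(δ−1) is found in M_ε.
--
-- Let W = [R/Z, t].  Since tr t ≠ 0, conjugation shows that the commutators w ∈ W are involutions
-- and that an element of R centralizing t modulo Z centralizes t.  Starting from a basis vector,
-- replace y by y + wy whenever w ∈ W moves the line of y; this ends with a minimal vector y of L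
-- (up to scale; f repairs the parity) which is an eigenvector of all w ∈ W, hence of t.
-- As k ≥ 1 there are r, s ∈ R with [r, [s, t]] = −1.  Then y, yr, ys, yrs are eigenvectors of t,
-- the product of their signs is −1, and half their sum is some x ∈ L.  So x + εxt is either a
-- single minimal vector u or a sum u + p + q with (p + q)(f − 1)/2 ∈ L^ε(t), and in both
-- cases u(f − 1)/2 ∈ M_ε.
module Submission where

open import Defs
open import Data.Bool using (Bool; true; false; if_then_else_; _xor_; _∧_; _∨_; not)
open import Data.Bool.Properties using (xor-assoc; xor-comm; xor-same; xor-identityʳ; ∧-distribˡ-xor; ∧-comm; ∧-zeroʳ; ∧-distribˡ-∨; ∨-identityʳ)
open import Data.Bool.Solver using (module xor-∧-Solver)
open import Data.Nat as ℕ using (ℕ; zero; suc; z≤n; s≤s)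
import Data.Nat.Properties as ℕₚ
open import Data.Nat.DivMod using (m≡m%n+[m/n]*n; m*n/n≡m; /-monoˡ-≤)
import Data.Integer as ℤ
import Data.Integer.Properties as ℤₚ
open import Data.Rational using (ℚ; 0ℚ; 1ℚ; ½; _+_; _*_; -_; _-_; _≤_; _<_; _/_; 1/_; ≢-nonZero; nonNegative; nonPositive; positive; Positive; *≤*)
open import Data.Rational.Properties
open import Data.Rational.Solver using (module +-*-Solver)
open import Data.Rational.Unnormalised using (mkℚᵘ; *≡*)
import Data.Rational.Unnormalised.Properties as ℚᵘₚ
open import Data.Fin using (Fin; zero; suc; combine; remQuot)
open import Data.Fin.Properties using (combine-injective; combine-remQuot; injective⇒≤)
open import Data.List using (List; []; _∷_; _++_; map; foldr; cartesianProduct)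
open import Data.List.Relation.Unary.All as All using (All; []; _∷_)
open import Data.List.Relation.Unary.All.Properties using (map⁺)
open import Data.List.Relation.Unary.Any using (here)
open import Data.List.Membership.Propositional using (_∈_)
open import Data.List.Membership.Propositional.Properties using (∈-++⁺ˡ; ∈-++⁺ʳ; ∈-map⁺; ∈-cartesianProduct⁺)
open import Data.Maybe using (Maybe; just; nothing)
open import Data.Vec as Vec using (Vec; []; _∷_; replicate)
open import Data.Vec.Properties using (∷-injective; ∷-injectiveʳ)
open import Data.Product using (_×_; _,_; proj₁; proj₂; ∃)
open import Data.Sum using (_⊎_; inj₁; inj₂)
open import Data.Unit using (⊤; tt)
open import Data.Empty using (⊥; ⊥-elim)
open import Function using (_∘_)
open import Function.Bundles using (_⇔_; mk⇔; Equivalence)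
open import Relation.Binary.PropositionalEquality
open import Relation.Nullary using (¬_; Dec; yes; no)
open +-*-Solver using (solve; _:=_; _:+_; _:*_; :-_; _:-_; con)

-- All estimates rest on a recursive description `N d 0` of BW_d, which has to be proved equal to
-- the lattice of the definition. That the generators satisfy the recursion yields the minimum; the
-- converse inclusion turns vectors built by halving into elements of L, and lets T act on `N d 0`.
-- The chain `N d n` is the bookkeeping for halved vectors: for every r in R, and not just for
-- fourvolutions, (r - 1)/2 and (r + 1)/2 raise the level by one, while doubling lowers it by two.
-- Thus (r + 1)/2, then (s + 1)/2, then doubling shows why half the sum of y, yr, ys, yrs belongs to
-- L. The involution is studied through the map that it induces on R/Z, an isometry of the
-- commutator form. Passing to R/Z loses signs, and the trace recovers them. Computations use `dot`,
-- the inner product without the factor 2^⌊d/2⌋: in it BW_d has minimum 1 and M_ε has minimum ½.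

⊕-comm : ∀ {d} (u v : Vec Bool d) → u ⊕ v ≡ v ⊕ u
⊕-comm [] [] = refl
⊕-comm (a ∷ u) (b ∷ v) = cong₂ _∷_ (xor-comm a b) (⊕-comm u v)

⊕-assoc : ∀ {d} (u v w : Vec Bool d) → (u ⊕ v) ⊕ w ≡ u ⊕ (v ⊕ w)
⊕-assoc [] [] [] = refl
⊕-assoc (a ∷ u) (b ∷ v) (c ∷ w) = cong₂ _∷_ (xor-assoc a b c) (⊕-assoc u v w)

⊕-self : ∀ {d} (u : Vec Bool d) → u ⊕ u ≡ zeroV
⊕-self [] = refl
⊕-self (a ∷ u) = cong₂ _∷_ (xor-same a) (⊕-self u)

⊕-identityˡ : ∀ {d} (u : Vec Bool d) → zeroV ⊕ u ≡ u
⊕-identityˡ [] = refl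
⊕-identityˡ (a ∷ u) = cong (a ∷_) (⊕-identityˡ u)

⊕-identityʳ : ∀ {d} (u : Vec Bool d) → u ⊕ zeroV ≡ u
⊕-identityʳ u = trans (⊕-comm u zeroV) (⊕-identityˡ u)

⊕-cancel : ∀ {d} (u v : Vec Bool d) → (u ⊕ v) ⊕ v ≡ u
⊕-cancel u v = trans (⊕-assoc u v v) (trans (cong (u ⊕_) (⊕-self v)) (⊕-identityʳ u))

⊕-zero⇒≡ : ∀ {d} {u v : Vec Bool d} → u ⊕ v ≡ zeroV → u ≡ v
⊕-zero⇒≡ {u = u} {v} p = trans (sym (⊕-cancel u v)) (trans (cong (_⊕ v) p) (⊕-identityˡ v))

==v-refl : ∀ {d} (u : Vec Bool d) → (u ==v u) ≡ true
==v-refl [] = refl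
==v-refl (false ∷ u) = ==v-refl u
==v-refl (true ∷ u) = ==v-refl u

==v⇒≡ : ∀ {d} (u v : Vec Bool d) → (u ==v v) ≡ true → u ≡ v
==v⇒≡ [] [] _ = refl
==v⇒≡ (false ∷ u) (false ∷ v) p = cong (false ∷_) (==v⇒≡ u v p)
==v⇒≡ (true ∷ u) (true ∷ v) p = cong (true ∷_) (==v⇒≡ u v p)

==v-sym : ∀ {d} (u v : Vec Bool d) → (u ==v v) ≡ (v ==v u)
==v-sym [] [] = refl
==v-sym (a ∷ u) (b ∷ v) = cong₂ (λ p q → not p ∧ q) (xor-comm a b) (==v-sym u v)

==v-shift : ∀ {d} (u v w : Vec Bool d) → (u ==v (v ⊕ w)) ≡ ((u ⊕ w) ==v v)
==v-shift [] [] [] = refl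
==v-shift (a ∷ u) (b ∷ v) (c ∷ w) = cong₂ (λ p q → not p ∧ q) (lem a b c) (==v-shift u v w)
  where
  lem : ∀ a b c → a xor (b xor c) ≡ (a xor c) xor b
  lem a b c = trans (cong (a xor_) (xor-comm b c)) (sym (xor-assoc a c b))

_∙_ : ∀ {d} → Vec Bool d → Vec Bool d → Bool
[] ∙ [] = false
(a ∷ u) ∙ (b ∷ v) = (a ∧ b) xor (u ∙ v)

xor-cancelˡ : ∀ a b → a xor (a xor b) ≡ b
xor-cancelˡ a b = trans (sym (xor-assoc a a b)) (cong (_xor b) (xor-same a))

xor-interchange : ∀ a b c d → (a xor b) xor (c xor d) ≡ (a xor c) xor (b xor d)
xor-interchange a b c d = trans (xor-assoc a b (c xor d))
  (trans (cong (a xor_) (trans (sym (xor-assoc b c d)) (trans (cong (_xor d) (xor-comm b c)) (xor-assoc c b d))))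
         (sym (xor-assoc a c (b xor d))))

∙-distribˡ : ∀ {d} (u v w : Vec Bool d) → u ∙ (v ⊕ w) ≡ (u ∙ v) xor (u ∙ w)
∙-distribˡ [] [] [] = refl
∙-distribˡ (a ∷ u) (b ∷ v) (c ∷ w) =
  trans (cong₂ _xor_ (∧-distribˡ-xor a b c) (∙-distribˡ u v w)) (xor-interchange (a ∧ b) (a ∧ c) (u ∙ v) (u ∙ w))

∙-comm : ∀ {d} (u v : Vec Bool d) → u ∙ v ≡ v ∙ u
∙-comm [] [] = refl
∙-comm (a ∷ u) (b ∷ v) = cong₂ _xor_ (∧-comm a b) (∙-comm u v)

∙-distribʳ : ∀ {d} (u v w : Vec Bool d) → (u ⊕ v) ∙ w ≡ (u ∙ w) xor (v ∙ w)
∙-distribʳ u v w = trans (∙-comm (u ⊕ v) w) (trans (∙-distribˡ w u v) (cong₂ _xor_ (∙-comm w u) (∙-comm w v)))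

zero∙ : ∀ {d} (v : Vec Bool d) → zeroV ∙ v ≡ false
zero∙ [] = refl
zero∙ (a ∷ v) = zero∙ v

∙zero : ∀ {d} (v : Vec Bool d) → v ∙ zeroV ≡ false
∙zero v = trans (∙-comm v zeroV) (zero∙ v)

∙-nondegenerate : ∀ {d} (u : Vec Bool d) → (u ≡ zeroV) ⊎ ∃ λ v → u ∙ v ≡ true
∙-nondegenerate [] = inj₁ refl
∙-nondegenerate (true ∷ u) = inj₂ (true ∷ zeroV , cong (true xor_) (∙zero u))
∙-nondegenerate (false ∷ u) with ∙-nondegenerate u
... | inj₁ p = inj₁ (cong (false ∷_) p)
... | inj₂ (v , p) = inj₂ (false ∷ v , p)

sg : Bool → ℚ
sg false = 1ℚ
sg true  = - 1ℚ

sg-xor : ∀ a b → sg (a xor b) ≡ sg a * sg b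
sg-xor false b = sym (*-identityˡ (sg b))
sg-xor true false = refl
sg-xor true true = refl

sg-sq : ∀ a → sg a * sg a ≡ 1ℚ
sg-sq false = refl
sg-sq true = refl

sg-cancel : ∀ a q → sg a * (sg a * q) ≡ q
sg-cancel a q = trans (sym (*-assoc (sg a) (sg a) q)) (trans (cong (_* q) (sg-sq a)) (*-identityˡ q))

sg-not : ∀ a → sg (not a) ≡ - sg a
sg-not false = refl
sg-not true = refl

-1*≡neg : ∀ q → - 1ℚ * q ≡ - q
-1*≡neg = solve 1 (λ q → con (- 1ℚ) :* q := :- q) refl

neg≡-1* : ∀ q → - q ≡ - 1ℚ * q
neg≡-1* q = sym (-1*≡neg q)

*-swap : ∀ p q r → p * (q * r) ≡ q * (p * r)
*-swap = solve 3 (λ p q r → p :* (q :* r) := q :* (p :* r)) refl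

-- Sums over Ω

foldr-sum-++ : ∀ {A : Set} (f : A → ℚ) (l l' : List A) →
  foldr (λ i r → f i + r) 0ℚ (l ++ l') ≡ foldr (λ i r → f i + r) 0ℚ l + foldr (λ i r → f i + r) 0ℚ l'
foldr-sum-++ f [] l' = sym (+-identityˡ (foldr (λ i r → f i + r) 0ℚ l'))
foldr-sum-++ f (x ∷ l) l' = trans (cong (f x +_) (foldr-sum-++ f l l'))
  (sym (+-assoc (f x) (foldr (λ i r → f i + r) 0ℚ l) (foldr (λ i r → f i + r) 0ℚ l')))

foldr-sum-map : ∀ {A B : Set} (f : B → ℚ) (g : A → B) (l : List A) →
  foldr (λ i r → f i + r) 0ℚ (map g l) ≡ foldr (λ i r → f (g i) + r) 0ℚ l
foldr-sum-map f g [] = refl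
foldr-sum-map f g (x ∷ l) = cong (f (g x) +_) (foldr-sum-map f g l)

-- Opaque, so that unification can read summands off a sum.
opaque
  ∑ : ∀ {d} → (Ω d → ℚ) → ℚ
  ∑ {d} f = sumΩ d f

  ∑≡sumΩ : ∀ {d} (f : Ω d → ℚ) → ∑ f ≡ sumΩ d f
  ∑≡sumΩ f = refl

  ∑-zero : ∀ (f : Ω 0 → ℚ) → ∑ f ≡ f []
  ∑-zero f = +-identityʳ (f [])

  ∑-suc : ∀ {d} (f : Ω (suc d) → ℚ) → ∑ f ≡ ∑ (λ i → f (false ∷ i)) + ∑ (λ i → f (true ∷ i))
  ∑-suc {d} f = trans (foldr-sum-++ f (map (false ∷_) (allVecs d)) (map (true ∷_) (allVecs d)))
    (cong₂ _+_ (foldr-sum-map f (false ∷_) (allVecs d)) (foldr-sum-map f (true ∷_) (allVecs d)))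

∑-cong : ∀ {d} {f g : Ω d → ℚ} → (∀ i → f i ≡ g i) → ∑ f ≡ ∑ g
∑-cong {zero} {f} {g} p = trans (∑-zero f) (trans (p []) (sym (∑-zero g)))
∑-cong {suc d} {f} {g} p = trans (∑-suc f)
  (trans (cong₂ _+_ (∑-cong (λ i → p (false ∷ i))) (∑-cong (λ i → p (true ∷ i)))) (sym (∑-suc g)))

+-interchange : ∀ a b c d → (a + b) + (c + d) ≡ (a + c) + (b + d)
+-interchange = solve 4 (λ a b c d → (a :+ b) :+ (c :+ d) := (a :+ c) :+ (b :+ d)) refl

∑-+ : ∀ {d} (f g : Ω d → ℚ) → ∑ (λ i → f i + g i) ≡ ∑ f + ∑ g
∑-+ {zero} f g = trans (∑-zero (λ i → f i + g i)) (sym (cong₂ _+_ (∑-zero f) (∑-zero g)))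
∑-+ {suc d} f g = begin
  ∑ (λ i → f i + g i)                                       ≡⟨ ∑-suc (λ i → f i + g i) ⟩
  ∑ (λ i → f₀ i + g₀ i) + ∑ (λ i → f₁ i + g₁ i)             ≡⟨ cong₂ _+_ (∑-+ f₀ g₀) (∑-+ f₁ g₁) ⟩
  (∑ f₀ + ∑ g₀) + (∑ f₁ + ∑ g₁)                             ≡⟨ +-interchange (∑ f₀) (∑ g₀) (∑ f₁) (∑ g₁) ⟩
  (∑ f₀ + ∑ f₁) + (∑ g₀ + ∑ g₁)                             ≡⟨ sym (cong₂ _+_ (∑-suc f) (∑-suc g)) ⟩
  ∑ f + ∑ g                                                 ∎
  where
  open ≡-Reasoning
  f₀ g₀ f₁ g₁ : Ω d → ℚ
  f₀ i = f (false ∷ i)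
  g₀ i = g (false ∷ i)
  f₁ i = f (true ∷ i)
  g₁ i = g (true ∷ i)

∑-* : ∀ {d} q (f : Ω d → ℚ) → ∑ (λ i → q * f i) ≡ q * ∑ f
∑-* {zero} q f = trans (∑-zero (λ i → q * f i)) (cong (q *_) (sym (∑-zero f)))
∑-* {suc d} q f = trans (∑-suc (λ i → q * f i))
  (trans (cong₂ _+_ (∑-* q (λ i → f (false ∷ i))) (∑-* q (λ i → f (true ∷ i))))
  (trans (sym (*-distribˡ-+ q (∑ (λ i → f (false ∷ i))) (∑ (λ i → f (true ∷ i))))) (cong (q *_) (sym (∑-suc f)))))

∑-0 : ∀ {d} → ∑ {d} (λ _ → 0ℚ) ≡ 0ℚ
∑-0 {d} = trans (∑-* {d} 0ℚ (λ _ → 0ℚ)) (*-zeroˡ (∑ {d} (λ _ → 0ℚ)))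

∑-neg : ∀ {d} (f : Ω d → ℚ) → ∑ (λ i → - f i) ≡ - ∑ f
∑-neg f = trans (∑-cong (λ i → neg≡-1* (f i))) (trans (∑-* (- 1ℚ) f) (sym (neg≡-1* (∑ f))))

∑-swap : ∀ {d e} (f : Ω d → Ω e → ℚ) → ∑ (λ i → ∑ (f i)) ≡ ∑ (λ j → ∑ (λ i → f i j))
∑-swap {zero} f = trans (∑-zero (λ i → ∑ (f i))) (∑-cong (λ j → sym (∑-zero (λ i → f i j))))
∑-swap {suc d} f = trans (∑-suc (λ i → ∑ (f i)))
  (trans (cong₂ _+_ (∑-swap (λ i → f (false ∷ i))) (∑-swap (λ i → f (true ∷ i))))
  (trans (sym (∑-+ (λ j → ∑ (λ i → f (false ∷ i) j)) (λ j → ∑ (λ i → f (true ∷ i) j))))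
         (∑-cong (λ j → sym (∑-suc (λ i → f i j))))))

∑-shift : ∀ {d} c (f : Ω d → ℚ) → ∑ (λ i → f (i ⊕ c)) ≡ ∑ f
∑-shift {zero} [] f = trans (∑-zero (λ i → f (i ⊕ []))) (sym (∑-zero f))
∑-shift {suc d} (false ∷ c) f = trans (∑-suc (λ i → f (i ⊕ (false ∷ c))))
  (trans (cong₂ _+_ (∑-shift c (λ i → f (false ∷ i))) (∑-shift c (λ i → f (true ∷ i)))) (sym (∑-suc f)))
∑-shift {suc d} (true ∷ c) f = trans (∑-suc (λ i → f (i ⊕ (true ∷ c))))
  (trans (cong₂ _+_ (∑-shift c (λ i → f (true ∷ i))) (∑-shift c (λ i → f (false ∷ i))))
  (trans (+-comm (∑ (λ i → f (true ∷ i))) (∑ (λ i → f (false ∷ i)))) (sym (∑-suc f))))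

∑-idM : ∀ {d} (x : Vect d) j → ∑ (λ i → x i * idM i j) ≡ x j
∑-idM {zero} x [] = trans (∑-zero (λ i → x i * idM i [])) (*-identityʳ (x []))
∑-idM {suc d} x (false ∷ j) = trans (∑-suc (λ i → x i * idM i (false ∷ j)))
  (trans (cong₂ _+_ (∑-idM (λ i → x (false ∷ i)) j)
     (trans (∑-cong (λ i → *-zeroʳ (x (true ∷ i)))) ∑-0)) (+-identityʳ (x (false ∷ j))))
∑-idM {suc d} x (true ∷ j) = trans (∑-suc (λ i → x i * idM i (true ∷ j)))
  (trans (cong₂ _+_ (trans (∑-cong (λ i → *-zeroʳ (x (false ∷ i)))) ∑-0)
     (∑-idM (λ i → x (true ∷ i)) j)) (+-identityˡ (x (true ∷ j))))

sq-nonneg : ∀ q → 0ℚ ≤ q * q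
sq-nonneg q with ≤-total 0ℚ q
... | inj₁ p = nonNegative⁻¹ (q * q) {{nonNeg*nonNeg⇒nonNeg q {{nonNegative p}} q {{nonNegative p}}}}
... | inj₂ p = nonNegative⁻¹ (q * q) {{nonPos*nonPos⇒nonPos q {{nonPositive p}} q {{nonPositive p}}}}

∑-nonneg : ∀ {d} {f : Ω d → ℚ} → (∀ i → 0ℚ ≤ f i) → 0ℚ ≤ ∑ f
∑-nonneg {zero} {f} p = subst (0ℚ ≤_) (sym (∑-zero f)) (p [])
∑-nonneg {suc d} {f} p = subst (0ℚ ≤_) (sym (∑-suc f))
  (+-mono-≤ (∑-nonneg (λ i → p (false ∷ i))) (∑-nonneg (λ i → p (true ∷ i))))

nonneg-+≡0 : ∀ {a b} → 0ℚ ≤ a → 0ℚ ≤ b → a + b ≡ 0ℚ → a ≡ 0ℚ × b ≡ 0ℚ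
nonneg-+≡0 {a} {b} pa pb e =
    ≤-antisym (subst (a ≤_) e (subst (_≤ a + b) (+-identityʳ a) (+-monoʳ-≤ a pb))) pa
  , ≤-antisym (subst (b ≤_) e (subst (_≤ a + b) (+-identityˡ b) (+-monoˡ-≤ b pa))) pb

integral : ∀ p q → p * q ≡ 0ℚ → p ≡ 0ℚ ⊎ q ≡ 0ℚ
integral p q e with p ≟ 0ℚ
... | yes z = inj₁ z
... | no nz = inj₂ (begin
    q                  ≡⟨ sym (*-identityˡ q) ⟩
    1ℚ * q             ≡⟨ cong (_* q) (sym (*-inverseˡ p)) ⟩
    (1/ p * p) * q     ≡⟨ *-assoc (1/ p) p q ⟩
    1/ p * (p * q)     ≡⟨ cong (1/ p *_) e ⟩
    1/ p * 0ℚ          ≡⟨ *-zeroʳ (1/ p) ⟩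
    0ℚ                 ∎)
  where
  open ≡-Reasoning
  instance _ = ≢-nonZero nz

sq≡0 : ∀ q → q * q ≡ 0ℚ → q ≡ 0ℚ
sq≡0 q e with integral q q e
... | inj₁ p = p
... | inj₂ p = p

∑-sq≡0 : ∀ {d} (x : Vect d) → ∑ (λ i → x i * x i) ≡ 0ℚ → x ≈v 0v
∑-sq≡0 {zero} x e [] = sq≡0 (x []) (trans (sym (∑-zero (λ i → x i * x i))) e)
∑-sq≡0 {suc d} x e i with nonneg-+≡0 (∑-nonneg (λ i → sq-nonneg (x (false ∷ i)))) (∑-nonneg (λ i → sq-nonneg (x (true ∷ i)))) (trans (sym (∑-suc (λ i → x i * x i))) e)
∑-sq≡0 {suc d} x e (false ∷ i) | p , q = ∑-sq≡0 (λ i → x (false ∷ i)) p i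
∑-sq≡0 {suc d} x e (true ∷ i)  | p , q = ∑-sq≡0 (λ i → x (true ∷ i)) q i

-- Vectors, the unscaled inner product and linear maps

≈v-sym : ∀ {d} {x y : Vect d} → x ≈v y → y ≈v x
≈v-sym p i = sym (p i)

≈v-trans : ∀ {d} {x y z : Vect d} → x ≈v y → y ≈v z → x ≈v z
≈v-trans p q i = trans (p i) (q i)

+v-cong : ∀ {d} {x x' y y' : Vect d} → x ≈v x' → y ≈v y' → (x +v y) ≈v (x' +v y')
+v-cong p q i = cong₂ _+_ (p i) (q i)

*v-cong : ∀ {d} q {x y : Vect d} → x ≈v y → (q *v x) ≈v (q *v y)
*v-cong q p i = cong (q *_) (p i)

opaque
  dot : ∀ {d} → Vect d → Vect d → ℚ
  dot x y = ∑ (λ i → x i * y i)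

  dot≡∑ : ∀ {d} (x y : Vect d) → dot x y ≡ ∑ (λ i → x i * y i)
  dot≡∑ x y = refl

  dot-cong : ∀ {d} {x x' y y' : Vect d} → x ≈v x' → y ≈v y' → dot x y ≡ dot x' y'
  dot-cong p q = ∑-cong (λ i → cong₂ _*_ (p i) (q i))

  dot-comm : ∀ {d} (x y : Vect d) → dot x y ≡ dot y x
  dot-comm x y = ∑-cong (λ i → *-comm (x i) (y i))

  dot-+ˡ : ∀ {d} (x y z : Vect d) → dot (x +v y) z ≡ dot x z + dot y z
  dot-+ˡ x y z = trans (∑-cong (λ i → *-distribʳ-+ (z i) (x i) (y i))) (∑-+ (λ i → x i * z i) (λ i → y i * z i))

  dot-*ˡ : ∀ {d} q (x y : Vect d) → dot (q *v x) y ≡ q * dot x y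
  dot-*ˡ q x y = trans (∑-cong (λ i → *-assoc q (x i) (y i))) (∑-* q (λ i → x i * y i))

  dot-idM : ∀ {d} (x : Vect d) j → dot x (idM j) ≡ x j
  dot-idM x j = trans (∑-cong (λ i → cong (x i *_) (cong (if_then 1ℚ else 0ℚ) (==v-sym j i)))) (∑-idM x j)

  dot≡0⇒≈0 : ∀ {d} (x : Vect d) → dot x x ≡ 0ℚ → x ≈v 0v
  dot≡0⇒≈0 = ∑-sq≡0

dot-congˡ : ∀ {d} {x x' : Vect d} (y : Vect d) → x ≈v x' → dot x y ≡ dot x' y
dot-congˡ y p = dot-cong p (λ _ → refl)

dot-congʳ : ∀ {d} (x : Vect d) {y y' : Vect d} → y ≈v y' → dot x y ≡ dot x y'
dot-congʳ x q = dot-cong (λ _ → refl) q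

dot-+ʳ : ∀ {d} (x y z : Vect d) → dot x (y +v z) ≡ dot x y + dot x z
dot-+ʳ x y z = trans (dot-comm x (y +v z)) (trans (dot-+ˡ y z x) (cong₂ _+_ (dot-comm y x) (dot-comm z x)))

dot-*ʳ : ∀ {d} q (x y : Vect d) → dot x (q *v y) ≡ q * dot x y
dot-*ʳ q x y = trans (dot-comm x (q *v y)) (trans (dot-*ˡ q y x) (cong (q *_) (dot-comm y x)))

dot-0ˡ : ∀ {d} (y : Vect d) → dot 0v y ≡ 0ℚ
dot-0ˡ y = trans (dot-congˡ y (λ i → sym (*-zeroˡ 0ℚ))) (trans (dot-*ˡ 0ℚ 0v y) (*-zeroˡ (dot 0v y)))

≈0⇒dot≡0 : ∀ {d} {x : Vect d} → x ≈v 0v → dot x x ≡ 0ℚ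
≈0⇒dot≡0 {x = x} p = trans (dot-congˡ x p) (dot-0ˡ x)

≈0? : ∀ {d} (x : Vect d) → Dec (x ≈v 0v)
≈0? x with dot x x ≟ 0ℚ
... | yes p = yes (dot≡0⇒≈0 x p)
... | no ¬p = no λ q → ¬p (≈0⇒dot≡0 q)

idM-sym : ∀ {d} (i j : Ω d) → idM i j ≡ idM j i
idM-sym i j = cong (if_then 1ℚ else 0ℚ) (==v-sym i j)

·-dot : ∀ {d} (x : Vect d) (M : Mat d) j → (x · M) j ≡ dot x (λ i → M i j)
·-dot x M j = trans (sym (∑≡sumΩ (λ i → x i * M i j))) (sym (dot≡∑ x (λ i → M i j)))

record Linear {d} (A : Vect d → Vect d) : Set where
  field
    ≈-cong : ∀ {x y} → x ≈v y → A x ≈v A y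
    +-homo : ∀ x y → A (x +v y) ≈v (A x +v A y)
    *-homo : ∀ q x → A (q *v x) ≈v (q *v A x)

  neg-homo : ∀ x → A (-v x) ≈v (-v A x)
  neg-homo x i = trans (≈-cong (λ j → neg≡-1* (x j)) i) (trans (*-homo (- 1ℚ) x i) (-1*≡neg (A x i)))

  0-homo : A 0v ≈v 0v
  0-homo i = trans (≈-cong (λ _ → sym (*-zeroˡ 0ℚ)) i) (trans (*-homo 0ℚ 0v i) (*-zeroˡ (A 0v i)))

module _ {d} {T : Vect d → Vect d} (T² : ∀ x → T (T x) ≈v x) (T-dot : ∀ x y → dot (T x) (T y) ≡ dot x y) where

  isometric-involution-adjoint : ∀ x y → dot (T x) y ≡ dot x (T y)
  isometric-involution-adjoint x y = trans (sym (T-dot (T x) y)) (dot-congˡ (T y) (T² x))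

·-linear : ∀ {d} (M : Mat d) → Linear (_· M)
·-linear {d} M = record
  { ≈-cong = λ {x} {y} p j → trans (·-dot x M j) (trans (dot-congˡ (λ i → M i j) p) (sym (·-dot y M j)))
  ; +-homo = λ x y j → trans (·-dot (x +v y) M j) (trans (dot-+ˡ x y (λ i → M i j)) (sym (cong₂ _+_ (·-dot x M j) (·-dot y M j))))
  ; *-homo = λ q x j → trans (·-dot (q *v x) M j) (trans (dot-*ˡ q x (λ i → M i j)) (cong (q *_) (sym (·-dot x M j))))
  }

·-cong : ∀ {d} (x : Vect d) {M N : Mat d} → M ≈m N → (x · M) ≈v (x · N)
·-cong x {M} {N} p j = trans (·-dot x M j) (trans (dot-congʳ x (λ i → p i j)) (sym (·-dot x N j)))

∑∑-assoc : ∀ {d} (x : Vect d) (M : Mat d) (y : Vect d) →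
  dot x (λ i → dot (M i) y) ≡ dot (λ k → dot x (λ i → M i k)) y
∑∑-assoc x M y = begin
  dot x (λ i → dot (M i) y)                 ≡⟨ dot≡∑ x (λ i → dot (M i) y) ⟩
  ∑ (λ i → x i * dot (M i) y)               ≡⟨ ∑-cong (λ i → cong (x i *_) (dot≡∑ (M i) y)) ⟩
  ∑ (λ i → x i * ∑ (λ k → M i k * y k))     ≡⟨ ∑-cong (λ i → sym (∑-* (x i) (λ k → M i k * y k))) ⟩
  ∑ (λ i → ∑ (λ k → x i * (M i k * y k)))   ≡⟨ ∑-swap (λ i k → x i * (M i k * y k)) ⟩
  ∑ (λ k → ∑ (λ i → x i * (M i k * y k)))   ≡⟨ ∑-cong (λ k → ∑-cong (λ i → lem (x i) (M i k) (y k))) ⟩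
  ∑ (λ k → ∑ (λ i → y k * (x i * M i k)))   ≡⟨ ∑-cong (λ k → ∑-* (y k) (λ i → x i * M i k)) ⟩
  ∑ (λ k → y k * ∑ (λ i → x i * M i k))     ≡⟨ ∑-cong (λ k → trans (*-comm (y k) (∑ (λ i → x i * M i k))) (cong (_* y k) (sym (dot≡∑ x (λ i → M i k))))) ⟩
  ∑ (λ k → dot x (λ i → M i k) * y k)       ≡⟨ sym (dot≡∑ (λ k → dot x (λ i → M i k)) y) ⟩
  dot (λ k → dot x (λ i → M i k)) y         ∎
  where
  open ≡-Reasoning
  lem : ∀ a b c → a * (b * c) ≡ c * (a * b)
  lem = solve 3 (λ a b c → a :* (b :* c) := c :* (a :* b)) refl

·-∘m : ∀ {d} (x : Vect d) (M N : Mat d) → (x · (M ∘m N)) ≈v ((x · M) · N)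
·-∘m x M N j = trans (·-dot x (M ∘m N) j)
  (trans (dot-congʳ x (λ i → ·-dot (M i) N j))
  (trans (∑∑-assoc x M (λ k → N k j))
  (trans (dot-congˡ (λ k → N k j) (λ k → sym (·-dot x M k))) (sym (·-dot (x · M) N j)))))

·-idM : ∀ {d} (x : Vect d) → (x · idM) ≈v x
·-idM x j = trans (·-dot x idM j) (trans (dot-congʳ x (λ i → idM-sym i j)) (dot-idM x j))

·-negM : ∀ {d} (x : Vect d) (M : Mat d) → (x · negM M) ≈v (-v (x · M))
·-negM x M j = trans (sym (∑≡sumΩ (λ i → x i * - M i j)))
  (trans (∑-cong (λ i → sym (neg-distribʳ-* (x i) (M i j))))
  (trans (∑-neg (λ i → x i * M i j)) (cong -_ (∑≡sumΩ (λ i → x i * M i j)))))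

idM-· : ∀ {d} (M : Mat d) i → (idM i · M) ≈v M i
idM-· M i j = trans (·-dot (idM i) M j) (trans (dot-comm (idM i) (λ k → M k j)) (dot-idM (λ k → M k j) i))

·-ext : ∀ {d} {M N : Mat d} → (∀ x → (x · M) ≈v (x · N)) → M ≈m N
·-ext {M = M} {N} p i j = trans (sym (idM-· M i j)) (trans (p (idM i) j) (idM-· N i j))

-- Barnes–Wall lattices and their minimum

natQ : ℕ → ℚ
natQ zero = 0ℚ
natQ (suc n) = 1ℚ + natQ n

natQ-+ : ∀ m n → natQ (m ℕ.+ n) ≡ natQ m + natQ n
natQ-+ zero n = sym (+-identityˡ (natQ n))
natQ-+ (suc m) n = trans (cong (1ℚ +_) (natQ-+ m n)) (sym (+-assoc 1ℚ (natQ m) (natQ n)))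

-- As differences of unary naturals, integers are closed under sums and negation without any
-- arithmetic of reduced fractions.
IsInt : ℚ → Set
IsInt q = ∃ λ m → ∃ λ n → q ≡ natQ m - natQ n

IsInt-+ : ∀ {p q} → IsInt p → IsInt q → IsInt (p + q)
IsInt-+ {p} {q} (m , n , e) (m' , n' , e') = m ℕ.+ m' , n ℕ.+ n' ,
  trans (cong₂ _+_ e e') (trans (lem (natQ m) (natQ n) (natQ m') (natQ n')) (sym
      (cong₂ _-_ (natQ-+ m m') (natQ-+ n n'))))
  where
  lem : ∀ a b c d → (a - b) + (c - d) ≡ (a + c) - (b + d)
  lem = solve 4 (λ a b c d → (a :- b) :+ (c :- d) := (a :+ c) :- (b :+ d)) refl

IsInt-neg : ∀ {q} → IsInt q → IsInt (- q)
IsInt-neg (m , n , e) = n , m , trans (cong -_ e) (lem (natQ m) (natQ n))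
  where
  lem : ∀ a b → - (a - b) ≡ b - a
  lem = solve 2 (λ a b → :- (a :- b) := b :- a) refl

-- HalfInt n q says that 2^⌊n/2⌋ q is an integer.
HalfInt : ℕ → ℚ → Set
HalfInt zero q = IsInt q
HalfInt (suc zero) q = IsInt q
HalfInt (suc (suc n)) q = HalfInt n (q + q)

HalfInt-+ : ∀ n {p q} → HalfInt n p → HalfInt n q → HalfInt n (p + q)
HalfInt-+ zero = IsInt-+
HalfInt-+ (suc zero) = IsInt-+
HalfInt-+ (suc (suc n)) {p} {q} hp hq = subst (HalfInt n) (+-interchange p p q q) (HalfInt-+ n hp hq)

HalfInt-neg : ∀ n {q} → HalfInt n q → HalfInt n (- q)
HalfInt-neg zero = IsInt-neg
HalfInt-neg (suc zero) = IsInt-neg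
HalfInt-neg (suc (suc n)) {q} h = subst (HalfInt n) (neg-distrib-+ q q) (HalfInt-neg n h)

HalfInt-0 : ∀ n → HalfInt n 0ℚ
HalfInt-0 zero = 0 , 0 , refl
HalfInt-0 (suc zero) = 0 , 0 , refl
HalfInt-0 (suc (suc n)) = HalfInt-0 n

HalfInt-1 : ∀ n → HalfInt n 1ℚ
HalfInt-1 zero = 1 , 0 , refl
HalfInt-1 (suc zero) = 1 , 0 , refl
HalfInt-1 (suc (suc n)) = HalfInt-+ n (HalfInt-1 n) (HalfInt-1 n)

HalfInt-mono : ∀ n {q} → HalfInt n q → HalfInt (suc n) q
HalfInt-mono zero h = h
HalfInt-mono (suc zero) h = IsInt-+ h h
HalfInt-mono (suc (suc n)) h = HalfInt-mono n h

lo : ∀ {d} → Vect (suc d) → Vect d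
lo x i = x (false ∷ i)

hi : ∀ {d} → Vect (suc d) → Vect d
hi x i = x (true ∷ i)

df : ∀ {d} → Vect (suc d) → Vect d
df x i = x (true ∷ i) - x (false ∷ i)

-- The |u|u+v| recursion.  BW d is N d 0, and the chain N d 0 ⊆ N d 1 ⊆ N d 2 = ½ N d 0 is
-- that of the successive images of BW d under (f − 1)⁻¹, for any fourvolution f in R.
N : (d n : ℕ) → Vect d → Set
N zero n x = HalfInt n (x [])
N (suc d) n x = N d (suc n) (lo x) × N d n (df x)

N-resp : ∀ d n {x y : Vect d} → x ≈v y → N d n x → N d n y
N-resp zero n p h = subst (HalfInt n) (p []) h
N-resp (suc d) n p (a , b) = N-resp d (suc n) (λ i → p (false ∷ i)) a ,
  N-resp d n (λ i → cong₂ _-_ (p (true ∷ i)) (p (false ∷ i))) b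

N-+ : ∀ d n {x y : Vect d} → N d n x → N d n y → N d n (x +v y)
N-+ zero n h k = HalfInt-+ n h k
N-+ (suc d) n {x} {y} (a , b) (a' , b') = N-+ d (suc n) a a' ,
  N-resp d n (λ i → lem (hi x i) (lo x i) (hi y i) (lo y i)) (N-+ d n b b')
  where
  lem : ∀ a b c d → (a - b) + (c - d) ≡ (a + c) - (b + d)
  lem = solve 4 (λ a b c d → (a :- b) :+ (c :- d) := (a :+ c) :- (b :+ d)) refl

N-neg : ∀ d n {x : Vect d} → N d n x → N d n (-v x)
N-neg zero n h = HalfInt-neg n h
N-neg (suc d) n {x} (a , b) = N-neg d (suc n) a , N-resp d n (λ i → lem (hi x i) (lo x i)) (N-neg d n b)
  where
  lem : ∀ a b → - (a - b) ≡ (- a) - (- b)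
  lem = solve 2 (λ a b → :- (a :- b) := (:- a) :- (:- b)) refl

N-0 : ∀ d n → N d n 0v
N-0 zero n = HalfInt-0 n
N-0 (suc d) n = N-0 d (suc n) , N-0 d n

N-mono : ∀ d n {x : Vect d} → N d n x → N d (suc n) x
N-mono zero n h = HalfInt-mono n h
N-mono (suc d) n (a , b) = N-mono d (suc n) a , N-mono d n b

N-double : ∀ d n {x : Vect d} → N d (2 ℕ.+ n) x → N d n (x +v x)
N-double zero n h = h
N-double (suc d) n {x} (a , b) = N-double d (suc n) a , N-resp d n (λ i → lem (hi x i) (lo x i)) (N-double d n b)
  where
  lem : ∀ a b → (a - b) + (a - b) ≡ (a + a) - (b + b)
  lem = solve 2 (λ a b → (a :- b) :+ (a :- b) := (a :+ a) :- (b :+ b)) refl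

N-halve : ∀ d n {x : Vect d} → N d n x → N d (2 ℕ.+ n) (½ *v x)
N-halve zero n {x} h = subst (HalfInt n) (lem (x [])) h
  where
  lem : ∀ q → q ≡ ½ * q + ½ * q
  lem = solve 1 (λ q → q := con ½ :* q :+ con ½ :* q) refl
N-halve (suc d) n {x} (a , b) = N-halve d (suc n) a , N-resp d (2 ℕ.+ n) (λ i → lem (hi x i) (lo x i)) (N-halve d n b)
  where
  lem : ∀ a b → ½ * (a - b) ≡ ½ * a - ½ * b
  lem = solve 2 (λ a b → con ½ :* (a :- b) := con ½ :* a :- con ½ :* b) refl

-- Translations and sign changes acting on the chain

shift : ∀ {d} → Ω d → Vect d → Vect d
shift c x i = x (i ⊕ c)

eps : ∀ {d} → Subset d → Vect d → Vect d
eps h x i = sg (h i) * x i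

-- That `halfDiff A x` lies in `N d (suc n)` says that A fixes x modulo twice that lattice. The
-- lemmas below amount to the trivial action of R on `N d n` modulo 2 `N d (suc n)`. For a
-- fourvolution f, `halfDiff f` is the negative of the inverse of f + 1.
halfDiff : ∀ {d} → (Vect d → Vect d) → Vect d → Vect d
halfDiff A x i = ½ * (A x i - x i)

N-from-halfDiff : ∀ d n (A : Vect d → Vect d) {x} → N d n x → N d (suc n) (halfDiff A x) → N d n (A x)
N-from-halfDiff d n A {x} hx h = N-resp d n (λ i → lem (A x i) (x i))
  (N-+ d n (N-double d n (N-mono d (suc n) h)) hx)
  where
  lem : ∀ a b → (½ * (a - b) + ½ * (a - b)) + b ≡ a
  lem = solve 2 (λ a b → (con ½ :* (a :- b) :+ con ½ :* (a :- b)) :+ b := a) refl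

-- A translation with first coordinate 1 exchanges the halves. The new lower half is then the half
-- difference of the old one plus half of a translate of `df x`, and the new difference of halves
-- involves `df x` alone; the translate is why `N-shift` is proved simultaneously.
N-halfDiff-shift : ∀ d n c {x : Vect d} → N d n x → N d (suc n) (halfDiff (shift c) x)
N-shift : ∀ d n c {x : Vect d} → N d n x → N d n (shift c x)

N-halfDiff-shift zero n [] {x} h = subst (HalfInt (suc n)) (lem (x [])) (HalfInt-0 (suc n))
  where
  lem : ∀ q → 0ℚ ≡ ½ * (q - q)
  lem = solve 1 (λ q → con 0ℚ := con ½ :* (q :- q)) refl
N-halfDiff-shift (suc d) n (false ∷ c) {x} (a , b) = N-halfDiff-shift d (suc n) c a ,
  N-resp d (suc n) (λ i → lem (hi x (i ⊕ c)) (hi x i) (lo x (i ⊕ c)) (lo x i)) (N-halfDiff-shift d n c b)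
  where
  lem : ∀ p q r s → ½ * ((p - r) - (q - s)) ≡ ½ * (p - q) - ½ * (r - s)
  lem = solve 4 (λ p q r s → con ½ :* ((p :- r) :- (q :- s)) := con ½ :* (p :- q) :- con ½ :* (r :- s)) refl
N-halfDiff-shift (suc d) n (true ∷ c) {x} (a , b) =
  N-resp d (2 ℕ.+ n) (λ i → lem₀ (lo x (i ⊕ c)) (lo x i) (hi x (i ⊕ c)))
    (N-+ d (2 ℕ.+ n) (N-halfDiff-shift d (suc n) c a) (N-halve d n (N-shift d n c b))) ,
  N-resp d (suc n) (λ i → lem₁ (lo x (i ⊕ c)) (lo x i) (hi x (i ⊕ c)) (hi x i))
    (N-neg d (suc n) (N-+ d (suc n) (N-halfDiff-shift d n c b) (N-mono d n b)))
  where
  lem₀ : ∀ p q r → ½ * (p - q) + ½ * (r - p) ≡ ½ * (r - q)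
  lem₀ = solve 3 (λ p q r → con ½ :* (p :- q) :+ con ½ :* (r :- p) := con ½ :* (r :- q)) refl
  lem₁ : ∀ p q r s → - (½ * ((r - p) - (s - q)) + (s - q)) ≡ ½ * (p - s) - ½ * (r - q)
  lem₁ = solve 4 (λ p q r s →
      :- (con ½ :* ((r :- p) :- (s :- q)) :+ (s :- q)) := con ½ :* (p :- s) :- con ½ :* (r :- q)) refl

N-shift d n c h = N-from-halfDiff d n (shift c) h (N-halfDiff-shift d n c h)

-- Deg k d h: as a polynomial over 𝔽₂, h has degree less than k.
Deg : (k d : ℕ) → Subset d → Set
Deg zero d h = ∀ i → h i ≡ false
Deg (suc k) zero h = ⊤
Deg (suc k) (suc d) h = Deg (suc k) d (λ i → h (false ∷ i)) × Deg k d (λ i → h (false ∷ i) xor h (true ∷ i))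

Deg-resp : ∀ k d {g h : Subset d} → g ≈s h → Deg k d g → Deg k d h
Deg-resp zero d p z i = trans (sym (p i)) (z i)
Deg-resp (suc k) zero p _ = tt
Deg-resp (suc k) (suc d) p (a , b) = Deg-resp (suc k) d (λ i → p (false ∷ i)) a ,
  Deg-resp k d (λ i → cong₂ _xor_ (p (false ∷ i)) (p (true ∷ i))) b

Deg-xor : ∀ k d {g h : Subset d} → Deg k d g → Deg k d h → Deg k d (λ i → g i xor h i)
Deg-xor zero d p q i = cong₂ _xor_ (p i) (q i)
Deg-xor (suc k) zero _ _ = tt
Deg-xor (suc k) (suc d) {g} {h} (a , b) (a' , b') = Deg-xor (suc k) d a a' ,
  Deg-resp k d (λ i → xor-interchange (g (false ∷ i)) (g (true ∷ i)) (h (false ∷ i)) (h (true ∷ i))) (Deg-xor k d b b')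

Deg-0 : ∀ k d → Deg k d (λ _ → false)
Deg-0 zero d i = refl
Deg-0 (suc k) zero = tt
Deg-0 (suc k) (suc d) = Deg-0 (suc k) d , Deg-0 k d

Deg-mono : ∀ k d {h : Subset d} → Deg k d h → Deg (suc k) d h
Deg-mono zero d p = Deg-resp 1 d (λ i → sym (p i)) (Deg-0 1 d)
Deg-mono (suc k) zero _ = tt
Deg-mono (suc k) (suc d) (a , b) = Deg-mono (suc k) d a , Deg-mono k d b

Deg-mono-≤ : ∀ {k l} d {h : Subset d} → k ℕ.≤ l → Deg k d h → Deg l d h
Deg-mono-≤ {k} {l} d {h'} p h with ℕₚ.m≤n⇒∃[o]m+o≡n p
... | o , refl = go o
  where
  go : ∀ o → Deg (k ℕ.+ o) d h'
  go zero = subst (λ m → Deg m d h') (sym (ℕₚ.+-identityʳ k)) h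
  go (suc o) = subst (λ m → Deg m d h') (sym (ℕₚ.+-suc k o)) (Deg-mono (k ℕ.+ o) d (go o))

Deg-top : ∀ d (h : Subset d) → Deg (suc d) d h
Deg-top zero h = tt
Deg-top (suc d) h = Deg-mono (suc d) d (Deg-top d (λ i → h (false ∷ i))) , Deg-top d (λ i →
    h (false ∷ i) xor h (true ∷ i))

derivative : ∀ {d} → Ω d → Subset d → Subset d
derivative u h i = h i xor h (i ⊕ u)

-- In a direction with first coordinate 1 the derivative mixes the halves: its lower half is the
-- derivative of the lower half of h plus a translate of the difference of the halves, which already
-- has smaller degree. Hence the simultaneous induction with `Deg-shift`.
Deg-derivative : ∀ k d u {h : Subset d} → Deg (suc k) d h → Deg k d (derivative u h)
Deg-shift : ∀ k d u {h : Subset d} → Deg k d h → Deg k d (λ i → h (i ⊕ u))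

Deg-derivative zero zero [] {h} _ [] = xor-same (h [])
Deg-derivative (suc k) zero u _ = tt
Deg-derivative zero (suc d) (b ∷ u) {h} (a , z) (c ∷ i) = trans
    (cong₂ _xor_ (const c i) (const (c xor b) (i ⊕ u))) (Deg-derivative zero d u a i)
  where
  const : ∀ c i → h (c ∷ i) ≡ h (false ∷ i)
  const false i = refl
  const true i = trans (sym (xor-cancelˡ (h (false ∷ i)) (h (true ∷ i)))) (trans
      (cong (h (false ∷ i) xor_) (z i)) (xor-identityʳ _))
Deg-derivative (suc k) (suc d) (false ∷ u) {h} (a , b) = Deg-derivative (suc k) d u a ,
  Deg-resp k d (λ i → xor-interchange (h (false ∷ i)) (h (true ∷ i)) (h (false ∷ (i ⊕ u))) (h (true ∷ (i ⊕ u)))) (Deg-derivative k d u b)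
Deg-derivative (suc k) (suc d) (true ∷ u) {h} (a , b) =
  Deg-resp (suc k) d (λ i → lem₀ (h (false ∷ i)) (h (false ∷ (i ⊕ u))) (h (true ∷ (i ⊕ u))))
    (Deg-xor (suc k) d (Deg-derivative (suc k) d u a) (Deg-shift (suc k) d u b')) ,
  Deg-resp k d (λ i → lem₁ (h (false ∷ i)) (h (true ∷ i)) (h (false ∷ (i ⊕ u))) (h (true ∷ (i ⊕ u)))) (Deg-derivative k d u b')
  where
  b' : Deg (suc k) d (λ i → h (false ∷ i) xor h (true ∷ i))
  b' = b
  lem₀ : ∀ p q r → (p xor q) xor (q xor r) ≡ p xor r
  lem₀ p q r = trans (xor-assoc p q (q xor r)) (cong (p xor_) (trans (sym (xor-assoc q q r))
      (cong (_xor r) (xor-same q))))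
  lem₁ : ∀ p q r s → (p xor q) xor (r xor s) ≡ (p xor s) xor (q xor r)
  lem₁ p q r s = trans (cong ((p xor q) xor_) (xor-comm r s)) (xor-interchange p q s r)

Deg-shift zero d u p i = p (i ⊕ u)
Deg-shift (suc k) zero u _ = tt
Deg-shift (suc k) (suc d) (false ∷ u) (a , b) = Deg-shift (suc k) d u a , Deg-shift k d u b
Deg-shift (suc k) (suc d) (true ∷ u) {h} (a , b) =
  Deg-resp (suc k) d (λ i →
      xor-cancelˡ (h (false ∷ (i ⊕ u))) (h (true ∷ (i ⊕ u)))) (Deg-xor (suc k) d (Deg-shift (suc k) d u a) (Deg-mono k d b'))  ,
  Deg-resp k d (λ i → xor-comm (h (false ∷ (i ⊕ u))) (h (true ∷ (i ⊕ u)))) b'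
  where
  b' : Deg k d (λ i → h (false ∷ (i ⊕ u)) xor h (true ∷ (i ⊕ u)))
  b' = Deg-shift k d u b

Deg-1-const : ∀ d {h : Subset d} → Deg 1 d h → ∃ λ b → ∀ i → h i ≡ b
Deg-1-const zero {h} _ = h [] , λ { [] → refl }
Deg-1-const (suc d) {h} (a , z) with Deg-1-const d a
... | b , p = b , λ { (false ∷ i) → p i ; (true ∷ i) → trans (sym (lem _ _ (z i))) (p i) }
  where
  lem : ∀ a b → a xor b ≡ false → a ≡ b
  lem false b e = sym e
  lem true true e = refl

Deg-2-affine : ∀ d {h : Subset d} → Deg 2 d h → ∃ λ b → ∃ λ l → ∀ i → h i ≡ b xor (l ∙ i)
Deg-2-affine zero {h} _ = h [] , [] , λ { [] → sym (xor-identityʳ (h [])) }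
Deg-2-affine (suc d) {h} (a , c) with Deg-2-affine d a | Deg-1-const d c
... | b , l , p | e , q = b , e ∷ l , λ
  { (false ∷ i) → trans (p i) (cong (λ z → b xor (z xor (l ∙ i))) (sym (∧-zeroʳ e)))
  ; (true ∷ i) → trans (sym (xor-cancelˡ (h (false ∷ i)) (h (true ∷ i)))) (trans (cong₂ _xor_ (p i) (q i)) (lem₂ b e (l ∙ i))) }
  where
  lem₂ : ∀ b e z → (b xor z) xor e ≡ b xor ((e ∧ true) xor z)
  lem₂ b e z = trans (xor-assoc b z e) (cong (b xor_) (trans (xor-comm z e) (cong (_xor z) (sym (∧-comm e true)))))

-- For affine h the signs on the two halves agree or are opposite throughout. If they agree, the
-- halves are treated separately. If they are opposite, the difference of the halves is minus the
-- sum of the signed lower half, the half difference of `df x`, and `df x`, all of which lie in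
-- `N d (suc n)`.
N-halfDiff-eps : ∀ d n {h : Subset d} {x} → Deg 2 d h → N d n x → N d (suc n) (halfDiff (eps h) x)
N-halfDiff-eps zero n {h} {x} _ k with h []
... | false = subst (HalfInt (suc n)) (lem (x [])) (HalfInt-0 (suc n))
  where
  lem : ∀ q → 0ℚ ≡ ½ * (1ℚ * q - q)
  lem = solve 1 (λ q → con 0ℚ := con ½ :* (con 1ℚ :* q :- q)) refl
... | true = subst (HalfInt (suc n)) (lem (x [])) (HalfInt-neg (suc n) (HalfInt-mono n k))
  where
  lem : ∀ q → - q ≡ ½ * (- 1ℚ * q - q)
  lem = solve 1 (λ q → :- q := con ½ :* (con (- 1ℚ) :* q :- q)) refl
N-halfDiff-eps (suc d) n {h} {x} (dh , dc) (a , b) with Deg-1-const d dc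
... | c , hc = N-halfDiff-eps d (suc n) dh a , hi-part c hc
  where
  h₀ h₁ : Subset d
  h₀ i = h (false ∷ i)
  h₁ i = h (true ∷ i)
  same : ∀ p q → p xor q ≡ false → q ≡ p
  same false q e = e
  same true true e = refl
  flip : ∀ p q → p xor q ≡ true → sg q ≡ - sg p
  flip false true e = refl
  flip true false e = refl
  lem₀ : ∀ s p q → ½ * (s * (p - q) - (p - q)) ≡ ½ * (s * p - p) - ½ * (s * q - q)
  lem₀ = solve 3 (λ s p q →
      con ½ :* (s :* (p :- q) :- (p :- q)) := con ½ :* (s :* p :- p) :- con ½ :* (s :* q :- q)) refl
  lem₁ : ∀ s p q → - (s * q + (½ * (s * (p - q) - (p - q)) + (p - q))) ≡ ½ * (- s * p - p) - ½ * (s * q - q)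
  lem₁ = solve 3 (λ s p q →
      :- (s :* q :+ (con ½ :* (s :* (p :- q) :- (p :- q)) :+ (p :- q))) := con ½ :* ((:- s) :* p :- p) :- con ½ :* (s :* q :- q)) refl
  εb : N d (suc n) (halfDiff (eps h₀) (df x))
  εb = N-halfDiff-eps d n dh b
  εa : N d (suc (suc n)) (halfDiff (eps h₀) (lo x))
  εa = N-halfDiff-eps d (suc n) dh a
  hi-part : ∀ c → (∀ i → h₀ i xor h₁ i ≡ c) → N d (suc n) (df (halfDiff (eps h) x))
  hi-part false e = N-resp d (suc n)
    (λ i → trans (lem₀ (sg (h₀ i)) (hi x i) (lo x i)) (cong (λ z →
        ½ * (sg z * hi x i - hi x i) - ½ * (sg (h₀ i) * lo x i - lo x i)) (sym (same (h₀ i) (h₁ i) (e i))))) εb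
  hi-part true e = N-resp d (suc n)
    (λ i → trans (lem₁ (sg (h₀ i)) (hi x i) (lo x i)) (cong (λ z →
        ½ * (z * hi x i - hi x i) - ½ * (sg (h₀ i) * lo x i - lo x i)) (sym (flip (h₀ i) (h₁ i) (e i)))))
    (N-neg d (suc n) (N-+ d (suc n) (N-from-halfDiff d (suc n) (eps h₀) a εa)
       (N-+ d (suc n) εb (N-mono d n b))))

N-eps₂ : ∀ d n {h : Subset d} {x} → Deg 2 d h → N d n x → N d n (eps h x)
N-eps₂ d n {h} dh hx = N-from-halfDiff d n (eps h) hx (N-halfDiff-eps d n dh hx)

-- For quadratic h the signs on the two halves differ by an affine function h'. Up to the signs of
-- the lower half, the new difference of halves is `df x` signed by h' plus twice
-- `halfDiff (eps h') (lo x)`. The latter starts two levels up, since `lo x` is one level higher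
-- than x, and doubling brings it back.
N-eps : ∀ d n {h : Subset d} {x} → Deg 3 d h → N d n x → N d n (eps h x)
N-eps zero n {h} {x} _ k with h []
... | false = subst (HalfInt n) (sym (*-identityˡ (x []))) k
... | true = subst (HalfInt n) (neg≡-1* (x [])) (HalfInt-neg n k)
N-eps (suc d) n {h} {x} (dh , dh') (a , b) = N-eps d (suc n) dh a ,
  N-resp d n (λ i → trans (lem (sg (h₀ i)) (sg (h' i)) (hi x i) (lo x i))
                (cong (λ z → z * hi x i - sg (h₀ i) * lo x i) (trans (sym (sg-xor (h₀ i) (h' i)))
                    (cong sg (xor-cancelˡ (h₀ i) (h₁ i))))))
    (N-eps d n dh (N-+ d n (N-double d n (N-halfDiff-eps d (suc n) dh' a)) (N-eps₂ d n dh' b)))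
  where
  h₀ h₁ h' : Subset d
  h₀ i = h (false ∷ i)
  h₁ i = h (true ∷ i)
  h' i = h₀ i xor h₁ i
  lem : ∀ s s' p q → s * ((½ * (s' * q - q) + ½ * (s' * q - q)) + s' * (p - q)) ≡ (s * s') * p - s * q
  lem = solve 4 (λ s s' p q →
      s :* ((con ½ :* (s' :* q :- q) :+ con ½ :* (s' :* q :- q)) :+ s' :* (p :- q)) := (s :* s') :* p :- s :* q) refl

-- Affine subspaces: BW_d is contained in N d 0

anyL-++ : ∀ {A : Set} (p : A → Bool) (l l' : List A) → anyL p (l ++ l') ≡ anyL p l ∨ anyL p l'
anyL-++ p [] l' = refl
anyL-++ p (a ∷ l) l' with p a
... | true = refl
... | false = anyL-++ p l l'

anyL-map : ∀ {A B : Set} (p : B → Bool) (g : A → B) (l : List A) → anyL p (map g l) ≡ anyL (p ∘ g) l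
anyL-map p g [] = refl
anyL-map p g (a ∷ l) = cong (p (g a) ∨_) (anyL-map p g l)

anyL-cong : ∀ {A : Set} {p q : A → Bool} → (∀ a → p a ≡ q a) → (l : List A) → anyL p l ≡ anyL q l
anyL-cong e [] = refl
anyL-cong e (a ∷ l) = cong₂ _∨_ (e a) (anyL-cong e l)

anyL⇒∃ : ∀ {A : Set} (p : A → Bool) (l : List A) → anyL p l ≡ true → ∃ λ a → p a ≡ true
anyL⇒∃ p (a ∷ l) e with p a in pa
... | true = a , pa
... | false = anyL⇒∃ p l e

-- This is `inAff` freed of the independence proof, so that inductions on the directions may move
-- the base point.
affPts : ∀ {d r} → Ω d → Vec (Ω d) r → Subset d
affPts {d} {r} b us i = anyL (λ c → i ==v (b ⊕ combo c us)) (allVecs r)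

affPts-[] : ∀ {d} (b i : Ω d) → affPts b [] i ≡ (i ==v b)
affPts-[] b i = trans (∨-identityʳ (i ==v (b ⊕ zeroV))) (cong (i ==v_) (⊕-identityʳ b))

affPts-∷ : ∀ {d r} (b u : Ω d) (us : Vec (Ω d) r) i → affPts b (u ∷ us) i ≡ affPts b us i ∨ affPts (b ⊕ u) us i
affPts-∷ {d} {r} b u us i = trans (anyL-++ p (map (false ∷_) (allVecs r)) (map (true ∷_) (allVecs r)))
  (cong₂ _∨_ (trans (anyL-map p (false ∷_) (allVecs r)) (anyL-cong (λ c → cong (λ z →
      i ==v (b ⊕ z)) (⊕-identityˡ (combo c us))) (allVecs r)))
             (trans (anyL-map p (true ∷_) (allVecs r)) (anyL-cong (λ c → cong (i ==v_)
                 (sym (⊕-assoc b u (combo c us)))) (allVecs r))))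
  where
  p : Vec Bool (suc r) → Bool
  p c = i ==v (b ⊕ combo c (u ∷ us))

affPts⇒∃ : ∀ {d r} (b : Ω d) (us : Vec (Ω d) r) i → affPts b us i ≡ true → ∃ λ c → i ≡ b ⊕ combo c us
affPts⇒∃ {r = r} b us i e with anyL⇒∃ (λ c → i ==v (b ⊕ combo c us)) (allVecs r) e
... | c , p = c , ==v⇒≡ i (b ⊕ combo c us) p

affPts-shift : ∀ {d r} (b u : Ω d) (us : Vec (Ω d) r) i → affPts (b ⊕ u) us i ≡ affPts b us (i ⊕ u)
affPts-shift {r = r} b u us i = anyL-cong (λ c → trans
  (cong (i ==v_) (trans (⊕-assoc b u (combo c us)) (trans (cong (b ⊕_) (⊕-comm u (combo c us)))
      (sym (⊕-assoc b (combo c us) u)))))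
  (==v-shift i (b ⊕ combo c us) u)) (allVecs r)

combo-⊕ : ∀ {d r} (c c' : Vec Bool r) (us : Vec (Ω d) r) → combo (c ⊕ c') us ≡ combo c us ⊕ combo c' us
combo-⊕ [] [] [] = sym (⊕-self zeroV)
combo-⊕ (a ∷ c) (a' ∷ c') (u ∷ us) = trans (cong₂ _⊕_ (lem a a' u) (combo-⊕ c c' us)) (swap _ _ _ _)
  where
  lem : ∀ {d} a a' (u : Ω d) → (if a xor a' then u else zeroV) ≡ (if a then u else zeroV) ⊕ (if a' then u else zeroV)
  lem false a' u = sym (⊕-identityˡ _)
  lem true false u = sym (⊕-identityʳ u)
  lem true true u = sym (⊕-self u)
  swap : ∀ {d} (p q r s : Ω d) → (p ⊕ q) ⊕ (r ⊕ s) ≡ (p ⊕ r) ⊕ (q ⊕ s)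
  swap p q r s = trans (⊕-assoc p q (r ⊕ s)) (trans (cong (p ⊕_) (trans (sym (⊕-assoc q r s))
    (trans (cong (_⊕ s) (⊕-comm q r)) (⊕-assoc r q s)))) (sym (⊕-assoc p r (q ⊕ s))))

LinIndep-tail : ∀ {d r} {u : Ω d} {us : Vec (Ω d) r} → LinIndep (u ∷ us) → LinIndep us
LinIndep-tail {us = us} ind c e = ∷-injectiveʳ (ind (false ∷ c) (trans (⊕-identityˡ (combo c us)) e))

affPts-disjoint : ∀ {d r} (b u : Ω d) (us : Vec (Ω d) r) → LinIndep (u ∷ us) → ∀ i →
  affPts b us i ≡ true → affPts (b ⊕ u) us i ≡ true → ⊥
affPts-disjoint b u us ind i e e' with affPts⇒∃ b us i e | affPts⇒∃ (b ⊕ u) us i e'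
... | c , p | c' , p' = case (ind (true ∷ (c ⊕ c')) (trans (cong (u ⊕_) (combo-⊕ c c' us)) relation))
  where
  case : ∀ {r} {w : Vec Bool r} → true ∷ w ≡ false ∷ replicate r false → ⊥
  case ()
  relation : u ⊕ (combo c us ⊕ combo c' us) ≡ zeroV
  relation = trans (cong (λ z → u ⊕ (z ⊕ combo c' us)) step) (trans (cong (u ⊕_) (⊕-cancel u (combo c' us))) (⊕-self u))
    where
    step : combo c us ≡ u ⊕ combo c' us
    step = trans (sym (⊕-cancel (combo c us) b)) (trans (cong (_⊕ b) (trans (⊕-comm (combo c us) b) (trans
        (sym p) (trans p' (⊕-assoc b u (combo c' us))))))
      (trans (cong (_⊕ b) (⊕-comm b (u ⊕ combo c' us))) (⊕-cancel (u ⊕ combo c' us) b)))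

indicator : ∀ {d} → Subset d → Vect d
indicator h i = if h i then 1ℚ else 0ℚ

-- Adding a direction u replaces A by the disjoint union of A and its translate by u, whose
-- characteristic function is the derivative of that of A along u. Starting from a point, of degree
-- at most d, each direction lowers the degree by one.
Deg-affPts : ∀ {d r} k (b : Ω d) (us : Vec (Ω d) r) → LinIndep us → suc d ℕ.≤ r ℕ.+ k → Deg k d (affPts b us)
Deg-affPts {d} k b [] ind p = Deg-mono-≤ d p (Deg-top d (affPts b []))
Deg-affPts {d} {suc r} k b (u ∷ us) ind p = Deg-resp k d (λ i → sym (step i))
  (Deg-derivative k d u (Deg-affPts (suc k) b us (LinIndep-tail ind) (subst (suc d ℕ.≤_) (sym (ℕₚ.+-suc r k)) p)))
  where
  step : ∀ i → affPts b (u ∷ us) i ≡ derivative u (affPts b us) i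
  step i = trans (affPts-∷ b u us i) (trans (∨≡xor (affPts b us i) (affPts (b ⊕ u) us i) (affPts-disjoint b u us ind i))
    (cong (affPts b us i xor_) (affPts-shift b u us i)))
    where
    ∨≡xor : ∀ p q → (p ≡ true → q ≡ true → ⊥) → p ∨ q ≡ p xor q
    ∨≡xor false q _ = refl
    ∨≡xor true false _ = refl
    ∨≡xor true true f = ⊥-elim (f refl refl)

Deg-InRM : ∀ k d {h : Subset d} → InRM k d h → Deg (suc k) d h
Deg-InRM k d (As , e) = Deg-resp (suc k) d (λ i → sym (e i)) (go As)
  where
  go : (As : List (AffCodim≤ k d)) → Deg (suc k) d (symDiffAll As)
  go [] = Deg-0 (suc k) d
  go ((r , aff b us ind , p) ∷ As) = Deg-xor (suc k) d
    (Deg-affPts (suc k) b us ind (subst (suc d ℕ.≤_) (sym (ℕₚ.+-suc r k)) (s≤s p))) (go As)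

N-point : ∀ d (b : Ω d) → N d 0 (λ i → idM i b)
N-point zero [] = HalfInt-1 0
N-point (suc d) (false ∷ b) = N-mono d 0 (N-point d b) , N-resp d 0 (λ i → sym (+-identityˡ (- idM i b)))
    (N-neg d 0 (N-point d b))
N-point (suc d) (true ∷ b) = N-0 d 1 , N-resp d 0 (λ i → sym (+-identityʳ (idM i b))) (N-point d b)

-- Each new direction u applies (τ_u + 1)/2, which is `halfDiff (shift u)` plus the identity and
-- raises the level by one.
N-affPts : ∀ {d r} (b : Ω d) (us : Vec (Ω d) r) → LinIndep us → N d r (halfPow r *v indicator (affPts b us))
N-affPts {d} b [] ind = N-resp d 0
  (λ i → trans (cong (if_then 1ℚ else 0ℚ) (sym (affPts-[] b i)))
      (sym (*-identityˡ (indicator (affPts b []) i)))) (N-point d b)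
N-affPts {d} {suc r} b (u ∷ us) ind = N-resp d (suc r) step
  (N-+ d (suc r) (N-halfDiff-shift d r u ih) (N-mono d r ih))
  where
  ih : N d r (halfPow r *v indicator (affPts b us))
  ih = N-affPts b us (LinIndep-tail ind)
  lem : ∀ h p q → ½ * (h * q - h * p) + h * p ≡ (½ * h) * (p + q)
  lem = solve 3 (λ h p q → con ½ :* (h :* q :- h :* p) :+ h :* p := (con ½ :* h) :* (p :+ q)) refl
  add : ∀ p q → (p ≡ true → q ≡ true → ⊥) → (if p then 1ℚ else 0ℚ) + (if q then 1ℚ else 0ℚ) ≡ (if p ∨ q then 1ℚ else 0ℚ)
  add false q _ = +-identityˡ (if q then 1ℚ else 0ℚ)
  add true false _ = refl
  add true true f = ⊥-elim (f refl refl)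
  step : (halfDiff (shift u) (halfPow r *v indicator (affPts b us)) +v (halfPow r *v indicator (affPts b us)))
           ≈v (halfPow (suc r) *v indicator (affPts b (u ∷ us)))
  step i = trans (lem (halfPow r) (indicator (affPts b us) i) (indicator (affPts b us) (i ⊕ u)))
    (cong (halfPow (suc r) *_) (trans (cong (λ z → indicator (affPts b us) i + (if z then 1ℚ else 0ℚ))
        (sym (affPts-shift b u us i)))
      (trans (add (affPts b us i) (affPts (b ⊕ u) us i) (affPts-disjoint b u us ind i))
             (cong (if_then 1ℚ else 0ℚ) (sym (affPts-∷ b u us i))))))

-- Each of m doublings lowers the level by two and removes one of the 2m factors ½. The parameter q
-- collects the factors that remain.
N-descend : ∀ d m q {y : Vect d} → N d (m ℕ.+ m) ((halfPow (m ℕ.+ m) * q) *v y) → N d 0 ((halfPow m * q) *v y)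
N-descend d zero q h = h
N-descend d (suc m) q {y} h = N-resp d 0 (λ i → cong (_* y i) (lem₁ (halfPow m) q))
  (N-descend d m (½ * q) (N-resp d (m ℕ.+ m) (λ i → lem (halfPow (m ℕ.+ m)) q (y i)) (N-double d (m ℕ.+ m) h')))
  where
  h' : N d (2 ℕ.+ (m ℕ.+ m)) ((halfPow (2 ℕ.+ (m ℕ.+ m)) * q) *v y)
  h' = subst (λ k → N d k ((halfPow k * q) *v y)) (cong suc (ℕₚ.+-suc m m)) h
  lem : ∀ h q y → (½ * (½ * h) * q) * y + (½ * (½ * h) * q) * y ≡ (h * (½ * q)) * y
  lem = solve 3 (λ h q y →
      (con ½ :* (con ½ :* h) :* q) :* y :+ (con ½ :* (con ½ :* h) :* q) :* y := (h :* (con ½ :* q)) :* y) refl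
  lem₁ : ∀ h q → h * (½ * q) ≡ (½ * h) * q
  lem₁ = solve 2 (λ h q → h :* (con ½ :* q) := (con ½ :* h) :* q) refl

N-bwGen : ∀ {d} m (A : Aff d (2 ℕ.* m)) S → InRM 2 d S → N d 0 (bwGen m A S)
N-bwGen {d} m (aff b us ind) S rm = N-resp d 0 step (N-eps d 0 (Deg-InRM 2 d rm) (N-descend d m 1ℚ
    (N-resp d (m ℕ.+ m) (λ i → cong (_* ind-A i) (sym (*-identityʳ (halfPow (m ℕ.+ m)))))
      (subst (λ k → N d k (halfPow k *v ind-A)) (cong (m ℕ.+_) (ℕₚ.+-identityʳ m)) (N-affPts b us ind)))))
  where
  ind-A : Vect d
  ind-A = indicator (affPts b us)
  lem : ∀ s h → s * ((h * 1ℚ) * 1ℚ) ≡ h * s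
  lem = solve 2 (λ s h → s :* ((h :* con 1ℚ) :* con 1ℚ) := h :* s) refl
  lem₀ : ∀ s h → s * ((h * 1ℚ) * 0ℚ) ≡ 0ℚ
  lem₀ = solve 2 (λ s h → s :* ((h :* con 1ℚ) :* con 0ℚ) := con 0ℚ) refl
  ite : ∀ b → sg b ≡ (if b then - 1ℚ else 1ℚ)
  ite false = refl
  ite true = refl
  step : eps S ((halfPow m * 1ℚ) *v ind-A) ≈v bwGen m (aff b us ind) S
  step i with affPts b us i
  ... | true = trans (lem (sg (S i)) (halfPow m)) (cong (halfPow m *_) (ite (S i)))
  ... | false = lem₀ (sg (S i)) (halfPow m)

InBW⇒N : ∀ {d} {x : Vect d} → InBW d x → N d 0 x
InBW⇒N (bw-gen m A S rm) = N-bwGen m A S rm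
InBW⇒N {d} bw-zero = N-0 d 0
InBW⇒N {d} (bw-add p q) = N-+ d 0 (InBW⇒N p) (InBW⇒N q)
InBW⇒N {d} (bw-neg p) = N-neg d 0 (InBW⇒N p)
InBW⇒N {d} (bw-resp e p) = N-resp d 0 e (InBW⇒N p)

-- The minimum of the chain

natQ-suc≥1 : ∀ n → 1ℚ ≤ natQ (suc n)
natQ-suc≥1 n = subst (_≤ natQ (suc n)) (+-identityʳ 1ℚ) (+-monoʳ-≤ 1ℚ (natQ≥0 n))
  where
  natQ≥0 : ∀ n → 0ℚ ≤ natQ n
  natQ≥0 zero = ≤-refl
  natQ≥0 (suc n) = +-mono-≤ {0ℚ} {1ℚ} (nonNegative⁻¹ 1ℚ) (natQ≥0 n)

1≤q⇒1≤q² : ∀ {q} → 1ℚ ≤ q → 1ℚ ≤ q * q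
1≤q⇒1≤q² {q} p = ≤-trans p (subst (_≤ q * q) (*-identityʳ q)
  (*-monoˡ-≤-nonNeg q {{nonNegative (≤-trans (nonNegative⁻¹ 1ℚ) p)}} p))

IsInt⇒1≤q² : ∀ {q} → IsInt q → ¬ q ≡ 0ℚ → 1ℚ ≤ q * q
IsInt⇒1≤q² {q} (m , n , e) nz with ℕₚ.≤-total n m
... | inj₁ n≤m with ℕₚ.m≤n⇒∃[o]m+o≡n n≤m
...   | zero , refl = ⊥-elim (nz (trans e (trans (cong (λ k → natQ k - natQ n) (ℕₚ.+-identityʳ n)) (+-inverseʳ (natQ n)))))
...   | suc o , refl = subst (λ z → 1ℚ ≤ z * z) (sym (trans e (trans (cong (_- natQ n) (natQ-+ n (suc o))) (lem (natQ n) (natQ (suc o))))))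
                         (1≤q⇒1≤q² (natQ-suc≥1 o))
  where
  lem : ∀ a b → (a + b) - a ≡ b
  lem = solve 2 (λ a b → (a :+ b) :- a := b) refl
IsInt⇒1≤q² {q} (m , n , e) nz | inj₂ m≤n with ℕₚ.m≤n⇒∃[o]m+o≡n m≤n
...   | zero , refl = ⊥-elim (nz (trans e (trans (cong (λ k → natQ m - natQ k) (ℕₚ.+-identityʳ m)) (+-inverseʳ (natQ m)))))
...   | suc o , refl = subst (1ℚ ≤_) (sym (trans (cong (λ z → z * z) (trans e (cong (λ z → natQ m - z) (natQ-+ m (suc o))))) (lem (natQ m) (natQ (suc o)))))
                         (1≤q⇒1≤q² (natQ-suc≥1 o))
  where
  lem : ∀ a b → (a - (a + b)) * (a - (a + b)) ≡ b * b
  lem = solve 2 (λ a b → (a :- (a :+ b)) :* (a :- (a :+ b)) := b :* b) refl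

¼·4q² : ∀ q → ½ * (½ * ((q + q) * (q + q))) ≡ q * q
¼·4q² = solve 1 (λ q → con ½ :* (con ½ :* ((q :+ q) :* (q :+ q))) := q :* q) refl

½-mono : ∀ {p q} → p ≤ q → ½ * p ≤ ½ * q
½-mono = *-monoˡ-≤-nonNeg ½

HalfInt-min : ∀ n {q} → HalfInt n q → ¬ q ≡ 0ℚ → halfPow n ≤ q * q
HalfInt-min zero h nz = IsInt⇒1≤q² h nz
HalfInt-min (suc zero) h nz = ≤-trans (*≤* (ℤ.+≤+ (s≤s z≤n))) (IsInt⇒1≤q² h nz)
HalfInt-min (suc (suc n)) {q} h nz = subst (halfPow (2 ℕ.+ n) ≤_) (¼·4q² q)
  (½-mono (½-mono (HalfInt-min n h (λ e → nz (trans (lem q) (trans (cong (½ *_) e) (*-zeroʳ ½)))))))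
  where
  lem : ∀ q → q ≡ ½ * (q + q)
  lem = solve 1 (λ q → q := con ½ :* (q :+ q)) refl

dot-suc : ∀ {d} (x y : Vect (suc d)) → dot x y ≡ dot (lo x) (lo y) + dot (hi x) (hi y)
dot-suc x y = trans (dot≡∑ x y) (trans (∑-suc (λ i → x i * y i))
  (sym (cong₂ _+_ (dot≡∑ (lo x) (lo y)) (dot≡∑ (hi x) (hi y)))))

halfPow-split : ∀ n → halfPow (suc n) + halfPow (suc n) ≡ halfPow n
halfPow-split n = solve 1 (λ h → con ½ :* h :+ con ½ :* h := h) refl (halfPow n)

-- The usual estimate for the |u|u+v| construction. If one half vanishes, the other is `df x` up to
-- sign and lies in `N d n`. If neither does, both lie in `N d (suc n)`, where the bound is half as
-- large, and the two contributions add up.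
N-min : ∀ d n {x : Vect d} → N d n x → ¬ x ≈v 0v → halfPow n ≤ dot x x
N-min zero n {x} h nz = subst (halfPow n ≤_) (sym (trans (dot≡∑ x x) (∑-zero (λ i → x i * x i))))
  (HalfInt-min n h (λ e → nz (λ { [] → e })))
N-min (suc d) n {x} (a , b) nz with ≈0? (lo x) | ≈0? (hi x)
... | yes p | yes q = ⊥-elim (nz (λ { (false ∷ i) → p i ; (true ∷ i) → q i }))
... | yes p | no ¬q = subst (halfPow n ≤_) (sym (trans (dot-suc x x) (trans (cong (_+ dot (hi x) (hi x)) (≈0⇒dot≡0 p)) (+-identityˡ (dot (hi x) (hi x))))))
  (N-min d n (N-resp d n (λ i → trans (cong (λ z → hi x i - z) (p i)) (+-identityʳ (hi x i))) b) ¬q)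
... | no ¬p | yes q = subst (halfPow n ≤_) (sym (trans (dot-suc x x) (trans (cong (dot (lo x) (lo x) +_) (≈0⇒dot≡0 q)) (+-identityʳ (dot (lo x) (lo x))))))
  (N-min d n (N-resp d n (λ i → trans (cong -_ (cong (_- lo x i) (q i))) (lem (lo x i))) (N-neg d n b)) ¬p)
  where
  lem : ∀ a → - (0ℚ - a) ≡ a
  lem = solve 1 (λ a → :- (con 0ℚ :- a) := a) refl
... | no ¬p | no ¬q = subst (halfPow n ≤_) (sym (dot-suc x x)) (subst (_≤ dot (lo x) (lo x) + dot (hi x) (hi x)) (halfPow-split n)
  (+-mono-≤ (N-min d (suc n) a ¬p) (N-min d (suc n) (N-resp d (suc n) (λ i → lem (hi x i) (lo x i))
      (N-+ d (suc n) (N-mono d n b) a)) ¬q)))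
  where
  lem : ∀ p q → (p - q) + q ≡ p
  lem = solve 2 (λ p q → (p :- q) :+ q := p) refl

-- Coordinate cubes: N d 0 is contained in BW_d

-- A cube fixes the coordinates carrying just b and leaves the others free.
Cube : ℕ → Set
Cube d = Vec (Maybe Bool) d

inCube : ∀ {d} → Cube d → Subset d
inCube [] [] = true
inCube (nothing ∷ c) (a ∷ i) = inCube c i
inCube (just b ∷ c) (a ∷ i) = not (a xor b) ∧ inCube c i

free : ∀ {d} → Cube d → ℕ
free [] = 0
free (nothing ∷ c) = suc (free c)
free (just b ∷ c) = free c

cubeBase : ∀ {d} → Cube d → Ω d
cubeBase [] = []
cubeBase (nothing ∷ c) = false ∷ cubeBase c
cubeBase (just b ∷ c) = b ∷ cubeBase c

cubeDirs : ∀ {d} (c : Cube d) → Vec (Ω d) (free c)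
cubeDirs [] = []
cubeDirs (nothing ∷ c) = (true ∷ zeroV) ∷ Vec.map (false ∷_) (cubeDirs c)
cubeDirs (just b ∷ c) = Vec.map (false ∷_) (cubeDirs c)

combo-map : ∀ {d r} (c : Vec Bool r) (us : Vec (Ω d) r) → combo c (Vec.map (false ∷_) us) ≡ false ∷ combo c us
combo-map [] [] = refl
combo-map (false ∷ c) (u ∷ us) = cong (zeroV ⊕_) (combo-map c us)
combo-map (true ∷ c) (u ∷ us) = cong ((false ∷ u) ⊕_) (combo-map c us)

cubeIndep : ∀ {d} (c : Cube d) → LinIndep (cubeDirs c)
cubeIndep [] [] e = refl
cubeIndep (just b ∷ c) w e = cubeIndep c w (∷-injectiveʳ (trans (sym (combo-map w (cubeDirs c))) e))
cubeIndep (nothing ∷ c) (false ∷ w) e = cong (false ∷_)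
  (cubeIndep c w (∷-injectiveʳ (trans (sym (combo-map w (cubeDirs c))) (trans
      (sym (⊕-identityˡ (combo w (Vec.map (false ∷_) (cubeDirs c))))) e))))
cubeIndep (nothing ∷ c) (true ∷ w) e with trans (cong ((true ∷ zeroV) ⊕_) (sym (combo-map w (cubeDirs c)))) e
... | ()

cubeAff : ∀ {d} (c : Cube d) → Aff d (free c)
cubeAff c = aff (cubeBase c) (cubeDirs c) (cubeIndep c)

affPts-map : ∀ {d r} b₀ (b : Ω d) (us : Vec (Ω d) r) a i →
  affPts (b₀ ∷ b) (Vec.map (false ∷_) us) (a ∷ i) ≡ not (a xor b₀) ∧ affPts b us i
affPts-map b₀ b [] a i = trans (affPts-[] (b₀ ∷ b) (a ∷ i)) (cong (not (a xor b₀) ∧_) (sym (affPts-[] b i)))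
affPts-map b₀ b (u ∷ us) a i = begin
  affPts (b₀ ∷ b) (Vec.map (false ∷_) (u ∷ us)) (a ∷ i)
    ≡⟨ affPts-∷ (b₀ ∷ b) (false ∷ u) (Vec.map (false ∷_) us) (a ∷ i) ⟩
  affPts (b₀ ∷ b) (Vec.map (false ∷_) us) (a ∷ i) ∨ affPts ((b₀ xor false) ∷ (b ⊕ u)) (Vec.map (false ∷_) us) (a ∷ i)
    ≡⟨ cong₂ _∨_ (affPts-map b₀ b us a i) (trans (affPts-map (b₀ xor false) (b ⊕ u) us a i) (cong (λ z → not (a xor z) ∧ affPts (b ⊕ u) us i) (xor-identityʳ b₀))) ⟩
  (not (a xor b₀) ∧ affPts b us i) ∨ (not (a xor b₀) ∧ affPts (b ⊕ u) us i)
    ≡⟨ sym (∧-distribˡ-∨ (not (a xor b₀)) (affPts b us i) (affPts (b ⊕ u) us i)) ⟩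
  not (a xor b₀) ∧ (affPts b us i ∨ affPts (b ⊕ u) us i)
    ≡⟨ cong (not (a xor b₀) ∧_) (sym (affPts-∷ b u us i)) ⟩
  not (a xor b₀) ∧ affPts b (u ∷ us) i ∎
  where open ≡-Reasoning

inAff-cube : ∀ {d} (c : Cube d) i → inAff (cubeAff c) i ≡ inCube c i
inAff-cube [] [] = refl
inAff-cube (just b ∷ c) (a ∷ i) = trans (affPts-map b (cubeBase c) (cubeDirs c) a i)
    (cong (not (a xor b) ∧_) (inAff-cube c i))
inAff-cube (nothing ∷ c) (a ∷ i) = trans (affPts-∷ (false ∷ cubeBase c) (true ∷ zeroV) (Vec.map (false ∷_) (cubeDirs c)) (a ∷ i))
  (trans (cong₂ _∨_ (trans (affPts-map false (cubeBase c) (cubeDirs c) a i)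
      (cong (not (a xor false) ∧_) (inAff-cube c i)))
     (trans (affPts-map true (cubeBase c ⊕ zeroV) (cubeDirs c) a i)
       (cong (not (a xor true) ∧_) (trans (cong (λ z →
           affPts z (cubeDirs c) i) (⊕-identityʳ (cubeBase c))) (inAff-cube c i)))))
  (lem a (inCube c i)))
  where
  lem : ∀ a q → (not (a xor false) ∧ q) ∨ (not (a xor true) ∧ q) ≡ q
  lem false q = ∨-identityʳ q
  lem true q = refl

record IsSubgroup {d} (P : Vect d → Set) : Set where
  field
    0-closed : P 0v
    +-closed : ∀ {x y} → P x → P y → P (x +v y)
    neg-closed : ∀ {x} → P x → P (-v x)
    resp-closed : ∀ {x y} → x ≈v y → P x → P y

module _ {d} {P : Vect d → Set} (sub : IsSubgroup P) where
  open IsSubgroup sub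

  natQ-closed : ∀ n {x} → P x → P (natQ n *v x)
  natQ-closed zero {x} p = resp-closed (λ i → sym (*-zeroˡ (x i))) 0-closed
  natQ-closed (suc n) {x} p = resp-closed (λ i → lem (natQ n) (x i)) (+-closed p (natQ-closed n p))
    where
    lem : ∀ n x → x + n * x ≡ (1ℚ + n) * x
    lem = solve 2 (λ n x → x :+ n :* x := (con 1ℚ :+ n) :* x) refl

  IsInt-closed : ∀ {q x} → IsInt q → P x → P (q *v x)
  IsInt-closed {q} {x} (m , n , e) p = resp-closed (λ i → trans (lem (natQ m) (natQ n) (x i)) (cong (_* x i) (sym e)))
    (+-closed (natQ-closed m p) (neg-closed (natQ-closed n p)))
    where
    lem : ∀ a b x → a * x + - (b * x) ≡ (a - b) * x
    lem = solve 3 (λ a b x → a :* x :+ :- (b :* x) := (a :- b) :* x) refl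

  HalfInt-closed : ∀ n {q x} → HalfInt n q → (∀ s → s ℕ.+ s ℕ.≤ n → P (halfPow s *v x)) → P (q *v x)
  HalfInt-closed zero {q} {x} h g = resp-closed (λ i → cong (q *_) (*-identityˡ (x i))) (IsInt-closed h (g 0 z≤n))
  HalfInt-closed (suc zero) {q} {x} h g = resp-closed (λ i → cong (q *_) (*-identityˡ (x i))) (IsInt-closed h (g 0 z≤n))
  HalfInt-closed (suc (suc n)) {q} {x} h g = resp-closed (λ i → lem q (x i))
    (HalfInt-closed n {x = ½ *v x} h (λ s p → resp-closed (λ i → lem' (halfPow s) (x i)) (g (suc s) (s≤s
        (subst (ℕ._≤ suc n) (sym (ℕₚ.+-suc s s)) (s≤s p))))))
    where
    lem : ∀ q x → (q + q) * (½ * x) ≡ q * x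
    lem = solve 2 (λ q x → (q :+ q) :* (con ½ :* x) := q :* x) refl
    lem' : ∀ h x → (½ * h) * x ≡ h * (½ * x)
    lem' = solve 2 (λ h x → (con ½ :* h) :* x := h :* (con ½ :* x)) refl

dup : ∀ {d} → Vect d → Vect (suc d)
dup x (_ ∷ i) = x i

top : ∀ {d} → Vect d → Vect (suc d)
top x (false ∷ i) = 0ℚ
top x (true ∷ i) = x i

-- Quantifying over all subgroups P lets the induction pull P back along `dup` and `top`, with x
-- written as `dup (lo x)` plus `top (df x)`. Duplicating a cube frees one more coordinate, which
-- matches the higher level of `lo x`.
N-generated : ∀ d n {P : Vect d → Set} → IsSubgroup P →
  (∀ c s → s ℕ.+ s ℕ.≤ n ℕ.+ free c → P (halfPow s *v indicator (inCube c))) →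
  ∀ {x} → N d n x → P x
N-generated zero n {P} sub g {x} h = resp-closed (λ { [] → *-identityʳ (x []) })
  (HalfInt-closed sub n {x [] } {indicator (inCube [])} h (λ s p → g [] s (subst (s ℕ.+ s ℕ.≤_)
      (sym (ℕₚ.+-identityʳ n)) p)))
  where open IsSubgroup sub
N-generated (suc d) n {P} sub g {x} (a , b) = resp-closed (λ { (false ∷ i) → +-identityʳ (lo x i) ; (true ∷ i) →
    lem (lo x i) (hi x i) })
  (+-closed (N-generated d (suc n) dup-sub dup-gen a) (N-generated d n top-sub top-gen b))
  where
  open IsSubgroup sub
  lem : ∀ a b → a + (b - a) ≡ b
  lem = solve 2 (λ a b → a :+ (b :- a) := b) refl
  dup-sub : IsSubgroup (λ y → P (dup y))
  dup-sub = record
    { 0-closed = resp-closed (λ { (_ ∷ i) → refl }) 0-closed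
    ; +-closed = λ p q → resp-closed (λ { (_ ∷ i) → refl }) (+-closed p q)
    ; neg-closed = λ p → resp-closed (λ { (_ ∷ i) → refl }) (neg-closed p)
    ; resp-closed = λ e → resp-closed (λ { (_ ∷ i) → e i }) }
  top-sub : IsSubgroup (λ y → P (top y))
  top-sub = record
    { 0-closed = resp-closed (λ { (false ∷ i) → refl ; (true ∷ i) → refl }) 0-closed
    ; +-closed = λ p q → resp-closed (λ { (false ∷ i) → refl ; (true ∷ i) → refl }) (+-closed p q)
    ; neg-closed = λ p → resp-closed (λ { (false ∷ i) → refl ; (true ∷ i) → refl }) (neg-closed p)
    ; resp-closed = λ e → resp-closed (λ { (false ∷ i) → refl ; (true ∷ i) → e i }) }
  dup-gen : ∀ c s → s ℕ.+ s ℕ.≤ suc n ℕ.+ free c → P (dup (halfPow s *v indicator (inCube c)))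
  dup-gen c s p = resp-closed (λ { (_ ∷ i) → refl }) (g (nothing ∷ c) s (subst (s ℕ.+ s ℕ.≤_)
      (sym (ℕₚ.+-suc n (free c))) p))
  top-gen : ∀ c s → s ℕ.+ s ℕ.≤ n ℕ.+ free c → P (top (halfPow s *v indicator (inCube c)))
  top-gen c s p = resp-closed (λ { (false ∷ i) → *-zeroʳ (halfPow s) ; (true ∷ i) → refl }) (g (just true ∷ c) s p)

InBW-subgroup : ∀ d → IsSubgroup (InBW d)
InBW-subgroup d = record { 0-closed = bw-zero ; +-closed = bw-add ; neg-closed = bw-neg ; resp-closed = bw-resp }

split-free : ∀ {d} r (c : Cube d) → free c ≡ suc r →
  ∃ λ c₀ → ∃ λ c₁ → free c₀ ≡ r × free c₁ ≡ r × (∀ i → indicator (inCube c) i ≡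
      indicator (inCube c₀) i + indicator (inCube c₁) i)
split-free r (nothing ∷ c) e = just false ∷ c , just true ∷ c , ℕₚ.suc-injective e , ℕₚ.suc-injective e ,
  λ { (false ∷ i) → sym (+-identityʳ (indicator (inCube c) i)) ; (true ∷ i) →
      sym (+-identityˡ (indicator (inCube c) i)) }
split-free r (just b ∷ c) e with split-free r c e
... | c₀ , c₁ , e₀ , e₁ , f = just b ∷ c₀ , just b ∷ c₁ , e₀ , e₁ , λ { (a ∷ i) → lem (not (a xor b)) i }
  where
  lem : ∀ z i → (if z ∧ inCube c i then 1ℚ else 0ℚ) ≡
      (if z ∧ inCube c₀ i then 1ℚ else 0ℚ) + (if z ∧ inCube c₁ i then 1ℚ else 0ℚ)
  lem false i = refl
  lem true i = f i

-- The generators of BW_d demand dimension exactly 2s. A larger cube is cut along free coordinates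
-- into cubes of that dimension, whose vectors add up to the given one.
InBW-cube : ∀ {d} (c : Cube d) s → s ℕ.+ s ℕ.≤ free c → InBW d (halfPow s *v indicator (inCube c))
InBW-cube {d} c s p with ℕₚ.m≤n⇒∃[o]m+o≡n p
... | o , e = go o c (trans (sym e) (ℕₚ.+-comm (s ℕ.+ s) o))
  where
  exact : ∀ {r} (A : Aff d r) → r ≡ 2 ℕ.* s → InBW d (halfPow s *v indicator (inAff A))
  exact A refl = bw-resp step (bw-gen s A (λ _ → false) ([] , λ _ → refl))
    where
    step : bwGen s A (λ _ → false) ≈v (halfPow s *v indicator (inAff A))
    step i with inAff A i
    ... | true = refl
    ... | false = sym (*-zeroʳ (halfPow s))
  go : ∀ o (c : Cube d) → free c ≡ o ℕ.+ (s ℕ.+ s) → InBW d (halfPow s *v indicator (inCube c))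
  go zero c e = bw-resp (λ i → cong (λ z → halfPow s * (if z then 1ℚ else 0ℚ)) (inAff-cube c i))
    (exact (cubeAff c) (trans e (cong (s ℕ.+_) (sym (ℕₚ.+-identityʳ s)))))
  go (suc o) c e with split-free (o ℕ.+ (s ℕ.+ s)) c e
  ... | c₀ , c₁ , e₀ , e₁ , f = bw-resp (λ i → trans (sym (*-distribˡ-+ (halfPow s) (indicator (inCube c₀) i) (indicator (inCube c₁) i))) (cong (halfPow s *_) (sym (f i))))
    (bw-add (go o c₀ e₀) (go o c₁ e₁))

N⇒InBW : ∀ {d} {x : Vect d} → N d 0 x → InBW d x
N⇒InBW {d} = N-generated d 0 (InBW-subgroup d) InBW-cube

-- The hyperplanes xⱼ = 1 with lⱼ = 1, whose symmetric difference is {i : l · i = 1}.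
coordHyperplanes : ∀ {d} → Vec Bool d → List (Cube d)
coordHyperplanes [] = []
coordHyperplanes (false ∷ l) = map (nothing ∷_) (coordHyperplanes l)
coordHyperplanes (true ∷ l) = (just true ∷ replicate _ nothing) ∷ map (nothing ∷_) (coordHyperplanes l)

InRM-linear : ∀ {d} (l : Vec Bool d) → InRM 1 d (λ i → l ∙ i)
InRM-linear {d} l = affs (coordHyperplanes l) (codim l) , λ i → trans
    (sym (xorAll-lin l i)) (xorAll-affs (coordHyperplanes l) (codim l) i)
  where
  Codim1 : ∀ {d} → Cube d → Set
  Codim1 {d} c = d ℕ.≤ free c ℕ.+ 1
  affs : ∀ {d} (cs : List (Cube d)) → All Codim1 cs → List (AffCodim≤ 1 d)
  affs [] [] = []
  affs (c ∷ cs) (p ∷ ps) = (free c , cubeAff c , p) ∷ affs cs ps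
  free-all : ∀ d → free (replicate d nothing) ≡ d
  free-all zero = refl
  free-all (suc d) = cong suc (free-all d)
  codim : ∀ {d} (l : Vec Bool d) → All Codim1 (coordHyperplanes l)
  codim [] = []
  codim (false ∷ l) = map⁺ (All.map s≤s (codim l))
  codim {suc d} (true ∷ l) = ℕₚ.≤-reflexive (trans (cong suc (sym (free-all d)))
      (sym (ℕₚ.+-comm (free (replicate d nothing)) 1))) ∷ map⁺ (All.map s≤s (codim l))
  xorAll : ∀ {d} → List (Cube d) → Subset d
  xorAll [] i = false
  xorAll (c ∷ cs) i = inCube c i xor xorAll cs i
  xorAll-affs : ∀ {d} (cs : List (Cube d)) ps i → xorAll cs i ≡ symDiffAll (affs cs ps) i
  xorAll-affs [] [] i = refl
  xorAll-affs (c ∷ cs) (p ∷ ps) i = cong₂ _xor_ (sym (inAff-cube c i)) (xorAll-affs cs ps i)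
  xorAll-map : ∀ {d} (cs : List (Cube d)) a i → xorAll (map (nothing ∷_) cs) (a ∷ i) ≡ xorAll cs i
  xorAll-map [] a i = refl
  xorAll-map (c ∷ cs) a i = cong (inCube c i xor_) (xorAll-map cs a i)
  inAll : ∀ {d} (i : Ω d) → inCube (replicate d nothing) i ≡ true
  inAll [] = refl
  inAll (a ∷ i) = inAll i
  xorAll-lin : ∀ {d} (l : Vec Bool d) i → xorAll (coordHyperplanes l) i ≡ l ∙ i
  xorAll-lin [] [] = refl
  xorAll-lin (false ∷ l) (a ∷ i) = trans (xorAll-map (coordHyperplanes l) a i) (xorAll-lin l i)
  xorAll-lin (true ∷ l) (a ∷ i) = cong₂ _xor_ (lem a i)
    (trans (xorAll-map (coordHyperplanes l) a i) (xorAll-lin l i))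
    where
    lem : ∀ a i → not (a xor true) ∧ inCube (replicate _ nothing) i ≡ a
    lem false i = refl
    lem true i = inAll i

-- The extraspecial group R

-- R/{±1}: the pair (c , l) stands for the class of τ_c ε_l.
U : ℕ → Set
U d = Vec Bool d × Vec Bool d

_⊞_ : ∀ {d} → U d → U d → U d
(c , l) ⊞ (c' , l') = c ⊕ c' , l ⊕ l'

0U : ∀ {d} → U d
0U = zeroV , zeroV

-- β is the cocycle of R over R/{±1}, the exponent of the sign in the product of the representatives
-- τ_c ε_l. Consequently κ is the commutator form, and `sq` below is the quadratic form given by
-- squaring in R.
β κ : ∀ {d} → U d → U d → Bool
β (c , l) (c' , l') = l ∙ c'
κ g h = β g h xor β h g

sq : ∀ {d} → U d → Bool
sq g = β g g

linear : ∀ {d} → Vec Bool d → Subset d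
linear l i = l ∙ i

act : ∀ {d} → U d → Vect d → Vect d
act (c , l) x = eps (linear l) (shift c x)

⊞-comm : ∀ {d} (g h : U d) → g ⊞ h ≡ h ⊞ g
⊞-comm (c , l) (c' , l') = cong₂ _,_ (⊕-comm c c') (⊕-comm l l')

⊞-zero⇒≡ : ∀ {d} {g h : U d} → g ⊞ h ≡ 0U → g ≡ h
⊞-zero⇒≡ e = cong₂ _,_ (⊕-zero⇒≡ (cong proj₁ e)) (⊕-zero⇒≡ (cong proj₂ e))

β-⊞ˡ : ∀ {d} (g h k : U d) → β (g ⊞ h) k ≡ β g k xor β h k
β-⊞ˡ (_ , l) (_ , l') (c , _) = ∙-distribʳ l l' c

β-⊞ʳ : ∀ {d} (g h k : U d) → β g (h ⊞ k) ≡ β g h xor β g k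
β-⊞ʳ (_ , l) (c , _) (c' , _) = ∙-distribˡ l c c'

κ-sym : ∀ {d} (g h : U d) → κ g h ≡ κ h g
κ-sym g h = xor-comm (β g h) (β h g)

κ-⊞ˡ : ∀ {d} (g h k : U d) → κ (g ⊞ h) k ≡ κ g k xor κ h k
κ-⊞ˡ g h k = trans (cong₂ _xor_ (β-⊞ˡ g h k) (β-⊞ʳ k g h)) (xor-interchange (β g k) (β h k) (β k g) (β k h))

κ-⊞ʳ : ∀ {d} (g h k : U d) → κ g (h ⊞ k) ≡ κ g h xor κ g k
κ-⊞ʳ g h k = trans (κ-sym g (h ⊞ k)) (trans (κ-⊞ˡ h k g) (cong₂ _xor_ (κ-sym h g) (κ-sym k g)))

sq-⊞ : ∀ {d} (g h : U d) → sq (g ⊞ h) ≡ (sq g xor sq h) xor κ g h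
sq-⊞ g h = begin
  β (g ⊞ h) (g ⊞ h)                           ≡⟨ β-⊞ˡ g h (g ⊞ h) ⟩
  β g (g ⊞ h) xor β h (g ⊞ h)                 ≡⟨ cong₂ _xor_ (β-⊞ʳ g g h) (β-⊞ʳ h g h) ⟩
  (β g g xor β g h) xor (β h g xor β h h)     ≡⟨ cong ((β g g xor β g h) xor_) (xor-comm (β h g) (β h h)) ⟩
  (β g g xor β g h) xor (β h h xor β h g)     ≡⟨ xor-interchange (β g g) (β g h) (β h h) (β h g) ⟩
  (sq g xor sq h) xor κ g h                   ∎
  where open ≡-Reasoning

κ-nondegenerate : ∀ {d} (g : U d) → g ≡ 0U ⊎ ∃ λ h → κ g h ≡ true
κ-nondegenerate (c , l) with ∙-nondegenerate l | ∙-nondegenerate c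
... | inj₂ (v , p) | _ = inj₂ ((v , zeroV) , cong₂ _xor_ p (zero∙ c))
... | inj₁ p | inj₂ (v , q) = inj₂ ((zeroV , v) , cong₂ _xor_ (∙zero l) (trans (∙-comm v c) q))
... | inj₁ p | inj₁ q = inj₁ (cong₂ _,_ q p)

act-linear : ∀ {d} (g : U d) → Linear (act g)
act-linear (c , l) = record
  { ≈-cong = λ p i → cong (sg (l ∙ i) *_) (p (i ⊕ c))
  ; +-homo = λ x y i → *-distribˡ-+ (sg (l ∙ i)) (x (i ⊕ c)) (y (i ⊕ c))
  ; *-homo = λ q x i → *-swap (sg (l ∙ i)) q (x (i ⊕ c))
  }

act-∘ : ∀ {d} (g h : U d) x → act h (act g x) ≈v (sg (β g h) *v act (g ⊞ h) x)
act-∘ (c , l) (c' , l') x i = begin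
  sg (l' ∙ i) * (sg (l ∙ (i ⊕ c')) * x ((i ⊕ c') ⊕ c))
    ≡⟨ cong₂ (λ a b → sg (l' ∙ i) * (a * x b)) (trans (cong sg (∙-distribˡ l i c')) (sg-xor (l ∙ i) (l ∙ c')))
         (trans (⊕-assoc i c' c) (cong (i ⊕_) (⊕-comm c' c))) ⟩
  sg (l' ∙ i) * ((sg (l ∙ i) * sg (l ∙ c')) * x (i ⊕ (c ⊕ c')))
    ≡⟨ lem (sg (l' ∙ i)) (sg (l ∙ i)) (sg (l ∙ c')) (x (i ⊕ (c ⊕ c'))) ⟩
  sg (l ∙ c') * ((sg (l ∙ i) * sg (l' ∙ i)) * x (i ⊕ (c ⊕ c')))
    ≡⟨ cong (λ a → sg (l ∙ c') * (a * x (i ⊕ (c ⊕ c')))) (trans (sym (sg-xor (l ∙ i) (l' ∙ i))) (cong sg (sym (∙-distribʳ l l' i)))) ⟩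
  sg (l ∙ c') * (sg ((l ⊕ l') ∙ i) * x (i ⊕ (c ⊕ c'))) ∎
  where
  open ≡-Reasoning
  lem : ∀ a b c x → a * ((b * c) * x) ≡ c * ((b * a) * x)
  lem = solve 4 (λ a b c x → a :* ((b :* c) :* x) := c :* ((b :* a) :* x)) refl

sg-*v : ∀ {d} a b (x : Vect d) → (sg a *v (sg b *v x)) ≈v (sg (a xor b) *v x)
sg-*v a b x i = trans (sym (*-assoc (sg a) (sg b) (x i))) (cong (_* x i) (sym (sg-xor a b)))

sg-*v-cancel : ∀ {d} a {x y : Vect d} → x ≈v (sg a *v y) → (sg a *v x) ≈v y
sg-*v-cancel a {x} {y} p i = trans (cong (sg a *_) (p i)) (sg-cancel a (y i))

act-comm : ∀ {d} (g h : U d) x → act h (act g x) ≈v (sg (κ g h) *v act g (act h x))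
act-comm g h x i = trans (act-∘ g h x i)
  (sym (trans (cong (sg (κ g h) *_) (trans (act-∘ h g x i) (cong (λ k → sg (β h g) * act k x i) (⊞-comm h g))))
       (trans (sg-*v (κ g h) (β h g) (act (g ⊞ h) x) i) (cong (λ a → sg a * act (g ⊞ h) x i) (lem (β g h) (β h g))))))
  where
  lem : ∀ a b → (a xor b) xor b ≡ a
  lem a b = trans (xor-assoc a b b) (trans (cong (a xor_) (xor-same b)) (xor-identityʳ a))

act-0U : ∀ {d} (x : Vect d) → act 0U x ≈v x
act-0U x i = trans (cong₂ (λ a b → sg a * x b) (zero∙ i) (⊕-identityʳ i)) (*-identityˡ (x i))

act-sq : ∀ {d} (g : U d) x → act g (act g x) ≈v (sg (sq g) *v x)
act-sq g@(c , l) x i = trans (act-∘ g g x i)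
  (cong (sg (sq g) *_) (trans (cong (λ k → act k x i) (cong₂ _,_ (⊕-self c) (⊕-self l))) (act-0U x i)))

act-dot : ∀ {d} (g : U d) x y → dot (act g x) (act g y) ≡ dot x y
act-dot (c , l) x y = trans (dot≡∑ (act (c , l) x) (act (c , l) y))
  (trans (∑-cong (λ i → trans (lem (sg (l ∙ i)) (x (i ⊕ c)) (y (i ⊕ c)))
      (trans (cong (_* (x (i ⊕ c) * y (i ⊕ c))) (sg-sq (l ∙ i))) (*-identityˡ (x (i ⊕ c) * y (i ⊕ c))))))
  (trans (∑-shift c (λ i → x i * y i)) (sym (dot≡∑ x y))))
  where
  lem : ∀ s a b → (s * a) * (s * b) ≡ (s * s) * (a * b)
  lem = solve 3 (λ s a b → (s :* a) :* (s :* b) := (s :* s) :* (a :* b)) refl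

dot-actˡ : ∀ {d} (g : U d) x y → dot (act g x) y ≡ sg (sq g) * dot x (act g y)
dot-actˡ g x y = trans (sym (act-dot g (act g x) y))
  (trans (dot-congˡ (act g y) (act-sq g x)) (dot-*ˡ (sg (sq g)) x (act g y)))

Deg-linear : ∀ {d} (l : Vec Bool d) → Deg 2 d (linear l)
Deg-linear {d} l = Deg-InRM 1 d (InRM-linear l)

N-halfDiff-act : ∀ d n g {x : Vect d} → N d n x → N d (suc n) (halfDiff (act g) x)
N-halfDiff-act d n (c , l) {x} h = N-resp d (suc n) (λ i → lem (act (c , l) x i) (shift c x i) (x i))
  (N-+ d (suc n) (N-halfDiff-eps d n (Deg-linear l) (N-shift d n c h)) (N-halfDiff-shift d n c h))
  where
  lem : ∀ p q r → ½ * (p - q) + ½ * (q - r) ≡ ½ * (p - r)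
  lem = solve 3 (λ p q r → con ½ :* (p :- q) :+ con ½ :* (q :- r) := con ½ :* (p :- r)) refl

N-act : ∀ d n g {x : Vect d} → N d n x → N d n (act g x)
N-act d n g h = N-from-halfDiff d n (act g) h (N-halfDiff-act d n g h)

-- The Fourier coefficients at (0, l) and (1, l) are the sum and the difference of the coefficients
-- at l of the two halves, so both halves have vanishing coefficients.
fourier-injective : ∀ {d} (h : Vect d) → (∀ l → ∑ (λ i → sg (l ∙ i) * h i) ≡ 0ℚ) → h ≈v 0v
fourier-injective {zero} h p [] = trans (sym (*-identityˡ (h []))) (trans (sym (∑-zero (λ i →
    sg ([] ∙ i) * h i))) (p []))
fourier-injective {suc d} h p = λ
  { (false ∷ i) → fourier-injective (lo h) (λ l → halves₀ (A l) (B l) (sum≡0 l) (diff≡0 l)) i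
  ; (true ∷ i) → fourier-injective (hi h) (λ l → halves₁ (A l) (B l) (sum≡0 l) (diff≡0 l)) i }
  where
  A B : Vec Bool d → ℚ
  A l = ∑ (λ i → sg (l ∙ i) * lo h i)
  B l = ∑ (λ i → sg (l ∙ i) * hi h i)
  sum≡0 : ∀ l → A l + B l ≡ 0ℚ
  sum≡0 l = trans (sym (∑-suc (λ i → sg ((false ∷ l) ∙ i) * h i))) (p (false ∷ l))
  diff≡0 : ∀ l → A l - B l ≡ 0ℚ
  diff≡0 l = trans (cong (A l +_) (trans (sym (∑-neg (λ i → sg (l ∙ i) * hi h i)))
      (∑-cong (λ i → trans (neg-distribˡ-* (sg (l ∙ i)) (hi h i)) (cong (_* hi h i) (sym (sg-not (l ∙ i))))))))
    (trans (sym (∑-suc (λ i → sg ((true ∷ l) ∙ i) * h i))) (p (true ∷ l)))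
  halves₀ : ∀ a b → a + b ≡ 0ℚ → a - b ≡ 0ℚ → a ≡ 0ℚ
  halves₀ a b p q = trans (lem a b) (cong₂ (λ y z → ½ * (y + z)) p q)
    where
    lem : ∀ a b → a ≡ ½ * ((a + b) + (a - b))
    lem = solve 2 (λ a b → a := con ½ :* ((a :+ b) :+ (a :- b))) refl
  halves₁ : ∀ a b → a + b ≡ 0ℚ → a - b ≡ 0ℚ → b ≡ 0ℚ
  halves₁ a b p q = trans (lem a b) (cong₂ (λ y z → ½ * (y - z)) p q)
    where
    lem : ∀ a b → b ≡ ½ * ((a + b) - (a - b))
    lem = solve 2 (λ a b → b := con ½ :* ((a :+ b) :- (a :- b))) refl

-- This is the irreducibility of R. For a fixed translation c, the products of z with τ_c ε_l
-- applied to y are the Fourier coefficients of k ↦ z_k y_{k+c}, so this function vanishes. With c =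
-- i + j and k = i this gives z_i y_j = 0 for all i and j.
orthogonal-to-orbit : ∀ {d} (z y : Vect d) → dot y y ≡ 1ℚ → (∀ g → dot z (act g y) ≡ 0ℚ) → z ≈v 0v
orthogonal-to-orbit {d} z y unit p i = begin
  z i                              ≡⟨ sym (*-identityʳ (z i)) ⟩
  z i * 1ℚ                         ≡⟨ cong (z i *_) (sym (trans (sym (dot≡∑ y y)) unit)) ⟩
  z i * ∑ (λ j → y j * y j)        ≡⟨ sym (∑-* (z i) (λ j → y j * y j)) ⟩
  ∑ (λ j → z i * (y j * y j))      ≡⟨ ∑-cong (λ j → trans (sym (*-assoc (z i) (y j) (y j))) (trans (cong (_* y j) (prod j)) (*-zeroˡ (y j)))) ⟩
  ∑ {d} (λ _ → 0ℚ)                 ≡⟨ ∑-0 {d} ⟩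
  0ℚ                               ∎
  where
  open ≡-Reasoning
  prod : ∀ j → z i * y j ≡ 0ℚ
  prod j = trans (cong (λ k → z i * y k) (sym (trans (cong (i ⊕_) (⊕-comm i j))
      (trans (⊕-comm i (j ⊕ i)) (⊕-cancel j i)))))
    (fourier-injective (λ k → z k * y (k ⊕ (i ⊕ j)))
      (λ l → trans (∑-cong (λ k → *-swap (sg (l ∙ k)) (z k) (y (k ⊕ (i ⊕ j))))) (trans (sym
          (dot≡∑ z (act (i ⊕ j , l) y))) (p (i ⊕ j , l)))) i)

≡-from-sg : ∀ {d} a b (x : Vect d) → ¬ dot x x ≡ 0ℚ → (sg a *v x) ≈v (sg b *v x) → a ≡ b
≡-from-sg a b x nz e = lem a b (dot x x) nz
  (trans (sym (dot-*ˡ (sg a) x x)) (trans (dot-congˡ x e) (dot-*ˡ (sg b) x x)))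
  where
  neg-fix : ∀ q → 1ℚ * q ≡ - 1ℚ * q → q ≡ 0ℚ
  neg-fix q e = trans (half q) (trans (cong (λ z → ½ * (z - - 1ℚ * q)) e) (cong (½ *_) (+-inverseʳ (- 1ℚ * q))))
    where
    half : ∀ q → q ≡ ½ * (1ℚ * q - - 1ℚ * q)
    half = solve 1 (λ q → q := con ½ :* (con 1ℚ :* q :- con (- 1ℚ) :* q)) refl
  lem : ∀ a b q → ¬ q ≡ 0ℚ → sg a * q ≡ sg b * q → a ≡ b
  lem false false q nz e = refl
  lem true true q nz e = refl
  lem false true q nz e = ⊥-elim (nz (neg-fix q e))
  lem true false q nz e = ⊥-elim (nz (neg-fix q (sym e)))

-- Matrices in R and the operators act

·-epsM : ∀ {d} (x : Vect d) (S : Subset d) → (x · epsM S) ≈v eps S x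
·-epsM {d} x S j = trans (sym (∑≡sumΩ (λ i → x i * epsM S i j)))
  (trans (∑-cong (λ i → trans (cong (x i *_) (entry i)) (*-swap (x i) (sg (S j)) (idM i j))))
  (trans (∑-* (sg (S j)) (λ i → x i * idM i j)) (cong (sg (S j) *_) (∑-idM x j))))
  where
  ite : ∀ b → (if b then - 1ℚ else 1ℚ) ≡ sg b * 1ℚ
  ite false = refl
  ite true = refl
  entry : ∀ i → epsM S i j ≡ sg (S j) * idM i j
  entry i with i ==v j in e
  ... | true = trans (cong (λ k → if S k then - 1ℚ else 1ℚ) (==v⇒≡ i j e)) (ite (S j))
  ... | false = sym (*-zeroʳ (sg (S j)))

·-tauM : ∀ {d} (x : Vect d) c → (x · tauM c) ≈v shift c x
·-tauM x c j = trans (sym (∑≡sumΩ (λ i → x i * tauM c i j)))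
  (trans (∑-cong (λ i → cong (λ b → x i * (if b then 1ℚ else 0ℚ)) (trans (==v-shift j i c) (==v-sym (j ⊕ c) i))))
         (∑-idM x (j ⊕ c)))

InR⇒act : ∀ {d} {M : Mat d} → InR d M → ∃ λ b → ∃ λ g → ∀ x → (x · M) ≈v (sg b *v act g x)
InR⇒act {d} (r-eps S rm) with Deg-2-affine d (Deg-InRM 1 d rm)
... | b , l , p = b , (zeroV , l) , λ x i → trans (·-epsM x S i)
    (trans (cong (_* x i) (trans (cong sg (p i)) (sg-xor b (l ∙ i))))
    (trans (*-assoc (sg b) (sg (l ∙ i)) (x i)) (cong (λ k → sg b * (sg (l ∙ i) * x k)) (sym (⊕-identityʳ i)))))
InR⇒act (r-tau c) = false , (c , zeroV) , λ x i → trans (·-tauM x c i)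
    (sym (trans (*-identityˡ (sg (zeroV ∙ i) * x (i ⊕ c))) (trans (cong (λ a →
        sg a * x (i ⊕ c)) (zero∙ i)) (*-identityˡ (x (i ⊕ c))))))
InR⇒act r-id = false , 0U , λ x i → trans (·-idM x i) (sym (trans (*-identityˡ (act 0U x i)) (act-0U x i)))
InR⇒act (r-comp {M} {M'} p q) with InR⇒act p | InR⇒act q
... | b , g , e | b' , g' , e' = (b' xor b) xor β g g' , g ⊞ g' , λ x → ≈v-trans (·-∘m x M M')
    (≈v-trans (e' (x · M)) (≈v-trans (*v-cong (sg b') (≈v-trans (≈-cong (e x)) (*-homo (sg b) (act g x))))
    (≈v-trans (sg-*v b' b (act g' (act g x))) (≈v-trans (*v-cong (sg (b' xor b)) (act-∘ g g' x))
        (sg-*v (b' xor b) (β g g') (act (g ⊞ g') x))))))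
  where open Linear (act-linear g')
InR⇒act (r-resp {M} {M'} e p) with InR⇒act p
... | b , g , e' = b , g , λ x → ≈v-trans (≈v-sym (·-cong x e)) (e' x)

actM : ∀ {d} → U d → Mat d
actM (c , l) = tauM c ∘m epsM (linear l)

InR-actM : ∀ {d} (g : U d) → InR d (actM g)
InR-actM (c , l) = r-comp (r-tau c) (r-eps (linear l) (InRM-linear l))

·-actM : ∀ {d} (g : U d) x → (x · actM g) ≈v act g x
·-actM (c , l) x = ≈v-trans (·-∘m x (tauM c) (epsM (linear l)))
  (≈v-trans (·-epsM (x · tauM c) (linear l)) (λ i → cong (sg (l ∙ i) *_) (·-tauM x c i)))

-- Operators equal up to sign have the same commutator with every k, so g ⊞ h lies in the radical of
-- κ, which is zero. Hence an operator determines its class in R/{±1}.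
act-injective : ∀ {d} {g h : U d} b → (∀ x → act g x ≈v (sg b *v act h x)) → g ≡ h
act-injective {d} {g} {h} b p with κ-nondegenerate (g ⊞ h)
... | inj₁ e = ⊞-zero⇒≡ e
... | inj₂ (k , e) = ⊥-elim (absurd (trans (sym e) (trans (κ-⊞ˡ g h k) (trans (cong (_xor κ h k) same) (xor-same (κ h k))))))
  where
  absurd : ¬ true ≡ false
  absurd ()
  x : Vect d
  x = idM zeroV
  unit : ∀ j → dot (idM j) (idM j) ≡ 1ℚ
  unit j = trans (dot-idM (idM j) j) (cong (if_then 1ℚ else 0ℚ) (==v-refl j))
  y : Vect d
  y = act g (act k x)
  y≢0 : ¬ dot y y ≡ 0ℚ
  y≢0 e = 1≢0 (trans (sym (trans (act-dot g (act k x) (act k x)) (trans (act-dot k x x) (unit (zeroV {d}))))) e)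
  open Linear
  same : κ g k ≡ κ h k
  same = ≡-from-sg (κ g k) (κ h k) y y≢0
    (≈v-trans (≈v-sym (act-comm g k x))
    (≈v-trans (≈-cong (act-linear k) (p x))
    (≈v-trans (*-homo (act-linear k) (sg b) (act h x))
    (≈v-trans (*v-cong (sg b) (act-comm h k x))
    (≈v-trans (λ i → *-swap (sg b) (sg (κ h k)) (act h (act k x) i))
    (*v-cong (sg (κ h k)) (≈v-sym (p (act k x)))))))))

∈-allVecs : ∀ {d} (v : Vec Bool d) → v ∈ allVecs d
∈-allVecs [] = here refl
∈-allVecs {suc d} (false ∷ v) = ∈-++⁺ˡ (∈-map⁺ (false ∷_) (∈-allVecs v))
∈-allVecs {suc d} (true ∷ v) = ∈-++⁺ʳ (map (false ∷_) (allVecs d)) (∈-map⁺ (true ∷_) (∈-allVecs v))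

allU : ∀ d → List (U d)
allU d = cartesianProduct (allVecs d) (allVecs d)

∈-allU : ∀ {d} (g : U d) → g ∈ allU d
∈-allU (c , l) = ∈-cartesianProduct⁺ (∈-allVecs c) (∈-allVecs l)

true≢false : ¬ true ≡ false
true≢false ()

x≡-x⇒0 : ∀ {q} → q ≡ - q → q ≡ 0ℚ
x≡-x⇒0 {q} e = trans (lem q) (trans (cong (λ z → ½ * (q + z)) e) (trans (cong (½ *_) (+-inverseʳ q)) (*-zeroʳ ½)))
  where
  lem : ∀ q → q ≡ ½ * (q + q)
  lem = solve 1 (λ q → q := con ½ :* (q :+ q)) refl

act-idM : ∀ {d} (g : U d) j → act g (idM j) ≈v (sg (proj₂ g ∙ (j ⊕ proj₁ g)) *v idM (j ⊕ proj₁ g))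
act-idM (c , l) j i with j ==v (i ⊕ c) in e
... | true = trans (cong (λ k → sg (l ∙ k) * 1ℚ) (trans (sym (⊕-cancel i c)) (cong (_⊕ c) (sym (==v⇒≡ j (i ⊕ c) e)))))
  (cong (λ b → sg (l ∙ (j ⊕ c)) * (if b then 1ℚ else 0ℚ)) (sym (trans (sym (==v-shift j i c)) e)))
... | false = trans (*-zeroʳ (sg (l ∙ i))) (sym (trans
  (cong (λ b → sg (l ∙ (j ⊕ c)) * (if b then 1ℚ else 0ℚ)) (trans
      (sym (==v-shift j i c)) e)) (*-zeroʳ (sg (l ∙ (j ⊕ c))))))

dot-idM-self : ∀ {d} (j : Ω d) → dot (idM j) (idM j) ≡ 1ℚ
dot-idM-self j = trans (dot-idM (idM j) j) (cong (if_then 1ℚ else 0ℚ) (==v-refl j))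

Tr : ∀ {d} → (Vect d → Vect d) → ℚ
Tr A = ∑ (λ i → dot (idM i) (A (idM i)))

-- Elements of R permute the standard basis up to signs, and each sign enters twice. The trace is
-- therefore invariant under conjugation by R without any general trace identity.
Tr-conj : ∀ {d} (g : U d) {A : Vect d → Vect d} → Linear A → ∑ (λ i → dot (act g (idM i)) (A (act g (idM i)))) ≡ Tr A
Tr-conj (c , l) {A} lin = trans (∑-cong step) (∑-shift c (λ i → dot (idM i) (A (idM i))))
  where
  open Linear lin
  step : ∀ i → dot (act (c , l) (idM i)) (A (act (c , l) (idM i))) ≡ dot (idM (i ⊕ c)) (A (idM (i ⊕ c)))
  step i = trans (dot-cong (act-idM (c , l) i) (≈v-trans (≈-cong (act-idM (c , l) i)) (*-homo s (idM (i ⊕ c)))))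
    (trans (dot-*ˡ s (idM (i ⊕ c)) (s *v A (idM (i ⊕ c)))) (trans (cong (s *_)
        (dot-*ʳ s (idM (i ⊕ c)) (A (idM (i ⊕ c)))))
      (sg-cancel (l ∙ (i ⊕ c)) (dot (idM (i ⊕ c)) (A (idM (i ⊕ c)))))))
    where
    s : ℚ
    s = sg (l ∙ (i ⊕ c))

-- Eigenvectors of elements of R and their stabilizers

record Eig {d} (y : Vect d) (g : U d) : Set where
  constructor eig
  field
    sign : Bool
    eigen : act g y ≈v (sg sign *v y)

Eig-⊞ : ∀ {d} {y : Vect d} {g h} → Eig y g → Eig y h → Eig y (g ⊞ h)
Eig-⊞ {y = y} {g} {h} (eig b p) (eig b' p') = eig (β g h xor (b xor b'))
  (≈v-trans (≈v-sym (sg-*v-cancel (β g h) (act-∘ g h y)))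
  (≈v-trans (*v-cong (sg (β g h)) (≈v-trans (≈-cong p) (≈v-trans (*-homo (sg b) y) (≈v-trans
      (*v-cong (sg b) p') (sg-*v b b' y)))))
            (sg-*v (β g h) (b xor b') y)))
  where open Linear (act-linear h)

Eig-κ : ∀ {d} {y : Vect d} {g h} → ¬ dot y y ≡ 0ℚ → Eig y g → Eig y h → κ g h ≡ false
Eig-κ {y = y} {g} {h} nz (eig b p) (eig b' p') = xor≡⇒false (≡-from-sg (b xor b') (κ g h xor (b' xor b)) y nz
  (≈v-trans (≈v-sym (both {g} {h} b b' p p')) (≈v-trans (act-comm g h y) (≈v-trans
      (*v-cong (sg (κ g h)) (both {h} {g} b' b p' p)) (sg-*v (κ g h) (b' xor b) y)))))
  where
  both : ∀ {g h} b b' → act g y ≈v (sg b *v y) → act h y ≈v (sg b' *v y) → act h (act g y) ≈v (sg (b xor b') *v y)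
  both {g} {h} b b' p p' = ≈v-trans (Linear.≈-cong (act-linear h) p)
    (≈v-trans (Linear.*-homo (act-linear h) (sg b) y) (≈v-trans (*v-cong (sg b) p') (sg-*v b b' y)))
  xor≡⇒false : b xor b' ≡ κ g h xor (b' xor b) → κ g h ≡ false
  xor≡⇒false e = lem (κ g h) (b xor b') (trans e (cong (κ g h xor_) (xor-comm b' b)))
    where
    lem : ∀ a c → c ≡ a xor c → a ≡ false
    lem false c e = refl
    lem true false ()
    lem true true ()

Eig-sq : ∀ {d} {y : Vect d} {g} → ¬ dot y y ≡ 0ℚ → Eig y g → sq g ≡ false
Eig-sq {y = y} {g} nz (eig b p) = ≡-from-sg (sq g) false y nz
  (≈v-trans (≈v-sym (act-sq g y)) (≈v-trans (≈-cong p) (≈v-trans (*-homo (sg b) y)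
    (≈v-trans (*v-cong (sg b) p) (≈v-trans (sg-*v b b y) (λ i → cong (λ a → sg a * y i) (xor-same b)))))))
  where open Linear (act-linear g)

-- As r anticommutes with g, it carries y into the opposite eigenspace of the isometry g.
orthogonal : ∀ {d} {z y : Vect d} {g r} b → act g z ≈v (sg b *v z) → act g y ≈v (sg b *v y) → κ g r ≡ true →
    dot z (act r y) ≡ 0ℚ
orthogonal {z = z} {y} {g} {r} b ez ey k = x≡-x⇒0 (begin
  dot z (act r y)                                  ≡⟨ sym (act-dot g z (act r y)) ⟩
  dot (act g z) (act g (act r y))                  ≡⟨ dot-cong ez (≈v-trans (act-comm r g y) (*v-cong (sg (κ r g)) (≈v-trans (Linear.≈-cong (act-linear r) ey) (Linear.*-homo (act-linear r) (sg b) y)))) ⟩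
  dot (sg b *v z) (sg (κ r g) *v (sg b *v act r y)) ≡⟨ dot-*ˡ (sg b) z (sg (κ r g) *v (sg b *v act r y)) ⟩
  sg b * dot z (sg (κ r g) *v (sg b *v act r y))   ≡⟨ cong (sg b *_) (trans (dot-*ʳ (sg (κ r g)) z (sg b *v act r y)) (cong (sg (κ r g) *_) (dot-*ʳ (sg b) z (act r y)))) ⟩
  sg b * (sg (κ r g) * (sg b * dot z (act r y)))   ≡⟨ cong (λ a → sg b * (sg a * (sg b * dot z (act r y)))) (trans (κ-sym r g) k) ⟩
  sg b * (- 1ℚ * (sg b * dot z (act r y)))         ≡⟨ lem (sg b) (dot z (act r y)) ⟩
  - (sg b * (sg b * dot z (act r y)))              ≡⟨ cong -_ (sg-cancel b (dot z (act r y))) ⟩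
  - dot z (act r y)                                ∎)
  where
  open ≡-Reasoning
  lem : ∀ s q → s * (- 1ℚ * (s * q)) ≡ - (s * (s * q))
  lem = solve 2 (λ s q → s :* (con (- 1ℚ) :* (s :* q)) := :- (s :* (s :* q))) refl

-- The stabilizer of the line of y is a maximal isotropic subgroup of R/{±1}.
IsFrame : ∀ {d} → Vect d → Set
IsFrame {d} y = ∀ r → Eig y r ⊎ ∃ λ g → Eig y g × κ g r ≡ true

level : Bool → ℕ
level false = 0
level true = 1

-- For p = true, y is a vector of squared norm ½ in the next lattice N d 1 of the chain.
record Good {d} (p : Bool) (y : Vect d) : Set where
  field
    member : N d (level p) y
    normed : dot y y ≡ halfPow (level p)
    frame : IsFrame y

  nonzero : ¬ dot y y ≡ 0ℚ
  nonzero e = lem p (trans (sym normed) e)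
    where
    lem : ∀ p → ¬ halfPow (level p) ≡ 0ℚ
    lem false ()
    lem true ()

Good-point : ∀ {d} → Good {d} false (idM zeroV)
Good-point {d} = record
  { member = N-resp d 0 (λ i → idM-sym i zeroV) (N-point d zeroV)
  ; normed = dot-idM-self {d} zeroV
  ; frame = fr
  }
  where
  diag : ∀ l → Eig (idM zeroV) (zeroV , l)
  diag l = eig (l ∙ (zeroV ⊕ zeroV)) (≈v-trans (act-idM (zeroV , l) zeroV)
    (λ i → cong (λ k → sg (l ∙ (zeroV ⊕ zeroV)) * idM k i) (⊕-identityʳ zeroV)))
  fr : IsFrame (idM zeroV)
  fr (c , l) with ∙-nondegenerate c
  ... | inj₁ refl = inj₁ (diag l)
  ... | inj₂ (v , p) = inj₂ ((zeroV , v) , diag v , cong₂ _xor_ (trans (∙-comm v c) p) (∙zero l))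

-- Replacing y by y + hy changes the squared norm by a factor 2, hence the two levels of Good.
module _ {d} {h : U d} (h² : sq h ≡ false) where
  open Linear (act-linear h)

  symmetrize : Vect d → Vect d
  symmetrize y = y +v act h y

  act-h² : ∀ y → act h (act h y) ≈v y
  act-h² y i = trans (act-sq h y i) (trans (cong (λ a → sg a * y i) h²) (*-identityˡ (y i)))

  Eig-symmetrize-h : ∀ y → Eig (symmetrize y) h
  Eig-symmetrize-h y = eig false λ i → trans (+-homo y (act h y) i)
    (trans (cong (act h y i +_) (act-h² y i)) (trans (+-comm (act h y i) (y i)) (sym (*-identityˡ (symmetrize y i)))))

  Eig-symmetrize : ∀ {y g} → κ g h ≡ false → Eig y g → Eig (symmetrize y) g
  Eig-symmetrize {y} {g} k (eig b p) = eig b λ i → trans (Linear.+-homo (act-linear g) y (act h y) i)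
    (trans (cong₂ _+_ (p i) (commuted i)) (sym (*-distribˡ-+ (sg b) (y i) (act h y i))))
    where
    commuted : act g (act h y) ≈v (sg b *v act h y)
    commuted i = trans (act-comm h g y i) (trans (cong (λ a → sg a * act h (act g y) i) (trans (κ-sym h g) k))
      (trans (*-identityˡ (act h (act g y) i)) (trans (≈-cong p i) (*-homo (sg b) y i))))

  -- If rh fixes the line of y, then ry is hy up to sign. As r commutes with h, it exchanges the two
  -- summands of y + hy with one common sign.
  Eig-symmetrize-⊞ : ∀ {y r} → κ h r ≡ false → Eig y (r ⊞ h) → Eig (symmetrize y) r
  Eig-symmetrize-⊞ {y} {r} k (eig b p) = eig s λ i → trans (Linear.+-homo (act-linear r) y (act h y) i)
    (trans (cong₂ _+_ (ry i) (rhy i)) (lem (sg s) (act h y i) (y i)))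
    where
    s : Bool
    s = β r h xor b
    hry : act h (act r y) ≈v (sg s *v y)
    hry i = trans (act-∘ r h y i) (trans (cong (sg (β r h) *_) (p i)) (sg-*v (β r h) b y i))
    ry : act r y ≈v (sg s *v act h y)
    ry i = trans (sym (act-h² (act r y) i)) (trans (≈-cong hry i) (*-homo (sg s) y i))
    rhy : act r (act h y) ≈v (sg s *v y)
    rhy i = trans (act-comm h r y i) (trans (cong (λ a → sg a * act h (act r y) i) k)
        (trans (*-identityˡ (act h (act r y) i)) (hry i)))
    lem : ∀ s a b → s * a + s * b ≡ s * (b + a)
    lem = solve 3 (λ s a b → s :* a :+ s :* b := s :* (b :+ a)) refl

  -- Elements commuting with h remain in the stabilizer and h joins it. If r anticommutes with h,
  -- then h itself is the required element. Otherwise maximality for y is applied to r and to rh. If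
  -- the elements g and g' so obtained both anticommute with h, then gg' commutes with h and still
  -- anticommutes with r.
  frame-symmetrize : ∀ {y} → IsFrame y → IsFrame (symmetrize y)
  frame-symmetrize {y} fr r with κ h r in khr
  ... | true = inj₂ (h , Eig-symmetrize-h y , khr)
  ... | false with fr r
  ... | inj₁ e = inj₁ (Eig-symmetrize (trans (κ-sym r h) khr) e)
  ... | inj₂ (g , e , kgr) with κ g h in kgh
  ... | false = inj₂ (g , Eig-symmetrize kgh e , kgr)
  ... | true with fr (r ⊞ h)
  ... | inj₁ e' = inj₁ (Eig-symmetrize-⊞ khr e')
  ... | inj₂ (g' , e' , k') with κ g' h in kg'h
  ... | false = inj₂ (g' , Eig-symmetrize kg'h e' , trans (sym (xor-identityʳ (κ g' r))) (trans (cong (κ g' r xor_) (sym kg'h)) (trans (sym (κ-⊞ʳ g' r h)) k')))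
  ... | true = inj₂ (g ⊞ g' , Eig-symmetrize (trans (κ-⊞ˡ g g' h) (cong₂ _xor_ kgh kg'h)) (Eig-⊞ e e') ,
      trans (κ-⊞ˡ g g' r) (cong₂ _xor_ kgr (cancel (κ g' r) (trans (cong (κ g' r xor_) (sym kg'h)) (trans
          (sym (κ-⊞ʳ g' r h)) k')))))
    where
    cancel : ∀ a → a xor true ≡ true → a ≡ false
    cancel false _ = refl
    cancel true ()

  dot-symmetrize : ∀ y → dot y (act h y) ≡ 0ℚ → dot (symmetrize y) (symmetrize y) ≡ dot y y + dot y y
  dot-symmetrize y o = trans (dot-+ˡ y (act h y) (symmetrize y)) (trans (cong₂ _+_ (dot-+ʳ y y (act h y))
      (dot-+ʳ (act h y) y (act h y)))
    (cong₂ _+_ (trans (cong (dot y y +_) o) (+-identityʳ (dot y y)))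
      (trans (cong₂ _+_ (trans (dot-comm (act h y) y) o) (act-dot h y y)) (+-identityˡ (dot y y)))))

  N-symmetrize : ∀ n {y} → N d n y → N d (suc n) (½ *v symmetrize y)
  N-symmetrize n {y} hy = N-resp d (suc n) (λ i → lem (act h y i) (y i)) (N-+ d (suc n)
      (N-halfDiff-act d n h hy) (N-mono d n hy))
    where
    lem : ∀ a b → ½ * (a - b) + b ≡ ½ * (b + a)
    lem = solve 2 (λ a b → con ½ :* (a :- b) :+ b := con ½ :* (b :+ a)) refl

  Eig-scale : ∀ q {y : Vect d} {g} → Eig y g → Eig (q *v y) g
  Eig-scale q {y} {g} (eig b p) = eig b (≈v-trans (Linear.*-homo (act-linear g) q y) (λ i → trans
      (cong (q *_) (p i)) (*-swap q (sg b) (y i))))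

  frame-scale : ∀ q {y} → IsFrame y → IsFrame (q *v y)
  frame-scale q fr r with fr r
  ... | inj₁ e = inj₁ (Eig-scale q e)
  ... | inj₂ (g , e , k) = inj₂ (g , Eig-scale q e , k)

  -- A stabilizing g that anticommutes with h makes hy orthogonal to y, so passing to y + hy doubles
  -- the squared norm exactly.
  Good-step : ∀ {p y} → Good p y → (∃ λ g → Eig y g × κ g h ≡ true) →
    ∃ λ y' → Good (not p) y' × Eig y' h × (∀ g → κ g h ≡ false → Eig y g → Eig y' g)
  Good-step {p} {y} good (g₀ , eig b₀ e₀ , k₀) = scale p *v symmetrize y ,
    record { member = mem p member ; normed = nrm p normed ; frame = frame-scale (scale p) (frame-symmetrize frame) } ,
    Eig-scale (scale p) (Eig-symmetrize-h y) ,
    λ g k e → Eig-scale (scale p) (Eig-symmetrize k e)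
    where
    open Good good
    -- From squared norm 1 the doubled value 2 is brought to ½ by the factor ½. From ½ the doubled
    -- value is already 1.
    scale : Bool → ℚ
    scale false = ½
    scale true = 1ℚ
    mem : ∀ p → N d (level p) y → N d (level (not p)) (scale p *v symmetrize y)
    mem false m = N-symmetrize 0 m
    mem true m = N-resp d 0 (λ i → lem (symmetrize y i)) (N-double d 0 (N-symmetrize 1 m))
      where
      lem : ∀ q → ½ * q + ½ * q ≡ 1ℚ * q
      lem = solve 1 (λ q → con ½ :* q :+ con ½ :* q := con 1ℚ :* q) refl
    quadratic : ∀ q → dot (q *v symmetrize y) (q *v symmetrize y) ≡ q * (q * (dot y y + dot y y))
    quadratic q = trans (dot-*ˡ q (symmetrize y) (q *v symmetrize y)) (cong (q *_) (trans (dot-*ʳ q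
        (symmetrize y) (symmetrize y))
      (cong (q *_) (dot-symmetrize y (orthogonal {g = g₀} {h} b₀ e₀ e₀ k₀)))))
    nrm : ∀ p → dot y y ≡ halfPow (level p) → dot (scale p *v symmetrize y) (scale p *v symmetrize y) ≡
        halfPow (level (not p))
    nrm false e = trans (quadratic ½) (cong (λ z → ½ * (½ * (z + z))) e)
    nrm true e = trans (quadratic 1ℚ) (cong (λ z → 1ℚ * (1ℚ * (z + z))) e)

-- Involutions normalizing R

halfDiff-linear : ∀ {d} {A : Vect d → Vect d} → Linear A → Linear (halfDiff A)
halfDiff-linear {A = A} lin = record
  { ≈-cong = λ p i → cong₂ (λ a b → ½ * (a - b)) (≈-cong p i) (p i)
  ; +-homo = λ x y i → trans (cong (λ a → ½ * (a - (x i + y i))) (+-homo x y i)) (lem₊ (A x i) (A y i) (x i) (y i))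
  ; *-homo = λ q x i → trans (cong (λ a → ½ * (a - q * x i)) (*-homo q x i)) (lem* q (A x i) (x i))
  }
  where
  open Linear lin
  lem₊ : ∀ a b x y → ½ * ((a + b) - (x + y)) ≡ ½ * (a - x) + ½ * (b - y)
  lem₊ = solve 4 (λ a b x y → con ½ :* ((a :+ b) :- (x :+ y)) := con ½ :* (a :- x) :+ con ½ :* (b :- y)) refl
  lem* : ∀ q a x → ½ * (q * a - q * x) ≡ q * (½ * (a - x))
  lem* = solve 3 (λ q a x → con ½ :* (q :* a :- q :* x) := q :* (con ½ :* (a :- x))) refl

±1-from-sq : ∀ q → q * q ≡ 1ℚ → ∃ λ b → q ≡ sg b
±1-from-sq q e = choose (integral (q - 1ℚ) (q + 1ℚ) (trans (factor q) (trans (cong (_- 1ℚ) e) (+-inverseʳ 1ℚ))))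
  where
  factor : ∀ q → (q - 1ℚ) * (q + 1ℚ) ≡ q * q - 1ℚ
  factor = solve 1 (λ q → (q :- con 1ℚ) :* (q :+ con 1ℚ) := q :* q :- con 1ℚ) refl
  minus-plus : ∀ q → q ≡ (q - 1ℚ) + 1ℚ
  minus-plus = solve 1 (λ q → q := (q :- con 1ℚ) :+ con 1ℚ) refl
  plus-minus : ∀ q → q ≡ (q + 1ℚ) - 1ℚ
  plus-minus = solve 1 (λ q → q := (q :+ con 1ℚ) :- con 1ℚ) refl
  choose : q - 1ℚ ≡ 0ℚ ⊎ q + 1ℚ ≡ 0ℚ → ∃ λ b → q ≡ sg b
  choose (inj₁ z) = false , trans (minus-plus q) (trans (cong (_+ 1ℚ) z) (+-identityˡ 1ℚ))
  choose (inj₂ z) = true , trans (plus-minus q) (trans (cong (_- 1ℚ) z) (+-identityˡ (- 1ℚ)))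

module Involution {d} (T : Vect d → Vect d) (T-linear : Linear T)
  (T² : ∀ x → T (T x) ≈v x) (T-dot : ∀ x y → dot (T x) (T y) ≡ dot x y)
  (conj : U d → U d) (conjSign : U d → Bool)
  (T-conj : ∀ g x → T (act g (T x)) ≈v (sg (conjSign g) *v act (conj g) x))
  (Tr≢0 : ¬ Tr T ≡ 0ℚ) where

  open Linear T-linear renaming (≈-cong to T-cong; +-homo to T-+; *-homo to T-*; neg-homo to T-neg; 0-homo to T-0)

  conjOp : U d → Vect d → Vect d
  conjOp g x = T (act g (T x))

  T-adjoint : ∀ x y → dot (T x) y ≡ dot x (T y)
  T-adjoint = isometric-involution-adjoint T² T-dot

  conjOp-∘ : ∀ g h x → conjOp h (conjOp g x) ≈v T (act h (act g (T x)))
  conjOp-∘ g h x = T-cong (Linear.≈-cong (act-linear h) (T² (act g (T x))))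

  conj-involutive : ∀ g → conj (conj g) ≡ g
  conj-involutive g = sym (act-injective (conjSign g xor conjSign (conj g)) λ x →
    ≈v-trans (≈v-sym (≈v-trans (T² (act g (T (T x)))) (Linear.≈-cong (act-linear g) (T² x))))
    (≈v-trans (T-cong (T-conj g (T x)))
    (≈v-trans (T-* (sg (conjSign g)) (act (conj g) (T x)))
    (≈v-trans (*v-cong (sg (conjSign g)) (T-conj (conj g) x))
        (sg-*v (conjSign g) (conjSign (conj g)) (act (conj (conj g)) x))))))

  -- Conjugation by T preserves commutators, and these are signs. The two signs are compared on a
  -- single nonzero vector, where the unknown factors `conjSign g` and `conjSign h` occur on both
  -- sides and cancel.
  κ-conj : ∀ g h → κ (conj g) (conj h) ≡ κ g h
  κ-conj g h = lem (κ (conj g) (conj h)) (κ g h) (a xor b) (≡-from-sg (κ (conj g) (conj h) xor (a xor b)) (κ g h xor (a xor b)) w w≢0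
    (≈v-trans (≈v-sym (≈v-trans (*v-cong (sg (κ (conj g) (conj h))) (sg-*v a b w))
        (sg-*v (κ (conj g) (conj h)) (a xor b) w)))
    (≈v-trans lhs≈rhs (≈v-trans (*v-cong (sg (κ g h)) (sg-*v a b w)) (sg-*v (κ g h) (a xor b) w)))))
    where
    a b : Bool
    a = conjSign g
    b = conjSign h
    x w : Vect d
    x = idM zeroV
    w = act (conj g) (act (conj h) x)
    w≢0 : ¬ dot w w ≡ 0ℚ
    w≢0 e = 1≢0 (trans (sym (trans (act-dot (conj g) (act (conj h) x) (act (conj h) x)) (trans
        (act-dot (conj h) x x) (dot-idM-self (zeroV {d}))))) e)
    lem : ∀ p q r → p xor r ≡ q xor r → p ≡ q
    lem p q r e = trans (sym (cancel p)) (trans (cong (_xor r) e) (cancel q))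
      where
      cancel : ∀ p → (p xor r) xor r ≡ p
      cancel p = trans (xor-assoc p r r) (trans (cong (p xor_) (xor-same r)) (xor-identityʳ p))
    expand : ∀ g h → conjOp h (conjOp g x) ≈v (sg (conjSign g) *v (sg (conjSign h) *v act (conj h) (act (conj g) x)))
    expand g h = ≈v-trans (T-cong (Linear.≈-cong (act-linear h) (T-cong (T-conj g x))))
      (≈v-trans (T-conj h (sg (conjSign g) *v act (conj g) x))
      (≈v-trans (*v-cong (sg (conjSign h)) (Linear.*-homo (act-linear (conj h)) (sg (conjSign g)) (act (conj g) x)))
      (λ i → *-swap (sg (conjSign h)) (sg (conjSign g)) (act (conj h) (act (conj g) x) i))))
    lhs≈rhs : (sg (κ (conj g) (conj h)) *v (sg a *v (sg b *v w))) ≈v (sg (κ g h) *v (sg a *v (sg b *v w)))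
    lhs≈rhs = ≈v-trans (λ i → swap (sg (κ (conj g) (conj h))) (sg a) (sg b) (w i))
      (≈v-trans (*v-cong (sg a) (*v-cong (sg b) (≈v-sym (act-comm (conj g) (conj h) x))))
      (≈v-trans (≈v-sym (expand g h))
      (≈v-trans (conjOp-∘ g h x)
      (≈v-trans (T-cong (act-comm g h (T x)))
      (≈v-trans (T-* (sg (κ g h)) (act g (act h (T x))))
      (*v-cong (sg (κ g h)) (≈v-trans (≈v-sym (conjOp-∘ h g x)) (≈v-trans (expand h g) (λ i →
          *-swap (sg b) (sg a) (w i))))))))))
      where
      swap : ∀ k a b w → k * (a * (b * w)) ≡ a * (b * (k * w))
      swap = solve 4 (λ k a b w → k :* (a :* (b :* w)) := a :* (b :* (k :* w))) refl

  -- The class in R/{±1} of the commutator of T and r.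
  W : U d → U d
  W r = conj r ⊞ r

  κ-conjˡ : ∀ g h → κ (conj g) h ≡ κ g (conj h)
  κ-conjˡ g h = trans (cong (κ (conj g)) (sym (conj-involutive h))) (κ-conj g (conj h))

  κ-W : ∀ g h → κ (W g) h ≡ κ g (W h)
  κ-W g h = trans (κ-⊞ˡ (conj g) g h) (trans (cong (_xor κ g h) (κ-conjˡ g h)) (sym (κ-⊞ʳ g (conj h) h)))

  -- Over 𝔽₂ the map `W` is 1 + `conj`, which is self-adjoint for κ and has square zero. Its image
  -- is thus totally isotropic, which is what makes a common eigenvector of all commutators
  -- possible.
  κ-WW : ∀ g h → κ (W g) (W h) ≡ false
  κ-WW g h = begin
    κ (W g) (conj h ⊞ h)                                                   ≡⟨ κ-⊞ʳ (W g) (conj h) h ⟩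
    κ (W g) (conj h) xor κ (W g) h                                         ≡⟨ cong₂ _xor_ (κ-⊞ˡ (conj g) g (conj h)) (κ-⊞ˡ (conj g) g h) ⟩
    (κ (conj g) (conj h) xor κ g (conj h)) xor (κ (conj g) h xor κ g h)    ≡⟨ cong₂ (λ a b → (a xor κ g (conj h)) xor (b xor κ g h)) (κ-conj g h) (κ-conjˡ g h) ⟩
    (κ g h xor κ g (conj h)) xor (κ g (conj h) xor κ g h)                  ≡⟨ cong ((κ g h xor κ g (conj h)) xor_) (xor-comm (κ g (conj h)) (κ g h)) ⟩
    (κ g h xor κ g (conj h)) xor (κ g h xor κ g (conj h))                  ≡⟨ xor-same (κ g h xor κ g (conj h)) ⟩
    false                                                                  ∎
    where open ≡-Reasoning

  wSign : U d → Bool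
  wSign r = conjSign r xor β (conj r) r

  act-W : ∀ r x → act r (conjOp r x) ≈v (sg (wSign r) *v act (W r) x)
  act-W r x = ≈v-trans (Linear.≈-cong (act-linear r) (T-conj r x))
    (≈v-trans (Linear.*-homo (act-linear r) (sg (conjSign r)) (act (conj r) x))
    (≈v-trans (*v-cong (sg (conjSign r)) (act-∘ (conj r) r x)) (sg-*v (conjSign r) (β (conj r) r) (act (W r) x))))

  -- With w = W r, the operator Tw is conjugate to T up to sign, so its trace is not zero;
  -- if w² = −1 then w is skew, and the trace of Tw would vanish.
  sq-W : ∀ r → sq (W r) ≡ false
  sq-W r with sq (W r) in e
  ... | false = refl
  ... | true = ⊥-elim (Tr≢0 (trans (sym (sg-cancel s (Tr T))) (trans (cong (sg s *_) (trans (sym conjugate) (x≡-x⇒0 skew))) (*-zeroʳ (sg s)))))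
    where
    w : U d
    w = W r
    s : Bool
    s = wSign r xor sq r
    A : Vect d → Vect d
    A x = act w (T x)
    A-linear : Linear A
    A-linear = record
      { ≈-cong = λ p → Linear.≈-cong (act-linear w) (T-cong p)
      ; +-homo = λ x y → ≈v-trans (Linear.≈-cong (act-linear w) (T-+ x y)) (Linear.+-homo (act-linear w) (T x) (T y))
      ; *-homo = λ q x → ≈v-trans (Linear.≈-cong (act-linear w) (T-* q x)) (Linear.*-homo (act-linear w) q (T x)) }
    conjugate : Tr A ≡ sg s * Tr T
    conjugate = trans (∑-cong (λ i → step (idM i))) (trans (∑-* (sg s) (λ i → dot (act r (idM i)) (T (act r (idM i)))))
      (cong (sg s *_) (Tr-conj r T-linear)))
      where
      step : ∀ x → dot x (A x) ≡ sg s * dot (act r x) (T (act r x))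
      step x = trans (dot-congʳ x (≈v-sym (sg-*v-cancel (wSign r) (≈v-trans (≈v-sym (Linear.≈-cong
          (act-linear r) (T-cong (Linear.≈-cong (act-linear r) (T² x))))) (act-W r (T x))))))
        (trans (dot-*ʳ (sg (wSign r)) x (act r (T (act r x))))
        (trans (cong (sg (wSign r) *_) (sym (trans (cong (sg (sq r) *_) (dot-actˡ r x (T (act r x))))
            (sg-cancel (sq r) (dot x (act r (T (act r x))))))))
        (trans (sym (*-assoc (sg (wSign r)) (sg (sq r)) (dot (act r x) (T (act r x)))))
            (cong (_* dot (act r x) (T (act r x))) (sym (sg-xor (wSign r) (sq r)))))))
    skew : Tr A ≡ - Tr A
    skew = trans (∑-cong (λ i → step (idM i))) (trans (∑-neg (λ i → dot (act w (idM i)) (A (act w (idM i)))))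
        (cong -_ (Tr-conj w A-linear)))
      where
      neg-one : ∀ q → q ≡ - (- 1ℚ * q)
      neg-one = solve 1 (λ q → q := :- (con (- 1ℚ) :* q)) refl
      step : ∀ x → dot x (A x) ≡ - dot (act w x) (A (act w x))
      step x = trans (trans (neg-one (dot x (act w (T x)))) (cong -_ (trans (cong (λ a →
          sg a * dot x (act w (T x))) (sym e)) (sym (dot-actˡ w x (T x))))))
        (cong -_ (trans (sym (T-adjoint (act w x) x)) (trans (dot-comm (T (act w x)) x) (sym
            (act-dot w x (T (act w x)))))))

  -- Nondegeneracy of κ gives `W g` = 0, so T and g commute or anticommute. Anticommuting would make
  -- T conjugate to -T and its trace zero.
  commutes : ∀ g → (∀ h → κ (W g) h ≡ false) → ∀ x → T (act g x) ≈v act g (T x)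
  commutes g k x with κ-nondegenerate (W g)
  ... | inj₂ (h , e) = ⊥-elim (true≢false (trans (sym e) (k h)))
  ... | inj₁ e with conjSign g in cs
  ... | false = ≈v-trans (T-cong (Linear.≈-cong (act-linear g) (≈v-sym (T² x)))) (≈v-trans (T-conj g (T x))
      (λ i → trans (cong₂ (λ a h → sg a * act h (T x) i) cs (⊞-zero⇒≡ e)) (*-identityˡ (act g (T x) i))))
  ... | true = ⊥-elim (Tr≢0 (x≡-x⇒0 (trans (sym (Tr-conj g T-linear))
      (trans (∑-cong (λ i → step (idM i))) (∑-neg (λ i → dot (idM i) (T (idM i))))))))
    where
    anti : ∀ x → T (act g x) ≈v (-v act g (T x))
    anti x = ≈v-trans (T-cong (Linear.≈-cong (act-linear g) (≈v-sym (T² x)))) (≈v-trans (T-conj g (T x))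
      (λ i → trans (cong₂ (λ a h → sg a * act h (T x) i) cs (⊞-zero⇒≡ e)) (-1*≡neg (act g (T x) i))))
    dot-neg : ∀ x y → dot x (-v y) ≡ - dot x y
    dot-neg x y = trans (dot-congʳ x (λ i → neg≡-1* (y i))) (trans (dot-*ʳ (- 1ℚ) x y) (sym (neg≡-1* (dot x y))))
    step : ∀ x → dot (act g x) (T (act g x)) ≡ - dot x (T x)
    step x = trans (dot-congʳ (act g x) (anti x)) (trans (dot-neg (act g x) (act g (T x))) (cong -_
        (act-dot g x (T x))))

  -- A common eigenvector of all commutators and of T

  record JointEigenvector (rs : List (U d)) : Set where
    constructor joint
    field
      {parity} : Bool
      {vector} : Vect d
      good : Good parity vector
      eigen : All (λ r → Eig vector (W r)) rs

  -- A step for `W r` destroys nothing already achieved, since by `κ-WW` the earlier `W s` commute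
  -- with `W r` and keep their eigenvector property.
  joint-eigenvector : ∀ rs → JointEigenvector rs
  joint-eigenvector [] = joint Good-point []
  joint-eigenvector (r ∷ rs) = extend (joint-eigenvector rs)
    where
    extend : JointEigenvector rs → JointEigenvector (r ∷ rs)
    extend (joint {p} {y} good es) = go (Good.frame good (W r))
      where
      go : Eig y (W r) ⊎ (∃ λ g → Eig y g × κ g (W r) ≡ true) → JointEigenvector (r ∷ rs)
      go (inj₁ e) = joint good (e ∷ es)
      go (inj₂ anti) =
        let (y' , good' , e' , keep) = Good-step (sq-W r) good anti
        in joint good' (e' ∷ All.map (λ {s} → keep (W s) (κ-WW s r)) es)

  module _ (f : U d) (f² : sq f ≡ true) (Tf : ∀ x → T (act f x) ≈v act f (T x)) where

    conj-f : conj f ≡ f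
    conj-f = sym (act-injective (conjSign f) λ x → ≈v-trans
      (≈v-sym (≈v-trans (Tf (T x)) (Linear.≈-cong (act-linear f) (T² x)))) (T-conj f x))

    κ-Wf : ∀ r → κ (W r) f ≡ false
    κ-Wf r = trans (κ-W r f) (trans (cong (λ g → κ r (g ⊞ f)) conj-f)
      (trans (κ-⊞ʳ r f f) (xor-same (κ r f))))

    -- When the norm is off by a factor 2, one more step with the involution gf, where g has
    -- eigenvector y and anticommutes with f, corrects it.
    even : JointEigenvector (allU d) → ∃ λ y → Good false y × ∀ r → Eig y (W r)
    even (joint {false} {y} good es) = y , good , λ r → All.lookup es (∈-allU r)
    even (joint {true} {y} good es) = from-f (frame f)
      where
      open Good good
      es' : ∀ r → Eig y (W r)
      es' r = All.lookup es (∈-allU r)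
      f∉stabilizer : ¬ Eig y f
      f∉stabilizer e = true≢false (trans (sym f²) (Eig-sq nonzero e))
      from-f : Eig y f ⊎ (∃ λ g → Eig y g × κ g f ≡ true) → ∃ λ y → Good false y × ∀ r → Eig y (W r)
      from-f (inj₁ e) = ⊥-elim (f∉stabilizer e)
      from-f (inj₂ (g , e , k)) = from-gf (frame (g ⊞ f))
        where
        gfg : (g ⊞ f) ⊞ g ≡ f
        gfg = trans (cong (_⊞ g) (⊞-comm g f)) (cong₂ _,_ (⊕-cancel (proj₁ f) (proj₁ g)) (⊕-cancel (proj₂ f) (proj₂ g)))
        -- In (gf)² the commutator -1 of g and f cancels f² = -1, while g² = 1 because g has an
        -- eigenvector.
        h² : sq (g ⊞ f) ≡ false
        h² = trans (sq-⊞ g f) (cong₂ _xor_ (cong₂ _xor_ (Eig-sq nonzero e) f²) k)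
        κ-Wh : ∀ r → κ (W r) (g ⊞ f) ≡ false
        κ-Wh r = trans (κ-⊞ʳ (W r) g f) (cong₂ _xor_ (Eig-κ nonzero (es' r) e) (κ-Wf r))
        from-gf : Eig y (g ⊞ f) ⊎ (∃ λ g' → Eig y g' × κ g' (g ⊞ f) ≡ true) → ∃ λ y → Good false y × ∀ r → Eig y (W r)
        from-gf (inj₁ e') = ⊥-elim (f∉stabilizer (subst (Eig y) gfg (Eig-⊞ e' e)))
        from-gf (inj₂ anti) =
          let (y' , good' , _ , keep) = Good-step {h = g ⊞ f} h² good anti
          in y' , good' , λ r → keep (W r) (κ-Wh r) (es' r)

    joint-eigenvector-even : ∃ λ y → Good false y × ∀ r → Eig y (W r)
    joint-eigenvector-even = even (joint-eigenvector (allU d))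

  -- The component z of Ty orthogonal to y is orthogonal to the whole R-orbit of y, hence zero. For
  -- r in the stabilizer this is the choice of z. Otherwise some g in the stabilizer anticommutes
  -- with r. Sharing the eigenvector y with every `W h`, this g commutes with all of them, and so
  -- with T; then z and y are eigenvectors of g with the same sign and `orthogonal` applies.
  T-eigen : ∀ {y} → Good false y → (∀ r → Eig y (W r)) → ∃ λ b → T y ≈v (sg b *v y)
  T-eigen {y} good es = let (b , e) = ±1-from-sq q q² in b , ≈v-trans Ty (λ i → cong (_* y i) e)
    where
    open Good good
    q : ℚ
    q = dot (T y) y
    z : Vect d
    z = T y +v ((- q) *v y)
    z⊥orbit : ∀ r → dot z (act r y) ≡ 0ℚ
    z⊥orbit r with frame r
    ... | inj₁ (eig b e) = trans (dot-congʳ z e) (trans (dot-*ʳ (sg b) z y) (trans (cong (sg b *_)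
        (trans (dot-+ˡ (T y) ((- q) *v y) y) (trans (cong (q +_) (trans (dot-*ˡ (- q) y y) (trans
            (cong (- q *_) normed) (*-identityʳ (- q))))) (+-inverseʳ q))))
        (*-zeroʳ (sg b))))
    ... | inj₂ (g , eig b e , k) = orthogonal {g = g} {r} b gz e k
      where
      gTy : act g (T y) ≈v (sg b *v T y)
      gTy = ≈v-trans (≈v-sym (commutes g (λ h → trans (κ-W g h) (Eig-κ {g = g} nonzero (eig b e) (es h))) y))
          (≈v-trans (T-cong e) (T-* (sg b) y))
      gz : act g z ≈v (sg b *v z)
      gz i = trans (Linear.+-homo (act-linear g) (T y) ((- q) *v y) i)
        (trans (cong₂ _+_ (gTy i) (trans (Linear.*-homo (act-linear g) (- q) y i) (cong (- q *_) (e i))))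
        (lem (sg b) (T y i) q (y i)))
        where
        lem : ∀ s t q y → s * t + - q * (s * y) ≡ s * (t + - q * y)
        lem = solve 4 (λ s t q y → s :* t :+ (:- q) :* (s :* y) := s :* (t :+ (:- q) :* y)) refl
    Ty : T y ≈v (q *v y)
    Ty i = trans (lem (T y i) q (y i)) (trans
        (cong (_+ q * y i) (orthogonal-to-orbit z y normed z⊥orbit i)) (+-identityˡ (q * y i)))
      where
      lem : ∀ t q y → t ≡ (t + - q * y) + q * y
      lem = solve 3 (λ t q y → t := (t :+ (:- q) :* y) :+ q :* y) refl
    q² : q * q ≡ 1ℚ
    q² = trans (cong (q *_) (sym (trans (cong (q *_) normed) (*-identityʳ q))))
      (trans (sym (trans (dot-*ˡ q y (q *v y)) (cong (q *_) (dot-*ʳ q y y))))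
      (trans (sym (dot-cong Ty Ty)) (trans (T-dot y y) normed)))

  -- Interchanging T and r costs `W r` and a sign that depends on r alone. When the same r is
  -- applied to two different vectors, that sign cancels from the comparison of the eigenvalues.
  T-eigen-act : ∀ {y} r a b → T y ≈v (sg a *v y) → act (W r) y ≈v (sg b *v y) →
    T (act r y) ≈v (sg (a xor (sq r xor (wSign r xor b))) *v act r y)
  T-eigen-act {y} r a b ty wy = ≈v-trans (≈v-sym (sg-*v-cancel a (sg-*v-cancel (sq r) (≈v-sym step))))
      (≈v-trans (*v-cong (sg a) (≈v-trans (*v-cong (sg (sq r)) (sg-*v (wSign r) b (act r y)))
          (sg-*v (sq r) (wSign r xor b) (act r y))))
                (sg-*v a (sq r xor (wSign r xor b)) (act r y)))
    where
    step : (sg (sq r) *v (sg a *v T (act r y))) ≈v (sg (wSign r) *v (sg b *v act r y))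
    step = ≈v-trans (λ i → trans (*-swap (sg (sq r)) (sg a) (T (act r y) i)) (cong (sg a *_) (sym
        (act-sq r (T (act r y)) i))))
      (≈v-trans (≈v-sym (≈v-trans (Linear.≈-cong (act-linear r) (Linear.≈-cong (act-linear r) (≈v-trans
          (T-cong (≈v-trans (Linear.≈-cong (act-linear r) ty) (Linear.*-homo (act-linear r) (sg a) y)))
          (T-* (sg a) (act r y)))))
          (≈v-trans (Linear.≈-cong (act-linear r) (Linear.*-homo (act-linear r) (sg a) (T (act r y))))
              (Linear.*-homo (act-linear r) (sg a) (act r (T (act r y)))))))
      (≈v-trans (Linear.≈-cong (act-linear r) (act-W r y))
      (≈v-trans (Linear.*-homo (act-linear r) (sg (wSign r)) (act (W r) y))
      (*v-cong (sg (wSign r)) (≈v-trans (Linear.≈-cong (act-linear r) wy) (Linear.*-homo (act-linear r) (sg b) y))))))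

  -- A vector attaining the bound in M_ε

  module Witnesses (F : Vect d → Vect d) (F-linear : Linear F) (TF : ∀ x → T (F x) ≈v F (T x))
    (N-halfDiff-F : ∀ n {x} → N d n x → N d (suc n) (halfDiff F x)) (e : Bool) where

    open Linear (halfDiff-linear F-linear) renaming (≈-cong to H-cong; +-homo to H-+; *-homo to H-*)

    -- The projection of x is half of x + εTx, so the last term of `decomposition` is P^ε(x)(f - 1).
    -- The record thus presents u(f - 1)/2 as an element of M_ε for a minimal vector u of L^ε(t).
    record Witness : Set where
      field
        {u x a} : Vect d
        u∈N : N d 0 u
        u-unit : dot u u ≡ 1ℚ
        Tu : T u ≈v (sg e *v u)
        x∈N : N d 0 x
        a∈N : N d 0 a
        Ta : T a ≈v (sg e *v a)
        decomposition : halfDiff F u ≈v (a +v halfDiff F (x +v (sg e *v T x)))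

    module _ (y : Vect d) (y∈N : N d 0 y) where

      -- The index δ tells whether the eigenvalue of v differs from ε. The field `v≡y` expresses
      -- that v is congruent to y modulo 2 `N d 1`; images of y under R have this property because R
      -- acts trivially on that quotient.
      record Term (δ : Bool) (v : Vect d) : Set where
        field
          v∈N : N d 0 v
          v-unit : dot v v ≡ 1ℚ
          v≡y : N d 1 (½ *v (v +v (-v y)))
          Tv : T v ≈v (sg (e xor δ) *v v)

      halfSum : (u p q o : Vect d) → Vect d
      halfSum u p q o i = ½ * (u i + p i + q i + o i)

      private
        module _ {u p q o} (h : N d 0 (halfSum u p q o)) {α β γ δ}
          (tu : T u ≈v (sg (e xor α) *v u)) (tp : T p ≈v (sg (e xor β) *v p))
          (tq : T q ≈v (sg (e xor γ) *v q)) (to : T o ≈v (sg (e xor δ) *v o)) where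

          T-halfSum : T (halfSum u p q o) ≈v
            (λ i → ½ * (sg (e xor α) * u i + sg (e xor β) * p i + sg (e xor γ) * q i + sg (e xor δ) * o i))
          T-halfSum = ≈v-trans (T-* ½ (((u +v p) +v q) +v o)) (*v-cong ½
            (≈v-trans (T-+ ((u +v p) +v q) o) (+v-cong (≈v-trans (T-+ (u +v p) q) (+v-cong (≈v-trans
                (T-+ u p) (+v-cong tu tp)) tq)) to)))

          symmetric-part : (halfSum u p q o +v (sg e *v T (halfSum u p q o))) ≈v
            (λ i → ½ * ((1ℚ + sg α) * u i + (1ℚ + sg β) * p i + (1ℚ + sg γ) * q i + (1ℚ + sg δ) * o i))
          symmetric-part i = trans (cong (λ z → halfSum u p q o i + sg e * z) (T-halfSum i))
            (trans (lem (sg e) (sg (e xor α)) (sg (e xor β)) (sg (e xor γ)) (sg (e xor δ)) (u i) (p i) (q i) (o i))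
              (cong (½ *_) (cong₂ _+_ (cong₂ _+_ (cong₂ _+_ (c α (u i)) (c β (p i))) (c γ (q i))) (c δ (o i)))))
            where
            lem : ∀ s a b c d u p q o → ½ * (u + p + q + o) + s * (½ * (a * u + b * p + c * q + d * o))
              ≡ ½ * ((1ℚ + s * a) * u + (1ℚ + s * b) * p + (1ℚ + s * c) * q + (1ℚ + s * d) * o)
            lem = solve 9 (λ s a b c d u p q o →
                con ½ :* (u :+ p :+ q :+ o) :+ s :* (con ½ :* (a :* u :+ b :* p :+ c :* q :+ d :* o))
              := con ½ :* ((con 1ℚ :+ s :* a) :* u :+ (con 1ℚ :+ s :* b) :* p :+ (con 1ℚ :+ s :* c) :* q :+ (con 1ℚ :+ s :* d) :* o)) refl
            c : ∀ δ z → (1ℚ + sg e * sg (e xor δ)) * z ≡ (1ℚ + sg δ) * z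
            c δ z = cong (λ t → (1ℚ + t) * z) (trans (cong (sg e *_) (sg-xor e δ)) (sg-cancel e (sg δ)))

      Tv-self : ∀ {v} → Term false v → T v ≈v (sg e *v v)
      Tv-self {v} t = ≈v-trans (Term.Tv t) (λ i → cong (λ b → sg b * v i) (xor-identityʳ e))

      -- In x + εTx the summands with eigenvalue -ε cancel and the one with eigenvalue ε is doubled,
      -- so that with x the half sum this vector is u and no correction a is needed.
      one-term : ∀ {u p q o} → N d 0 (halfSum u p q o) → Term false u → Term true p → Term true q →
          Term true o → Witness
      one-term {u} {p} {q} {o} h tu tp tq to = record
        { u∈N = Term.v∈N tu
        ; u-unit = Term.v-unit tu
        ; Tu = Tv-self tu
        ; x∈N = h
        ; a∈N = N-0 d 0
        ; Ta = λ i → trans (T-0 i) (sym (*-zeroʳ (sg e)))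
        ; decomposition = λ i → trans (H-cong (λ j → sym (trans (symmetric-part h (Term.Tv tu) (Term.Tv tp) (Term.Tv tq) (Term.Tv to) j) (lem (u j) (p j) (q j) (o j)))) i)
            (sym (+-identityˡ (halfDiff F (halfSum u p q o +v (sg e *v T (halfSum u p q o))) i)))
        }
        where
        lem : ∀ u p q o → ½ * ((1ℚ + 1ℚ) * u + (1ℚ + - 1ℚ) * p + (1ℚ + - 1ℚ) * q + (1ℚ + - 1ℚ) * o) ≡ u
        lem = solve 4 (λ u p q o →
            con ½ :* ((con 1ℚ :+ con 1ℚ) :* u :+ (con 1ℚ :+ con (- 1ℚ)) :* p :+ (con 1ℚ :+ con (- 1ℚ)) :* q :+ (con 1ℚ :+ con (- 1ℚ)) :* o) := u) refl

      -- Here x + εTx = u + p + q, and (p + q)(f − 1)/2 lies in the lattice since p ≡ q ≡ y.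
      three-terms : ∀ {u p q o} → N d 0 (halfSum u p q o) → Term false u → Term false p → Term false q →
          Term true o → Witness
      three-terms {u} {p} {q} {o} h tu tp tq to = record
        { u∈N = Term.v∈N tu
        ; u-unit = Term.v-unit tu
        ; Tu = Tv-self tu
        ; x∈N = h
        -- With w = (p + q)/2 in `N d 1`, the vector a is minus twice `halfDiff F w`: one level up
        -- from 1, then two levels down by doubling.
        ; a∈N = N-resp d 0 (λ i → sym (trans (cong -_ (H-cong pq≡w+w i)) (cong -_ (H-+ w w i)))) (N-neg d 0 (N-double d 0 (N-halfDiff-F 1 w∈N)))
        ; Ta = λ i → trans (T-neg (halfDiff F (p +v q)) i) (trans (cong -_ (trans (TH (p +v q) i) (trans (H-cong Tpq i) (H-* (sg e) (p +v q) i)))) (neg-distribʳ-* (sg e) (halfDiff F (p +v q) i)))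
        ; decomposition = λ i → trans (lem₁ (halfDiff F u i) (halfDiff F (p +v q) i)) (cong (- halfDiff F (p +v q) i +_)
            (trans (sym (H-+ u (p +v q) i)) (H-cong (λ j → sym (trans
                (symmetric-part h (Term.Tv tu) (Term.Tv tp) (Term.Tv tq) (Term.Tv to) j) (lem₂ (u j) (p j) (q j) (o j)))) i)))
        }
        where
        w : Vect d
        w = ½ *v (p +v q)
        pq≡w+w : (p +v q) ≈v (w +v w)
        pq≡w+w i = lem (p i + q i)
          where
          lem : ∀ a → a ≡ ½ * a + ½ * a
          lem = solve 1 (λ a → a := con ½ :* a :+ con ½ :* a) refl
        w∈N : N d 1 w
        w∈N = N-resp d 1 (λ i → lem (p i) (q i) (y i)) (N-+ d 1 (N-+ d 1 (Term.v≡y tp) (Term.v≡y tq)) (N-mono d 0 y∈N))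
          where
          lem : ∀ p q y → ½ * (p + - y) + ½ * (q + - y) + y ≡ ½ * (p + q)
          lem = solve 3 (λ p q y → con ½ :* (p :+ :- y) :+ con ½ :* (q :+ :- y) :+ y := con ½ :* (p :+ q)) refl
        TH : ∀ v → T (halfDiff F v) ≈v halfDiff F (T v)
        TH v i = trans (T-* ½ (F v +v (-v v)) i) (cong (½ *_) (trans (T-+ (F v) (-v v) i) (cong₂ _+_ (TF v i)
            (T-neg v i))))
        Tpq : T (p +v q) ≈v (sg e *v (p +v q))
        Tpq i = trans (T-+ p q i) (trans (cong₂ _+_ (Tv-self tp i) (Tv-self tq i))
            (sym (*-distribˡ-+ (sg e) (p i) (q i))))
        lem₁ : ∀ a b → a ≡ - b + (a + b)
        lem₁ = solve 2 (λ a b → a := :- b :+ (a :+ b)) refl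
        lem₂ : ∀ u p q o → ½ * ((1ℚ + 1ℚ) * u + (1ℚ + 1ℚ) * p + (1ℚ + 1ℚ) * q + (1ℚ + - 1ℚ) * o) ≡ u + (p + q)
        lem₂ = solve 4 (λ u p q o →
            con ½ :* ((con 1ℚ :+ con 1ℚ) :* u :+ (con 1ℚ :+ con 1ℚ) :* p :+ (con 1ℚ :+ con 1ℚ) :* q :+ (con 1ℚ :+ con (- 1ℚ)) :* o) := u :+ (p :+ q)) refl

      permuted : ∀ u p q o {h : Vect d} → (∀ i → h i ≡ u i + p i + q i + o i) → N d 0 (½ *v h) → N d 0 (halfSum u p q o)
      permuted u p q o e n = N-resp d 0 (λ i → cong (½ *_) (e i)) n

      -- The relation on δ₃ says that the four indices sum to 1, so that one or three of the four
      -- vectors have eigenvalue ε. Every case is a permutation of `one-term` or `three-terms`.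
      odd-terms : ∀ {u₀ u₁ u₂ u₃ δ₀ δ₁ δ₂ δ₃} → N d 0 (halfSum u₀ u₁ u₂ u₃) →
        Term δ₀ u₀ → Term δ₁ u₁ → Term δ₂ u₂ → Term δ₃ u₃ → δ₃ ≡ not (δ₀ xor δ₁ xor δ₂) → Witness
      odd-terms {u₀} {u₁} {u₂} {u₃} {δ₀} {δ₁} {δ₂} h t₀ t₁ t₂ t₃ parity = go δ₀ δ₁ δ₂ t₀ t₁ t₂ (subst (λ δ →
          Term δ u₃) parity t₃)
        where
        s01 : ∀ i → u₀ i + u₁ i + u₂ i + u₃ i ≡ u₁ i + u₀ i + u₂ i + u₃ i
        s01 i = solve 4 (λ a b c d → a :+ b :+ c :+ d := b :+ a :+ c :+ d) refl (u₀ i) (u₁ i) (u₂ i) (u₃ i)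
        s02 : ∀ i → u₀ i + u₁ i + u₂ i + u₃ i ≡ u₂ i + u₀ i + u₁ i + u₃ i
        s02 i = solve 4 (λ a b c d → a :+ b :+ c :+ d := c :+ a :+ b :+ d) refl (u₀ i) (u₁ i) (u₂ i) (u₃ i)
        s03 : ∀ i → u₀ i + u₁ i + u₂ i + u₃ i ≡ u₃ i + u₀ i + u₁ i + u₂ i
        s03 i = solve 4 (λ a b c d → a :+ b :+ c :+ d := d :+ a :+ b :+ c) refl (u₀ i) (u₁ i) (u₂ i) (u₃ i)
        s30 : ∀ i → u₀ i + u₁ i + u₂ i + u₃ i ≡ u₁ i + u₂ i + u₃ i + u₀ i
        s30 i = solve 4 (λ a b c d → a :+ b :+ c :+ d := b :+ c :+ d :+ a) refl (u₀ i) (u₁ i) (u₂ i) (u₃ i)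
        s31 : ∀ i → u₀ i + u₁ i + u₂ i + u₃ i ≡ u₀ i + u₂ i + u₃ i + u₁ i
        s31 i = solve 4 (λ a b c d → a :+ b :+ c :+ d := a :+ c :+ d :+ b) refl (u₀ i) (u₁ i) (u₂ i) (u₃ i)
        s32 : ∀ i → u₀ i + u₁ i + u₂ i + u₃ i ≡ u₀ i + u₁ i + u₃ i + u₂ i
        s32 i = solve 4 (λ a b c d → a :+ b :+ c :+ d := a :+ b :+ d :+ c) refl (u₀ i) (u₁ i) (u₂ i) (u₃ i)
        go : ∀ δ₀ δ₁ δ₂ → Term δ₀ u₀ → Term δ₁ u₁ → Term δ₂ u₂ → Term (not (δ₀ xor δ₁ xor δ₂)) u₃ → Witness
        go false true true t₀ t₁ t₂ t₃ = one-term h t₀ t₁ t₂ t₃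
        go true false true t₀ t₁ t₂ t₃ = one-term (permuted u₁ u₀ u₂ u₃ s01 h) t₁ t₀ t₂ t₃
        go true true false t₀ t₁ t₂ t₃ = one-term (permuted u₂ u₀ u₁ u₃ s02 h) t₂ t₀ t₁ t₃
        go true true true t₀ t₁ t₂ t₃ = one-term (permuted u₃ u₀ u₁ u₂ s03 h) t₃ t₀ t₁ t₂
        go true false false t₀ t₁ t₂ t₃ = three-terms (permuted u₁ u₂ u₃ u₀ s30 h) t₁ t₂ t₃ t₀
        go false true false t₀ t₁ t₂ t₃ = three-terms (permuted u₀ u₂ u₃ u₁ s31 h) t₀ t₂ t₃ t₁
        go false false true t₀ t₁ t₂ t₃ = three-terms (permuted u₀ u₁ u₃ u₂ s32 h) t₀ t₁ t₃ t₂
        go false false false t₀ t₁ t₂ t₃ = three-terms h t₀ t₁ t₂ t₃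

    witness : ∀ {y} → Good false y → (∀ r → Eig y (W r)) → ∀ r₁ r₂ → κ r₁ (W r₂) ≡ true → Witness
    witness {y} good es r₁ r₂ k = odd-terms y member {y} {u₁} {u₂} {u₃} sum∈N
      (term a₀ member normed N₀ ty)
      (term a₁ (N-act d 0 r₁ member) (trans (act-dot r₁ y y) normed) (N-halfDiff-act d 0 r₁ member) tu₁)
      (term a₂ (N-act d 0 r₂ member) (trans (act-dot r₂ y y) normed) (N-halfDiff-act d 0 r₂ member) tu₂)
      (term a₃ (N-act d 0 r₂ (N-act d 0 r₁ member)) (trans (act-dot r₂ u₁ u₁) (trans (act-dot r₁ y y) normed)) N₃ tu₃)
      (parity e a₀ a₁ (sq r₂) (wSign r₂) η₂)
      where
      open Good good
      η₁ η₂ a₀ a₁ a₂ a₃ : Bool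
      η₁ = Eig.sign (es r₁)
      η₂ = Eig.sign (es r₂)
      a₀ = proj₁ (T-eigen good es)
      a₁ = a₀ xor (sq r₁ xor (wSign r₁ xor η₁))
      a₂ = a₀ xor (sq r₂ xor (wSign r₂ xor η₂))
      a₃ = a₁ xor (sq r₂ xor (wSign r₂ xor (true xor η₂)))
      u₁ u₂ u₃ : Vect d
      u₁ = act r₁ y
      u₂ = act r₂ y
      u₃ = act r₂ u₁
      ty : T y ≈v (sg a₀ *v y)
      ty = proj₂ (T-eigen good es)
      tu₁ : T u₁ ≈v (sg a₁ *v u₁)
      tu₁ = T-eigen-act r₁ a₀ η₁ ty (Eig.eigen (es r₁))
      tu₂ : T u₂ ≈v (sg a₂ *v u₂)
      tu₂ = T-eigen-act r₂ a₀ η₂ ty (Eig.eigen (es r₂))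
      -- Since r₁ anticommutes with `W r₂`, the eigenvalue on u₁ is opposite to that on y. This is
      -- the source of the odd parity.
      wu₁ : act (W r₂) u₁ ≈v (sg (true xor η₂) *v u₁)
      wu₁ = ≈v-trans (act-comm r₁ (W r₂) y) (≈v-trans
        (λ i → cong₂ (λ b z → sg b * z) k (≈v-trans (Linear.≈-cong (act-linear r₁) (Eig.eigen (es r₂)))
            (Linear.*-homo (act-linear r₁) (sg η₂) y) i))
        (sg-*v true η₂ u₁))
      tu₃ : T u₃ ≈v (sg a₃ *v u₃)
      tu₃ = T-eigen-act r₂ a₁ (true xor η₂) tu₁ wu₁
      term : ∀ a {v} → N d 0 v → dot v v ≡ 1ℚ → N d 1 (½ *v (v +v (-v y))) → T v ≈v (sg a *v v) →
          Term y member (e xor a) v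
      term a {v} m n c t = record { v∈N = m ; v-unit = n ; v≡y = c ; Tv = λ i → trans (t i) (cong (λ b →
          sg b * v i) (sym lem)) }
        where
        lem : e xor (e xor a) ≡ a
        lem = trans (sym (xor-assoc e e a)) (cong (_xor a) (xor-same e))
      N₀ : N d 1 (½ *v (y +v (-v y)))
      N₀ = N-resp d 1 (λ i → sym (trans (cong (½ *_) (+-inverseʳ (y i))) (*-zeroʳ ½))) (N-0 d 1)
      N₃ : N d 1 (½ *v (u₃ +v (-v y)))
      N₃ = N-resp d 1 (λ i → lem (u₃ i) (u₁ i) (y i)) (N-+ d 1 (N-halfDiff-act d 0 r₂ (N-act d 0 r₁ member))
          (N-halfDiff-act d 0 r₁ member))
        where
        lem : ∀ a b c → ½ * (a - b) + ½ * (b - c) ≡ ½ * (a + - c)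
        lem = solve 3 (λ a b c → con ½ :* (a :- b) :+ con ½ :* (b :- c) := con ½ :* (a :+ :- c)) refl
      -- Here w = (r₁ + 1)/2 applied to y, and w' = (r₂ + 1)/2 applied to w. Two levels up, w'
      -- doubles to the half sum in `N d 0`.
      w : Vect d
      w = halfDiff (act r₁) y +v y
      w' : Vect d
      w' = halfDiff (act r₂) w +v w
      w∈N : N d 1 w
      w∈N = N-+ d 1 (N-halfDiff-act d 0 r₁ member) (N-mono d 0 member)
      w'∈N : N d 2 w'
      w'∈N = N-+ d 2 (N-halfDiff-act d 1 r₂ w∈N) (N-mono d 1 w∈N)
      sum∈N : N d 0 (halfSum y member y u₁ u₂ u₃)
      sum∈N = N-resp d 0 (λ i → trans (cong (λ z →
          (½ * (z - w i) + w i) + (½ * (z - w i) + w i)) (r₂w i)) (lem (y i) (u₁ i) (u₂ i) (u₃ i))) (N-double d 0 w'∈N)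
        where
        w≡ : w ≈v (½ *v (u₁ +v y))
        w≡ i = l (u₁ i) (y i)
          where
          l : ∀ a b → ½ * (a - b) + b ≡ ½ * (a + b)
          l = solve 2 (λ a b → con ½ :* (a :- b) :+ b := con ½ :* (a :+ b)) refl
        r₂w : act r₂ w ≈v (½ *v (u₃ +v u₂))
        r₂w = ≈v-trans (Linear.≈-cong (act-linear r₂) w≡) (≈v-trans (Linear.*-homo
            (act-linear r₂) ½ (u₁ +v y)) (*v-cong ½ (Linear.+-homo (act-linear r₂) u₁ y)))
        lem : ∀ y a b c → (½ * (½ * (c + b) - (½ * (a - y) + y)) + (½ * (a - y) + y)) + (½ * (½ * (c + b) - (½ * (a - y) + y)) + (½ * (a - y) + y)) ≡ ½ * (y + a + b + c)
        lem = solve 4 (λ y a b c →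
            (con ½ :* (con ½ :* (c :+ b) :- (con ½ :* (a :- y) :+ y)) :+ (con ½ :* (a :- y) :+ y)) :+ (con ½ :* (con ½ :* (c :+ b) :- (con ½ :* (a :- y) :+ y)) :+ (con ½ :* (a :- y) :+ y)) := con ½ :* (y :+ a :+ b :+ c)) refl
      -- The signs p and q depending on r₂ alone, and η, occur once on each side. What is left over
      -- is the extra `true` from `wu₁`.
      parity : ∀ e a₀ a₁ p q η → e xor (a₁ xor (p xor (q xor (true xor η)))) ≡
        true xor ((e xor a₀) xor (e xor a₁) xor (e xor (a₀ xor (p xor (q xor η)))))
      parity = xor-solve 6 (λ e a₀ a₁ p q η → e ⊹ (a₁ ⊹ (p ⊹ (q ⊹ (xor-con true ⊹ η)))) ⊜
        xor-con true ⊹ ((e ⊹ a₀) ⊹ ((e ⊹ a₁) ⊹ (e ⊹ (a₀ ⊹ (p ⊹ (q ⊹ η))))))) refl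
        where
        open xor-∧-Solver using () renaming (solve to xor-solve; _:+_ to _⊹_; _:=_ to _⊜_; con to xor-con)

-- The lattices L^ε(t) and M_ε

bit : Bool → Fin 2
bit false = zero
bit true = suc zero

unbit : Fin 2 → Bool
unbit zero = false
unbit (suc zero) = true

bit-injective : ∀ {a b} → bit a ≡ bit b → a ≡ b
bit-injective {false} {false} _ = refl
bit-injective {true} {true} _ = refl

unbit-injective : ∀ {a b} → unbit a ≡ unbit b → a ≡ b
unbit-injective {zero} {zero} _ = refl
unbit-injective {zero} {suc zero} ()
unbit-injective {suc zero} {zero} ()
unbit-injective {suc zero} {suc zero} _ = refl

index : ∀ {n} → Vec Bool n → Fin (2 ℕ.^ n)
index [] = zero
index (b ∷ v) = combine (bit b) (index v)

index-injective : ∀ {n} (v w : Vec Bool n) → index v ≡ index w → v ≡ w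
index-injective [] [] _ = refl
index-injective (a ∷ v) (b ∷ w) e with combine-injective (bit a) (index v) (bit b) (index w) e
... | p , q = cong₂ _∷_ (bit-injective p) (index-injective v w q)

vector : ∀ n → Fin (2 ℕ.^ n) → Vec Bool n
vector zero _ = []
vector (suc n) i = unbit (proj₁ (remQuot {2} (2 ℕ.^ n) i)) ∷ vector n (proj₂ (remQuot {2} (2 ℕ.^ n) i))

remQuot-injective : ∀ {m} n {i j : Fin (m ℕ.* n)} → remQuot {m} n i ≡ remQuot {m} n j → i ≡ j
remQuot-injective {m} n {i} {j} e = trans (sym (combine-remQuot {m} n i)) (trans (cong (λ p →
    combine (proj₁ p) (proj₂ p)) e) (combine-remQuot {m} n j))

vector-injective : ∀ n {i j} → vector n i ≡ vector n j → i ≡ j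
vector-injective zero {zero} {zero} _ = refl
vector-injective (suc n) {i} {j} e with ∷-injective e
... | p , q = remQuot-injective {2} (2 ℕ.^ n) (cong₂ _,_ (unbit-injective p) (vector-injective n q))

-- Pigeonhole principle: the 2^(2d) elements of `U d` and the 2^n bit vectors are numbered by finite
-- ordinals.
no-injection : ∀ {d n} (φ : U d → Vec Bool n) → (∀ {g h} → φ g ≡ φ h → g ≡ h) → ¬ n ℕ.< d ℕ.+ d
no-injection {d} {n} φ inj n<2d = ℕₚ.<⇒≱ (ℕₚ.^-monoʳ-< 2 (s≤s (s≤s z≤n)) n<2d)
  (subst (ℕ._≤ 2 ℕ.^ n) (sym (ℕₚ.^-distribˡ-+-* 2 d d)) (injective⇒≤ {f = ψ} ψ-injective))
  where
  ψ : Fin (2 ℕ.^ d ℕ.* 2 ℕ.^ d) → Fin (2 ℕ.^ n)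
  ψ i = index (φ (vector d (proj₁ (remQuot {2 ℕ.^ d} (2 ℕ.^ d) i)) , vector d (proj₂ (remQuot {2 ℕ.^ d} (2 ℕ.^ d) i))))
  ψ-injective : ∀ {i j} → ψ i ≡ ψ j → i ≡ j
  ψ-injective e = let p = inj (index-injective _ _ e) in
    remQuot-injective {2 ℕ.^ d} (2 ℕ.^ d) (cong₂ _,_ (vector-injective d (cong proj₁ p)) (vector-injective d
        (cong proj₂ p)))

-- Reduction to lowest terms blocks computation on variables, so the identity is checked on
-- unnormalised fractions.
/1-+ : ∀ m n → (ℤ.+ (m ℕ.+ n)) / 1 ≡ (ℤ.+ m) / 1 + (ℤ.+ n) / 1
/1-+ m n = toℚᵘ-injective (ℚᵘₚ.≃-trans (toℚᵘ-fromℚᵘ (mkℚᵘ (ℤ.+ (m ℕ.+ n)) 0)) (ℚᵘₚ.≃-trans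
  (*≡* (cong₂ ℤ._*_ (trans (ℤₚ.pos-+ m n) (sym (cong₂ ℤ._+_ (ℤₚ.*-identityʳ (ℤ.+ m)) (ℤₚ.*-identityʳ (ℤ.+ n))))) refl))
  (ℚᵘₚ.≃-sym (ℚᵘₚ.≃-trans (toℚᵘ-homo-+ ((ℤ.+ m) / 1) ((ℤ.+ n) / 1))
     (ℚᵘₚ.+-cong (toℚᵘ-fromℚᵘ (mkℚᵘ (ℤ.+ m) 0)) (toℚᵘ-fromℚᵘ (mkℚᵘ (ℤ.+ n) 0)))))))

pow2-suc : ∀ n → pow2 (suc n) ≡ pow2 n + pow2 n
pow2-suc n = trans (cong (λ k → (ℤ.+ (2 ℕ.^ n ℕ.+ k)) / 1) (ℕₚ.+-identityʳ (2 ℕ.^ n))) (/1-+ (2 ℕ.^ n) (2 ℕ.^ n))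

pow2-pos : ∀ n → 0ℚ < pow2 n
pow2-pos zero = positive⁻¹ 1ℚ
pow2-pos (suc n) = subst (0ℚ <_) (sym (pow2-suc n)) (+-mono-< (pow2-pos n) (pow2-pos n))

ip≡dot : ∀ d x y → ip d x y ≡ pow2 (d ℕ./ 2) * dot x y
ip≡dot d x y = cong (pow2 (d ℕ./ 2) *_) (sym (trans (dot≡∑ x y) (∑≡sumΩ (λ i → x i * y i))))

module _ (d : ℕ) where

  private
    c : ℚ
    c = pow2 (d ℕ./ 2)
    instance
      c-positive : Positive c
      c-positive = positive (pow2-pos (d ℕ./ 2))

  ip-cancel : ∀ {x y z w} → ip d x y ≡ ip d z w → dot x y ≡ dot z w
  ip-cancel {x} {y} {z} {w} e = ≤-antisym
    (*-cancelˡ-≤-pos c (≤-reflexive (trans (sym (ip≡dot d x y)) (trans e (ip≡dot d z w)))))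
    (*-cancelˡ-≤-pos c (≤-reflexive (trans (sym (ip≡dot d z w)) (trans (sym e) (ip≡dot d x y)))))

  norm-mono : ∀ {x y} → dot x x ≤ dot y y → norm d x ≤ norm d y
  norm-mono {x} {y} p = subst₂ _≤_ (sym (ip≡dot d x x)) (sym (ip≡dot d y y)) (*-monoˡ-≤-nonNeg c {{pos⇒nonNeg c}} p)

  norm-cancel : ∀ {x y} → norm d x ≤ norm d y → dot x x ≤ dot y y
  norm-cancel {x} {y} p = *-cancelˡ-≤-pos c (subst₂ _≤_ (ip≡dot d x x) (ip≡dot d y y) p)

  -- An attained bound turns minimality, a comparison with all vectors of P, into an equation for
  -- one squared norm. Such equations can be carried along f - 1, which doubles squared norms.
  minimal⇔ : ∀ {P : Vect d → Set} {μ} → 0ℚ < μ → (∀ w → P w → ¬ w ≈v 0v → μ ≤ dot w w) →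
    (∃ λ u → P u × dot u u ≡ μ) → ∀ w → IsMinimalVec d P w ⇔ (P w × dot w w ≡ μ)
  minimal⇔ {P} {μ} μ>0 bound (u , pu , eu) w = mk⇔
    (λ { (pw , nz , min) → pw , ≤-antisym (subst
        (dot w w ≤_) eu (norm-cancel {w} {u} (min u pu (nz-of eu)))) (bound w pw nz) })
    (λ { (pw , e) → pw , nz-of e , λ z pz nz → norm-mono {w} {z} (subst (_≤ dot z z) (sym e) (bound z pz nz)) })
    where
    nz-of : ∀ {x : Vect d} → dot x x ≡ μ → ¬ x ≈v 0v
    nz-of e z = <-irrefl (sym (trans (sym e) (≈0⇒dot≡0 z))) μ>0

sgn≈ : ∀ {d} ε → ∃ λ e → ∀ (x : Vect d) → sgn ε x ≈v (sg e *v x)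
sgn≈ plus = false , λ x i → sym (*-identityˡ (x i))
sgn≈ minus = true , λ x i → neg≡-1* (x i)

-- Application to t and f

module Setting {d k : ℕ} (1≤k : 1 ℕ.≤ k) (t : Mat d) (t∈G : InG d t) (t-inv : IsInvolution t)
  (defect : HasDefect d t k) (tr>0 : 0ℚ < trace d t)
  (f : Mat d) (f∈R : InR d f) (f-four : IsFourvolution f) (ft : (f ∘m t) ≈m (t ∘m f)) where

  T F : Vect d → Vect d
  T x = x · t
  F x = x · f

  T-linear : Linear T
  T-linear = ·-linear t

  F-linear : Linear F
  F-linear = ·-linear f

  T² : ∀ x → T (T x) ≈v x
  T² x = ≈v-trans (≈v-sym (·-∘m x t t)) (≈v-trans (·-cong x (proj₁ t-inv)) (·-idM x))

  T-dot : ∀ x y → dot (T x) (T y) ≡ dot x y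
  T-dot x y = ip-cancel d {T x} {T y} {x} {y} (proj₁ t∈G x y)

  T-adjoint : ∀ x y → dot (T x) y ≡ dot x (T y)
  T-adjoint = isometric-involution-adjoint T² T-dot

  -- `InG` expresses normalization of R through the transpose. Its agreement with t turns that
  -- condition into a statement on T g T.
  t-symmetric : transpose t ≈m t
  t-symmetric i j = trans (sym (idM-· t j i)) (trans (sym (dot-idM (T (idM j)) i)) (trans (T-adjoint (idM j) (idM i))
    (trans (dot-comm (idM j) (T (idM i))) (trans (dot-idM (T (idM i)) j) (idM-· t i j)))))

  conjugate : ∀ g → ∃ λ b → ∃ λ g' → ∀ x → T (act g (T x)) ≈v (sg b *v act g' x)
  conjugate g = let (b , g' , p) = InR⇒act (proj₁ (proj₂ (proj₂ (proj₂ t∈G))) (actM g) (InR-actM g)) in b , g' , λ x → ≈v-trans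
    (≈v-sym (≈v-trans (·-∘m x (transpose t ∘m actM g) t) (Linear.≈-cong T-linear (≈v-trans (·-∘m x
        (transpose t) (actM g))
      (≈v-trans (·-actM g (x · transpose t)) (Linear.≈-cong (act-linear g) (·-cong x t-symmetric))))))) (p x)

  conj : U d → U d
  conj g = proj₁ (proj₂ (conjugate g))

  conjSign : U d → Bool
  conjSign g = proj₁ (conjugate g)

  T-conj : ∀ g x → T (act g (T x)) ≈v (sg (conjSign g) *v act (conj g) x)
  T-conj g = proj₂ (proj₂ (conjugate g))

  Tr-T : Tr T ≡ trace d t
  Tr-T = trans (∑-cong (λ i → trans (dot-comm (idM i) (T (idM i))) (trans
      (dot-idM (T (idM i)) i) (idM-· t i i)))) (∑≡sumΩ (λ i → t i i))

  open Involution T T-linear T² T-dot conj conjSign T-conj (λ e → <-irrefl (sym (trans (sym Tr-T) e)) tr>0)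
    hiding (T-adjoint)

  f-sign : Bool
  f-sign = proj₁ (InR⇒act f∈R)

  f₀ : U d
  f₀ = proj₁ (proj₂ (InR⇒act f∈R))

  F≈ : ∀ x → F x ≈v (sg f-sign *v act f₀ x)
  F≈ = proj₂ (proj₂ (InR⇒act f∈R))

  F² : ∀ x → F (F x) ≈v (-v x)
  F² x = ≈v-trans (≈v-sym (·-∘m x f f)) (≈v-trans (·-cong x f-four) (≈v-trans (·-negM x idM) (λ i →
      cong -_ (·-idM x i))))

  TF : ∀ x → T (F x) ≈v F (T x)
  TF x = ≈v-trans (≈v-sym (·-∘m x f t)) (≈v-trans (·-cong x ft) (·-∘m x t f))

  act-f₀ : ∀ x → act f₀ x ≈v (sg f-sign *v F x)
  act-f₀ x = ≈v-sym (sg-*v-cancel f-sign (F≈ x))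

  sq-f₀ : sq f₀ ≡ true
  sq-f₀ = ≡-from-sg (sq f₀) true (idM zeroV) (λ e → 1≢0 (trans (sym (dot-idM-self (zeroV {d}))) e))
    (≈v-trans (≈v-sym (act-sq f₀ x)) (≈v-trans (act-f₀ (act f₀ x)) (≈v-trans (*v-cong (sg f-sign)
      (≈v-trans (Linear.≈-cong F-linear (act-f₀ x)) (Linear.*-homo F-linear (sg f-sign) (F x))))
      (λ i → trans (sg-cancel f-sign (F (F x) i)) (trans (F² x i) (neg≡-1* (x i)))))))
    where
    x : Vect d
    x = idM zeroV

  Tf₀ : ∀ x → T (act f₀ x) ≈v act f₀ (T x)
  Tf₀ x = ≈v-trans (Linear.≈-cong T-linear (act-f₀ x)) (≈v-trans (Linear.*-homo T-linear (sg f-sign) (F x))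
    (≈v-trans (*v-cong (sg f-sign) (TF x)) (≈v-sym (act-f₀ (T x)))))

  N-sg : ∀ b n {x : Vect d} → N d n x → N d n (sg b *v x)
  N-sg false n {x} h = N-resp d n (λ i → sym (*-identityˡ (x i))) h
  N-sg true n {x} h = N-resp d n (λ i → neg≡-1* (x i)) (N-neg d n h)

  N-F : ∀ n {x} → N d n x → N d n (F x)
  N-F n {x} h = N-resp d n (≈v-sym (F≈ x)) (N-sg f-sign n (N-act d n f₀ h))

  N-halfDiff-F : ∀ n {x} → N d n x → N d (suc n) (halfDiff F x)
  N-halfDiff-F n {x} h = N-resp d (suc n) (λ i → cong (λ z → ½ * (z - x i)) (sym (F≈ x i))) (signed f-sign)
    where
    signed : ∀ b → N d (suc n) (λ i → ½ * (sg b * act f₀ x i - x i))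
    signed false = N-resp d (suc n) (λ i → cong (λ z → ½ * (z - x i)) (sym (*-identityˡ (act f₀ x i))))
        (N-halfDiff-act d n f₀ h)
    signed true = N-resp d (suc n) (λ i → lem (act f₀ x i) (x i)) (N-neg d (suc n) (N-+ d (suc n)
        (N-halfDiff-act d n f₀ h) (N-mono d n h)))
      where
      lem : ∀ a b → - (½ * (a - b) + b) ≡ ½ * (- 1ℚ * a - b)
      lem = solve 2 (λ a b → :- (con ½ :* (a :- b) :+ b) := con ½ :* (con (- 1ℚ) :* a :- b)) refl

  -- If T centralized R/{±1}, the fixed space would have 2^2d elements.
  not-all-fixed : ¬ (∀ r → W r ≡ 0U)
  not-all-fixed all = no-injection coords coords-injective n<2d
    where
    k≤d : k ℕ.≤ d
    k≤d = proj₁ defect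
    rs : Vec (Mat d) (2 ℕ.* (d ℕ.∸ k))
    rs = proj₁ (proj₂ defect)
    span : ∀ r → FixedMod d t r → ∃ λ c → (r ≈m prodSel c rs) ⊎ (r ≈m negM (prodSel c rs))
    span = proj₂ (proj₂ (proj₂ (proj₂ defect)))
    fixed : ∀ r → FixedMod d t (actM r)
    fixed r = InR-actM r , choose (conjSign r) refl
      where
      op : ∀ x → (x · ((t ∘m actM r) ∘m t)) ≈v (sg (conjSign r) *v act r x)
      op x = ≈v-trans (·-∘m x (t ∘m actM r) t) (≈v-trans (Linear.≈-cong T-linear
          (≈v-trans (·-∘m x t (actM r)) (·-actM r (T x))))
        (≈v-trans (T-conj r x) (λ i → cong (λ g → sg (conjSign r) * act g x i) (⊞-zero⇒≡ (all r)))))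
      choose : ∀ b → conjSign r ≡ b → (((t ∘m actM r) ∘m t) ≈m actM r) ⊎ (((t ∘m actM r) ∘m t) ≈m negM (actM r))
      choose false e = inj₁ (·-ext λ x → ≈v-trans (op x) (λ i → trans (cong (λ b → sg b * act r x i) e)
          (trans (*-identityˡ (act r x i)) (sym (·-actM r x i)))))
      choose true e = inj₂ (·-ext λ x → ≈v-trans (op x) (λ i → trans (cong (λ b → sg b * act r x i) e)
        (trans (-1*≡neg (act r x i)) (trans (cong -_ (sym (·-actM r x i))) (sym (·-negM x (actM r) i))))))
    coords : U d → Vec Bool (2 ℕ.* (d ℕ.∸ k))
    coords r = proj₁ (span (actM r) (fixed r))
    signed : ∀ r → ∃ λ b → ∀ x → act r x ≈v (sg b *v (x · prodSel (coords r) rs))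
    signed r with proj₂ (span (actM r) (fixed r))
    ... | inj₁ e = false , λ x → ≈v-trans (≈v-sym (·-actM r x)) (≈v-trans (·-cong x e) (λ i → sym (*-identityˡ ((x · prodSel (coords r) rs) i))))
    ... | inj₂ e = true , λ x → ≈v-trans (≈v-sym (·-actM r x)) (≈v-trans (·-cong x e) (≈v-trans (·-negM x (prodSel (coords r) rs)) (λ i → neg≡-1* ((x · prodSel (coords r) rs) i))))
    coords-injective : ∀ {r s} → coords r ≡ coords s → r ≡ s
    coords-injective {r} {s} e with signed r | signed s
    ... | b , p | b' , p' = act-injective (b xor b') λ x → ≈v-trans (p x) (≈v-trans
      (*v-cong (sg b) (≈v-trans (λ i → cong (λ c → (x · prodSel c rs) i) e) (≈v-sym
          (sg-*v-cancel b' (p' x))))) (sg-*v b b' (act s x)))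
    -- The defect enters here: k ≥ 1 makes the dimension 2(d - k) of the fixed space smaller than
    -- that of R/Z.
    n<2d : 2 ℕ.* (d ℕ.∸ k) ℕ.< d ℕ.+ d
    n<2d = subst (2 ℕ.* (d ℕ.∸ k) ℕ.<_) (cong (d ℕ.+_) (ℕₚ.+-identityʳ d)) (ℕₚ.*-monoʳ-< 2 (ℕₚ.∸-monoʳ-< 1≤k k≤d))

  nonfixed : ∃ λ r₁ → ∃ λ r₂ → κ r₁ (W r₂) ≡ true
  nonfixed = conclude (search (allU d))
    where
    search : ∀ rs → All (λ r → W r ≡ 0U) rs ⊎ ∃ λ r₁ → ∃ λ r₂ → κ r₁ (W r₂) ≡ true
    search [] = inj₁ []
    search (r ∷ rs) = try (κ-nondegenerate (W r)) (search rs)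
      where
      try : W r ≡ 0U ⊎ (∃ λ h → κ (W r) h ≡ true) → All (λ r → W r ≡ 0U) rs ⊎ (∃ λ r₁ → ∃ λ r₂ → κ r₁ (W r₂) ≡ true) →
        All (λ r → W r ≡ 0U) (r ∷ rs) ⊎ ∃ λ r₁ → ∃ λ r₂ → κ r₁ (W r₂) ≡ true
      try (inj₂ (h , e)) _ = inj₂ (h , r , trans (κ-sym h (W r)) e)
      try (inj₁ e) (inj₁ es) = inj₁ (e ∷ es)
      try (inj₁ e) (inj₂ found) = inj₂ found
    conclude : All (λ r → W r ≡ 0U) (allU d) ⊎ (∃ λ r₁ → ∃ λ r₂ → κ r₁ (W r₂) ≡ true) → ∃ λ r₁ → ∃ λ r₂ →
        κ r₁ (W r₂) ≡ true
    conclude (inj₂ found) = found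
    conclude (inj₁ es) = ⊥-elim (not-all-fixed λ r → All.lookup es (∈-allU r))

  -- The hypothesis on t concerns the lattice given by generators, so both inclusions between it and
  -- `N d 0` are used.
  N-T : ∀ {x} → N d 0 x → N d 0 (T x)
  N-T {x} h = InBW⇒N (proj₁ (proj₂ t∈G) x (N⇒InBW h))

  F-dot : ∀ x → dot (F x) (F x) ≡ dot x x
  F-dot x = trans (dot-cong (F≈ x) (F≈ x)) (trans (dot-*ˡ (sg f-sign) (act f₀ x) (sg f-sign *v act f₀ x))
    (trans (cong (sg f-sign *_) (dot-*ʳ (sg f-sign) (act f₀ x) (act f₀ x))) (trans (sg-cancel f-sign
        (dot (act f₀ x) (act f₀ x))) (act-dot f₀ x x))))

  F-skew : ∀ x → dot (F x) x ≡ 0ℚ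
  F-skew x = trans (dot-congˡ x (F≈ x)) (trans (dot-*ˡ (sg f-sign) (act f₀ x) x) (trans
      (cong (sg f-sign *_) (x≡-x⇒0 skew)) (*-zeroʳ (sg f-sign))))
    where
    skew : dot (act f₀ x) x ≡ - dot (act f₀ x) x
    skew = trans (dot-actˡ f₀ x x) (trans (cong (λ b → sg b * dot x (act f₀ x)) sq-f₀) (trans (-1*≡neg
        (dot x (act f₀ x))) (cong -_ (dot-comm x (act f₀ x)))))

  dot-minus : ∀ (a b : Vect d) → dot (a +v (-v b)) (a +v (-v b)) ≡ (dot a a + dot b b) - (dot a b + dot a b)
  dot-minus a b = trans (dot-cong neg≡ neg≡) (trans (dot-+ˡ a ((- 1ℚ) *v b) (a +v ((- 1ℚ) *v b)))
    (trans (cong₂ _+_ (trans (dot-+ʳ a a ((- 1ℚ) *v b)) (cong (dot a a +_) (dot-*ʳ (- 1ℚ) a b)))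
       (trans (dot-*ˡ (- 1ℚ) b (a +v ((- 1ℚ) *v b))) (cong (- 1ℚ *_) (trans (dot-+ʳ b a ((- 1ℚ) *v b))
           (cong₂ _+_ (dot-comm b a) (dot-*ʳ (- 1ℚ) b b))))))
       (lem (dot a a) (dot a b) (dot b b))))
    where
    neg≡ : (a +v (-v b)) ≈v (a +v ((- 1ℚ) *v b))
    neg≡ i = cong (a i +_) (neg≡-1* (b i))
    lem : ∀ p q r → (p + - 1ℚ * q) + - 1ℚ * (q + - 1ℚ * r) ≡ (p + r) - (q + q)
    lem = solve 3 (λ p q r →
        (p :+ con (- 1ℚ) :* q) :+ con (- 1ℚ) :* (q :+ con (- 1ℚ) :* r) := (p :+ r) :- (q :+ q)) refl

  dot-timesFm1 : ∀ v → dot (timesFm1 v f) (timesFm1 v f) ≡ dot v v + dot v v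
  dot-timesFm1 v = trans (dot-minus (F v) v) (trans (cong₂ (λ a b →
      (a + dot v v) - (b + b)) (F-dot v) (F-skew v)) (+-identityʳ (dot v v + dot v v)))

  module Eigenlattice (ε : Sgn) where

    e : Bool
    e = proj₁ (sgn≈ {d} ε)

    sgn-e : ∀ (x : Vect d) → sgn ε x ≈v (sg e *v x)
    sgn-e = proj₂ (sgn≈ ε)

    open Witnesses F F-linear TF N-halfDiff-F e

    L⇒N : ∀ {x} → Leps d t ε x → N d 0 x
    L⇒N (h , _) = InBW⇒N h

    L⇒T : ∀ {x} → Leps d t ε x → T x ≈v (sg e *v x)
    L⇒T {x} (_ , p) = ≈v-trans p (sgn-e x)

    toL : ∀ {x} → N d 0 x → T x ≈v (sg e *v x) → Leps d t ε x
    toL {x} h p = N⇒InBW h , ≈v-trans p (≈v-sym (sgn-e x))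

    QSpan⇒T : ∀ {x} → QSpan (Leps d t ε) x → T x ≈v (sg e *v x)
    QSpan⇒T qs-zero i = trans (Linear.0-homo T-linear i) (sym (*-zeroʳ (sg e)))
    QSpan⇒T (qs-gen q {x} p) i = trans (Linear.*-homo T-linear q x i) (trans
        (cong (q *_) (L⇒T p i)) (*-swap q (sg e) (x i)))
    QSpan⇒T (qs-add {x} {y} p q) i = trans (Linear.+-homo T-linear x y i) (trans
        (cong₂ _+_ (QSpan⇒T p i) (QSpan⇒T q i)) (sym (*-distribˡ-+ (sg e) (x i) (y i))))
    QSpan⇒T (qs-resp {x} {y} r p) i = trans (Linear.≈-cong T-linear (≈v-sym r) i) (trans (QSpan⇒T p i)
        (cong (sg e *_) (r i)))

    QSpan-* : ∀ q {x} → QSpan (Leps d t ε) x → QSpan (Leps d t ε) (q *v x)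
    QSpan-* q qs-zero = qs-resp (λ i → sym (*-zeroʳ q)) qs-zero
    QSpan-* q (qs-gen r {x} p) = qs-resp (λ i → *-assoc q r (x i)) (qs-gen (q * r) p)
    QSpan-* q (qs-add {x} {y} p p') = qs-resp (λ i →
        sym (*-distribˡ-+ q (x i) (y i))) (qs-add (QSpan-* q p) (QSpan-* q p'))
    QSpan-* q (qs-resp r p) = qs-resp (*v-cong q r) (QSpan-* q p)

    twiceP : Vect d → Vect d
    twiceP x = x +v (sg e *v T x)

    twiceP∈L : ∀ {x} → N d 0 x → Leps d t ε (twiceP x)
    twiceP∈L {x} h = toL (N-+ d 0 h (N-sg e 0 (N-T h))) λ i → trans (Linear.+-homo T-linear x (sg e *v T x) i)
      (trans (cong (T x i +_) (trans (Linear.*-homo T-linear (sg e) (T x) i) (cong (sg e *_) (T² x i))))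
      (trans (+-comm (T x i) (sg e * x i)) (trans (cong (sg e * x i +_) (sym (sg-cancel e (T x i))))
          (sym (*-distribˡ-+ (sg e) (x i) (sg e * T x i))))))

    twiceP-orthogonal : ∀ x {y} → T y ≈v (sg e *v y) → dot (x +v (-v (½ *v twiceP x))) y ≡ 0ℚ
    twiceP-orthogonal x {y} ty = trans (dot-congˡ y (λ i → expand (x i) (sg e) (T x i)))
      (trans (dot-+ˡ (½ *v x) ((- ½ * sg e) *v T x) y) (trans (cong₂ _+_ (dot-*ˡ ½ x y)
        (trans (dot-*ˡ (- ½ * sg e) (T x) y) (trans (cong ((- ½ * sg e) *_) (trans (T-adjoint x y) (trans
            (dot-congʳ x ty) (dot-*ʳ (sg e) x y))))
          (trans (*-assoc (- ½) (sg e) (sg e * dot x y)) (cong (- ½ *_) (sg-cancel e (dot x y))))))) (lem (dot x y))))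
      where
      expand : ∀ x s z → x + - (½ * (x + s * z)) ≡ ½ * x + (- ½ * s) * z
      expand = solve 3 (λ x s z → x :+ :- (con ½ :* (x :+ s :* z)) := con ½ :* x :+ (con (- ½) :* s) :* z) refl
      lem : ∀ q → ½ * q + - ½ * q ≡ 0ℚ
      lem = solve 1 (λ q → con ½ :* q :+ con (- ½) :* q := con 0ℚ) refl

    ip≡0 : ∀ x y → dot x y ≡ 0ℚ → ip d x y ≡ 0ℚ
    ip≡0 x y p = trans (ip≡dot d x y) (trans (cong (pow2 (d ℕ./ 2) *_) p) (*-zeroʳ (pow2 (d ℕ./ 2))))

    proj-exists : ∀ {x} → N d 0 x → IsOrthProj d (Leps d t ε) x (½ *v twiceP x)
    proj-exists {x} h = qs-gen ½ (twiceP∈L h) , λ y q →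
        ip≡0 (x +v (-v (½ *v twiceP x))) y (twiceP-orthogonal x (QSpan⇒T q))

    -- An element of M_ε comes with some z that satisfies the defining property of the projection.
    -- Its difference D from (x + εTx)/2 lies in the rational span of L^ε(t) and is orthogonal to D
    -- itself, so it vanishes.
    proj-unique : ∀ {x z} → N d 0 x → IsOrthProj d (Leps d t ε) x z → z ≈v (½ *v twiceP x)
    proj-unique {x} {z} h (qz , orth) i = diff≡0 (z i) (½ * twiceP x i) (dot≡0⇒≈0 D DD i)
      where
      D : Vect d
      D = z +v ((- 1ℚ) *v (½ *v twiceP x))
      qD : QSpan (Leps d t ε) D
      qD = qs-add qz (QSpan-* (- 1ℚ) (qs-gen ½ (twiceP∈L h)))
      diff≡0 : ∀ a b → a + - 1ℚ * b ≡ 0ℚ → a ≡ b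
      diff≡0 a b p = trans (lem a b) (trans (cong (_+ b) p) (+-identityˡ b))
        where
        lem : ∀ a b → a ≡ (a + - 1ℚ * b) + b
        lem = solve 2 (λ a b → a := (a :+ con (- 1ℚ) :* b) :+ b) refl
      orth₁ : dot (x +v (-v z)) D ≡ 0ℚ
      orth₁ = trans (ip-cancel d {x +v (-v z)} {D} {0v} {D} (trans (orth D qD) (sym (ip≡0 0v D (dot-0ˡ D))))) (dot-0ˡ D)
      orth₂ : dot (x +v (-v (½ *v twiceP x))) D ≡ 0ℚ
      orth₂ = twiceP-orthogonal x (QSpan⇒T qD)
      split : D ≈v ((x +v (-v (½ *v twiceP x))) +v ((- 1ℚ) *v (x +v (-v z))))
      split i = lem (x i) (z i) (½ * twiceP x i)
        where
        lem : ∀ x z p → z + - 1ℚ * p ≡ (x + - p) + - 1ℚ * (x + - z)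
        lem = solve 3 (λ x z p → z :+ con (- 1ℚ) :* p := (x :+ :- p) :+ con (- 1ℚ) :* (x :+ :- z)) refl
      DD : dot D D ≡ 0ℚ
      DD = trans (dot-congˡ D split) (trans (dot-+ˡ (x +v (-v (½ *v twiceP x))) ((- 1ℚ) *v (x +v (-v z))) D)
        (cong₂ _+_ orth₂ (trans (dot-*ˡ (- 1ℚ) (x +v (-v z)) D) (cong (- 1ℚ *_) orth₁))))

    M : Vect d → Set
    M = InM d t f ε

    M·Fm1⊆L : ∀ {v} → M v → Leps d t ε (timesFm1 v f)
    M·Fm1⊆L {v} (a , z , La , (x , x∈BW , pz) , v≈) = toL
      (N-resp d 0 (≈v-sym image) (N-+ d 0 (N-+ d 0 (N-F 0 (L⇒N La)) (N-neg d 0 (L⇒N La))) (N-neg d 0 (N-F 0 (L⇒N Ls)))))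
      (≈v-trans (Linear.≈-cong T-linear image) (≈v-trans T-image (*v-cong (sg e) (≈v-sym image))))
      where
      s : Vect d
      s = twiceP x
      Ls : Leps d t ε s
      Ls = twiceP∈L (InBW⇒N x∈BW)
      z≈ : z ≈v (½ *v s)
      z≈ = proj-unique (InBW⇒N x∈BW) pz
      w : Vect d
      w = (F a +v (-v a)) +v (-v F s)
      v≈' : v ≈v (a +v (½ *v (F s +v (-v s))))
      v≈' i = trans (v≈ i) (cong (a i +_) (trans (cong₂ (λ p q → p + - q) (trans (Linear.≈-cong F-linear z≈ i)
          (Linear.*-homo F-linear ½ s i)) (z≈ i)) (lem (F s i) (s i))))
        where
        lem : ∀ p q → ½ * p + - (½ * q) ≡ ½ * (p + - q)
        lem = solve 2 (λ p q → con ½ :* p :+ :- (con ½ :* q) := con ½ :* (p :+ :- q)) refl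
      Fv : F v ≈v (F a +v (½ *v ((-v s) +v (-v F s))))
      Fv i = trans (Linear.≈-cong F-linear v≈' i) (trans (Linear.+-homo F-linear a (½ *v (F s +v (-v s))) i)
          (cong (F a i +_)
        (trans (Linear.*-homo F-linear ½ (F s +v (-v s)) i) (cong (½ *_) (trans
            (Linear.+-homo F-linear (F s) (-v s) i) (cong₂ _+_ (F² s i) (Linear.neg-homo F-linear s i)))))))
      image : timesFm1 v f ≈v w
      image i = trans (cong₂ (λ p q → p + - q) (Fv i) (v≈' i)) (lem (F a i) (a i) (F s i) (s i))
        where
        lem : ∀ fa a fs s → (fa + ½ * (- s + - fs)) + - (a + ½ * (fs + - s)) ≡ (fa + - a) + - fs
        lem = solve 4 (λ fa a fs s →
            (fa :+ con ½ :* (:- s :+ :- fs)) :+ :- (a :+ con ½ :* (fs :+ :- s)) := (fa :+ :- a) :+ :- fs) refl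
      TFx : ∀ {x} → T x ≈v (sg e *v x) → T (F x) ≈v (sg e *v F x)
      TFx {x} p = ≈v-trans (TF x) (≈v-trans (Linear.≈-cong F-linear p) (Linear.*-homo F-linear (sg e) x))
      T-image : T w ≈v (sg e *v w)
      T-image i = trans (Linear.+-homo T-linear (F a +v (-v a)) (-v F s) i)
        (trans (cong₂ _+_ (trans (Linear.+-homo T-linear (F a) (-v a) i) (cong₂ _+_ (TFx (L⇒T La) i) (trans
            (Linear.neg-homo T-linear a i) (cong -_ (L⇒T La i)))))
           (trans (Linear.neg-homo T-linear (F s) i) (cong -_ (TFx (L⇒T Ls) i))))
        (lem (sg e) (F a i) (a i) (F s i)))
        where
        lem : ∀ e fa a fs → (e * fa + - (e * a)) + - (e * fs) ≡ e * ((fa + - a) + - fs)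
        lem = solve 4 (λ e fa a fs → (e :* fa :+ :- (e :* a)) :+ :- (e :* fs) := e :* ((fa :+ :- a) :+ :- fs)) refl

    BW-bound : ∀ w → InBW d w → ¬ w ≈v 0v → 1ℚ ≤ dot w w
    BW-bound w h nz = N-min d 0 (InBW⇒N h) nz

    double≡ : ∀ q → q ≡ ½ * (q + q)
    double≡ = solve 1 (λ q → q := con ½ :* (q :+ q)) refl

    M-bound : ∀ v → M v → ¬ v ≈v 0v → ½ ≤ dot v v
    M-bound v m nz = subst₂ _≤_ (*-identityʳ ½) (trans (cong (½ *_) (dot-timesFm1 v)) (sym (double≡ (dot v v))))
      (½-mono (BW-bound (timesFm1 v f) (proj₁ (M·Fm1⊆L m))
        (λ z → nz (dot≡0⇒≈0 v (trans (double≡ (dot v v)) (trans (cong (½ *_) (trans (sym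
            (dot-timesFm1 v)) (≈0⇒dot≡0 z))) (*-zeroʳ ½)))))))

    the-witness : Witness
    the-witness = let (r₁ , r₂ , k) = nonfixed
                      (y , good , es) = joint-eigenvector-even f₀ sq-f₀ Tf₀
                  in witness good es r₁ r₂ k

    open Witness the-witness using (u; u-unit)

    L-attained : ∃ λ u → Leps d t ε u × dot u u ≡ 1ℚ
    L-attained = u , toL (Witness.u∈N the-witness) (Witness.Tu the-witness) , u-unit

    v₀ : Vect d
    v₀ = halfDiff F u

    v₀∈M : M v₀
    v₀∈M = a , ½ *v twiceP x , toL a∈N Ta , (x , N⇒InBW x∈N , proj-exists x∈N) ,
      λ i → trans (decomposition i) (cong (a i +_) (trans (lem (F (twiceP x) i) (twiceP x i))
        (cong (_+ - (½ * twiceP x i)) (sym (Linear.*-homo F-linear ½ (twiceP x) i)))))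
      where
      open Witness the-witness
      lem : ∀ p q → ½ * (p - q) ≡ ½ * p + - (½ * q)
      lem = solve 2 (λ p q → con ½ :* (p :- q) := con ½ :* p :+ :- (con ½ :* q)) refl

    v₀-norm : dot v₀ v₀ ≡ ½
    v₀-norm = trans (dot-*ˡ ½ (timesFm1 u f) (½ *v timesFm1 u f)) (cong (½ *_)
      (trans (dot-*ʳ ½ (timesFm1 u f) (timesFm1 u f)) (trans (cong (½ *_) (dot-timesFm1 u)) (trans
          (sym (double≡ (dot u u))) u-unit))))

    1>0 : 0ℚ < 1ℚ
    1>0 = positive⁻¹ 1ℚ

    ½>0 : 0ℚ < ½
    ½>0 = positive⁻¹ ½

    M-minimal : ∀ v → IsMinimalVec d M v ⇔ (M v × dot v v ≡ ½)
    M-minimal = minimal⇔ d ½>0 M-bound (v₀ , v₀∈M , v₀-norm)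

    L-minimal : ∀ w → IsMinimalVec d (Leps d t ε) w ⇔ (Leps d t ε w × dot w w ≡ 1ℚ)
    L-minimal = minimal⇔ d 1>0 (λ w l → BW-bound w (proj₁ l)) L-attained

    BW-minimal : ∀ w → IsMinimalVec d (InBW d) w ⇔ (InBW d w × dot w w ≡ 1ℚ)
    BW-minimal = minimal⇔ d 1>0 BW-bound (u , proj₁ (proj₁ (proj₂ L-attained)) , u-unit)

    minNorm : HasMinNorm d M (pow2 (d ℕ./ 2) * ½)
    minNorm = (v₀ , v₀∈M , (λ z → <-irrefl (sym (trans
        (sym v₀-norm) (≈0⇒dot≡0 z))) ½>0) , trans (ip≡dot d v₀ v₀) (cong (pow2 (d ℕ./ 2) *_) v₀-norm)) ,
      λ v m nz → subst (_≤ norm d v) (trans (ip≡dot d v₀ v₀)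
          (cong (pow2 (d ℕ./ 2) *_) v₀-norm)) (norm-mono d {v₀} {v} (subst (_≤ dot v v) (sym v₀-norm) (M-bound v m nz)))

    M-minimal⇔L-minimal : ∀ v → M v → IsMinimalVec d M v ⇔ IsMinimalVec d (Leps d t ε) (timesFm1 v f)
    M-minimal⇔L-minimal v m = mk⇔
      (λ h → from (L-minimal (timesFm1 v f)) (M·Fm1⊆L m , trans (dot-timesFm1 v) (cong (λ q →
          q + q) (proj₂ (to (M-minimal v) h)))))
      (λ h → from (M-minimal v) (m , trans (double≡ (dot v v)) (cong (½ *_) (trans (sym
          (dot-timesFm1 v)) (proj₂ (to (L-minimal (timesFm1 v f)) h))))))
      where open Equivalence

    L-minimal⇔BW-minimal : ∀ w → IsMinimalVec d (Leps d t ε) w ⇔ (IsMinimalVec d (InBW d) w × Leps d t ε w)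
    L-minimal⇔BW-minimal w = mk⇔
      (λ h → let (l , q) = to (L-minimal w) h in from (BW-minimal w) (proj₁ l , q) , l)
      (λ { (h , l) → from (L-minimal w) (l , proj₂ (to (BW-minimal w) h)) })
      where open Equivalence

    -- The squared norm ½ is below the minimum 1 of BW_d.
    M-minimal∉L : ∀ v → IsMinimalVec d M v → ¬ Leps d t ε v
    M-minimal∉L v h l = ½≱1 (subst (1ℚ ≤_) q (BW-bound v (proj₁ l) (proj₁ (proj₂ h))))
      where
      q : dot v v ≡ ½
      q = proj₂ (Equivalence.to (M-minimal v) h)
      ½≱1 : ¬ 1ℚ ≤ ½
      ½≱1 (*≤* (ℤ.+≤+ (s≤s ())))

-- Oddness of d identifies δ with the exponent ⌊d/2⌋ of the scaling of the inner product. The lower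
-- bound on d gives δ ≥ 1, so the truncated δ - 1 is the true one.
half-dim : ∀ d k → d ℕ.% 2 ≡ 1 → 2 ℕ.* k ℕ.+ 3 ℕ.≤ d → pow2 (d ℕ./ 2) * ½ ≡ pow2 (((d ℕ.∸ 1) ℕ./ 2) ℕ.∸ 1)
half-dim d k odd bound = trans (cong (λ m → pow2 m * ½) (sym (ℕₚ.m+[n∸m]≡n {1} {d ℕ./ 2} 1≤)))
  (trans (cong (_* ½) (pow2-suc (d ℕ./ 2 ℕ.∸ 1))) (trans (lem (pow2 (d ℕ./ 2 ℕ.∸ 1))) (cong (λ m →
      pow2 (m ℕ.∸ 1)) (sym quotient))))
  where
  lem : ∀ q → (q + q) * ½ ≡ q
  lem = solve 1 (λ q → (q :+ q) :* con ½ := q) refl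
  1≤ : 1 ℕ.≤ d ℕ./ 2
  1≤ = /-monoˡ-≤ 2 (ℕₚ.≤-trans (ℕₚ.≤-trans (s≤s (s≤s z≤n)) (ℕₚ.m≤n+m 3 (2 ℕ.* k))) bound)
  quotient : (d ℕ.∸ 1) ℕ./ 2 ≡ d ℕ./ 2
  quotient = trans (cong (λ n → (n ℕ.∸ 1) ℕ./ 2) (trans (m≡m%n+[m/n]*n d 2)
      (cong (ℕ._+ d ℕ./ 2 ℕ.* 2) odd))) (m*n/n≡m (d ℕ./ 2) 2)

theorem3p9 : (d k : ℕ) → d ℕ.% 2 ≡ 1 → 1 ℕ.≤ k → 2 ℕ.* k ℕ.+ 3 ℕ.≤ d →
    (t : Mat d) → InG d t → IsInvolution t → HasDefect d t k → 0ℚ < trace d t →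
    (f : Mat d) → InR d f → IsFourvolution f → (f ∘m t) ≈m (t ∘m f) →
    (ε : Sgn) →
    HasMinNorm d (InM d t f ε) (pow2 (((d ℕ.∸ 1) ℕ./ 2) ℕ.∸ 1))
    × (∀ v → InM d t f ε v →
    (IsMinimalVec d (InM d t f ε) v ⇔ IsMinimalVec d (Leps d t ε) (timesFm1 v f))
    × (IsMinimalVec d (Leps d t ε) (timesFm1 v f)
    ⇔ (IsMinimalVec d (InBW d) (timesFm1 v f) × Leps d t ε (timesFm1 v f))))
    × (∀ v → IsMinimalVec d (InM d t f ε) v → ¬ Leps d t ε v)
theorem3p9 d k odd 1≤k bound t t∈G t-inv defect tr>0 f f∈R f-four ft ε =
    subst (HasMinNorm d (InM d t f ε)) (half-dim d k odd bound) minNorm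
  , (λ v m → M-minimal⇔L-minimal v m , L-minimal⇔BW-minimal (timesFm1 v f))
  , M-minimal∉L
  where
  open Setting 1≤k t t∈G t-inv defect tr>0 f f∈R f-four ft
  open Eigenlattice ε
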